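{- For every prime $l$ and every integer $n\ge1$, \[ (k_n)_l\equiv 1\pmod{2^n}, \] where $(k_n)_l=\left|(RE_n^+/A_n)_l\right|$ is the order of the $l$-primary part of $RE_n^+/A_n$.
   Context: $X_j=2\cos(2\pi/2^{j+2})$ for $j\ge0$, $\mathbb{B}_j=\mathbb{Q}(X_j)$ with ring of integers $\mathbb{Z}[X_j]$, class number $h_j$, $G_j=\mathrm{Gal}(\mathbb{B}_j/\mathbb{Q})$ cyclic of order $2^j$ generated by $\sigma$, $E_j$ the unit group. $N_{n/n-1}:E_n\to E_{n-1}$, $x\mapsto x\sigma^{2^{n-1}}(x)$; $RE_n^+=\ker N_{n/n-1}$; $C_n=\langle -1,1+X_n\rangle_{\mathbb{Z}[G_n]}$ the circular units; $A_n=RE_n^+\cap C_n$. The group $RE_n^+/A_n$ is finite, of order $k_n=h_n/h_{n-1}$. The $l$-primary part $(RE_n^+/A_n)_l$ is the subgroup of elements of $l$-power order. -}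

module Defs where

open import Data.Nat as ℕ using (ℕ; zero; suc; _^_; _∸_)
open import Data.Integer as ℤ using (ℤ; +_; -[1+_])
open import Data.List using (List; []; _∷_)
open import Data.List.Relation.Unary.All using (All)
open import Data.Vec using (Vec; lookup; toList)
open import Data.Fin using (Fin)
open import Data.Bool using (Bool; true; false)
open import Data.Product using (Σ; ∃; _×_)
open import Relation.Binary.PropositionalEquality using (_≡_)

-- Integer polynomials as coefficient lists (constant term first).
-- B_n = Q(X_n) has ring of integers Z[X_n] ≅ Z[x]/(m_n), where m_n is
-- the minimal polynomial of X_n = 2cos(2π/2^{n+2}).  We represent
-- elements of Z[X_n] by polynomials, with equality modulo m_n.

Poly : Set
Poly = List ℤ

infixl 6 _+ₚ_ _-ₚ_
infixl 7 _*ₚ_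

_+ₚ_ : Poly → Poly → Poly
[] +ₚ q = q
(a ∷ p) +ₚ [] = a ∷ p
(a ∷ p) +ₚ (b ∷ q) = (a ℤ.+ b) ∷ (p +ₚ q)

scale : ℤ → Poly → Poly
scale c [] = []
scale c (a ∷ p) = (c ℤ.* a) ∷ scale c p

negₚ : Poly → Poly
negₚ = scale (ℤ.- (+ 1))

_-ₚ_ : Poly → Poly → Poly
p -ₚ q = p +ₚ negₚ q

_*ₚ_ : Poly → Poly → Poly
[] *ₚ q = []
(a ∷ p) *ₚ q = scale a q +ₚ ((+ 0) ∷ (p *ₚ q))

const : ℤ → Poly
const c = c ∷ []

oneₚ : Poly
oneₚ = const (+ 1)

Xₚ : Poly
Xₚ = (+ 0) ∷ (+ 1) ∷ []

powₚ : Poly → ℕ → Poly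
powₚ p zero = oneₚ
powₚ p (suc k) = p *ₚ powₚ p k

compose : Poly → Poly → Poly
compose [] r = []
compose (a ∷ p) r = const a +ₚ r *ₚ compose p r

-- minimal polynomial of X_j = 2cos(2π/2^{j+2}):
-- X_0 = 0, and X_{j+1}^2 = 2 + X_j, so m_0 = x, m_{j+1}(x) = m_j(x^2 - 2).
minPoly : ℕ → Poly
minPoly zero = Xₚ
minPoly (suc j) = compose (minPoly j) (Xₚ *ₚ Xₚ -ₚ const (+ 2))

IsZeroₚ : Poly → Set
IsZeroₚ p = All (_≡ + 0) p

_≈[_]_ : Poly → ℕ → Poly → Set
p ≈[ n ] q = ∃ λ r → IsZeroₚ (p -ₚ q -ₚ r *ₚ minPoly n)

-- The generator σ of G_n: X_n ↦ 2cos(3·2π/2^{n+2}) = X_n^3 - 3 X_n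
-- (3 generates (Z/2^{n+2})^× / {±1}).

σ : Poly → Poly
σ p = compose p (Xₚ *ₚ Xₚ *ₚ Xₚ -ₚ scale (+ 3) Xₚ)

σ^ : ℕ → Poly → Poly
σ^ zero p = p
σ^ (suc i) p = σ (σ^ i p)

IsUnit : ℕ → Poly → Set
IsUnit n u = ∃ λ v → (u *ₚ v) ≈[ n ] oneₚ

-- relative norm N_{n/n-1}(x) = x σ^{2^{n-1}}(x);  RE_n^+ = its kernel in E_n
InRE : ℕ → Poly → Set
InRE n u = IsUnit n u × ((u *ₚ σ^ (2 ^ (n ∸ 1)) u) ≈[ n ] oneₚ)

-- Circular units C_n = ⟨-1, 1+X_n⟩_{Z[G_n]}: elements
--   ± ∏_{i < 2^n} σ^i(1+X_n)^{a_i},   a_i ∈ ℤ.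
-- To avoid inverses, u = ± ∏ σ^i(1+X)^{a_i} is written as
--   u · ∏_{a_i<0} σ^i(1+X)^{-a_i} = ± ∏_{a_i≥0} σ^i(1+X)^{a_i}.

posExp : ℤ → ℕ
posExp (+ k) = k
posExp -[1+ k ] = 0

negExp : ℤ → ℕ
negExp (+ k) = 0
negExp -[1+ k ] = suc k

circ : ℕ → Poly
circ i = σ^ i (oneₚ +ₚ Xₚ)

prodPos : ℕ → List ℤ → Poly
prodPos i [] = oneₚ
prodPos i (a ∷ as) = powₚ (circ i) (posExp a) *ₚ prodPos (suc i) as

prodNeg : ℕ → List ℤ → Poly
prodNeg i [] = oneₚ
prodNeg i (a ∷ as) = powₚ (circ i) (negExp a) *ₚ prodNeg (suc i) as

signₚ : Bool → Poly
signₚ true = oneₚ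
signₚ false = const (ℤ.- (+ 1))

InC : ℕ → Poly → Set
InC n u = Σ Bool λ s → Σ (Vec ℤ (2 ^ n)) λ a →
  (u *ₚ prodNeg 0 (toList a)) ≈[ n ] (signₚ s *ₚ prodPos 0 (toList a))

InA : ℕ → Poly → Set
InA n u = InRE n u × InC n u

SameCoset : ℕ → Poly → Poly → Set
SameCoset n u v = ∃ λ a → InA n a × (u ≈[ n ] (v *ₚ a))

LPrimary : ℕ → ℕ → Poly → Set
LPrimary l n u = InRE n u × ∃ λ k → InA n (powₚ u (l ^ k))

LPrimaryOrder : ℕ → ℕ → ℕ → Set
LPrimaryOrder l n m = Σ (Vec Poly m) λ reps →
  ((i : Fin m) → LPrimary l n (lookup reps i)) ×
  ((i j : Fin m) → SameCoset n (lookup reps i) (lookup reps j) → i ≡ j) ×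
  ((u : Poly) → LPrimary l n u → ∃ λ i → SameCoset n u (lookup reps i))

{-# OPTIONS --safe #-}
module Submission where

-- Let θ = 2π/2ⁿ⁺², X = 2cos θ, d = 2ⁿ, η = 1 + X and ηᵢ = σⁱη.
--
-- Since ηᵢ is the quotient of sin(3ⁱ⁺¹θ/2) by sin(3ⁱθ/2), the product of all ηᵢ
-- telescopes to −1.  Hence the circular units are exactly the products ∏ ηᵢ^aᵢ
-- with natural exponents.
--
-- Multiplication by X is a symmetric integral matrix in a suitable basis of
-- ℤ[X], which gives a positive definite form with ⟨xy,z⟩ = ⟨y,xz⟩.  So −v² is not
-- a square for any unit v, and a product ∏ ηᵢ^aᵢ that is a square has even
-- exponents, because 𝔽₂[⟨σ⟩] is local and its socle is spanned by the norm.
-- Consequently the circular units are 2-saturated (the case l = 2), and the only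
-- relations between the ηᵢ come from ∏ ηᵢ = −1.
--
-- For odd l, Cauchy–Schwarz gives ∥x∥²ᵐ ≤ ∥xᵐ∥², so every class of l-power order
-- has a representative of size bounded independently of its order; by the
-- pigeonhole principle the l-primary part is killed by a fixed power M of l.
-- Its classes then correspond to those vectors c ∈ (ℤ/M)ᵈ with
-- c_{i+d/2} = −cᵢ for which ∏ ηᵢ^cᵢ is an M-th power, and this finite set is
-- decidable by the size bound.  The automorphism σ acts on it by rotation, and
-- the rotation by d/2 is negation, which fixes only 0 because M is odd.  So all
-- other orbits have d elements.

open import Level using (0ℓ; _⊔_)
open import Algebra.Bundles using (AbelianGroup; CommutativeRing)
open import Data.Bool using (true; false)
open import Data.Empty using (⊥-elim)
open import Data.Fin as Fin using (Fin; toℕ; finToFun; funToFin)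
import Data.Fin.Properties as Finₚ
open import Data.Integer as ℤ using (ℤ; +_; -[1+_]; ∣_∣)
import Data.Integer.Properties as ℤₚ
open import Data.Integer.Solver using () renaming (module +-*-Solver to ℤ-Solver)
open import Data.List as List using (List; []; _∷_; _++_; length; lookup; applyUpTo; upTo; filter; allFin)
open import Data.List.Properties using (length-++; length-applyUpTo)
open import Data.List.Membership.Propositional using (_∈_; _∉_; lose; find)
open import Data.List.Membership.Propositional.Properties using (∈-∃++; ∈-++⁻; ∈-++⁺ˡ; ∈-++⁺ʳ; ∈-map⁺; ∈-upTo⁺; ∈-applyUpTo⁺; ∈-applyUpTo⁻; ∈-filter⁺; ∈-filter⁻; ∈-allFin; ∈-lookup; ∈-cartesianProductWith⁺)
open import Data.List.Relation.Unary.All as All using (All; []; _∷_)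
open import Data.List.Relation.Unary.AllPairs using ([]; _∷_)
open import Data.List.Relation.Unary.Any as Any using (here; there)
open import Data.List.Relation.Unary.Any.Properties using (lookup-index)
open import Data.List.Relation.Unary.Unique.Propositional using (Unique)
open import Data.List.Relation.Unary.Unique.Propositional.Properties using (applyUpTo⁺₁; allFin⁺; filter⁺)
open import Data.List.Relation.Binary.Subset.Propositional using (_⊆_)
open import Data.List.Relation.Binary.Permutation.Propositional using (_↭_; ↭-refl; ↭-trans; ↭-sym; prep; ↭⇒↭ₛ)
open import Data.List.Relation.Binary.Permutation.Propositional.Properties using (shift; ∈-resp-↭; ↭-length)
open import Data.Nat as ℕ using (ℕ; zero; suc; NonZero; _/_; _%_)
import Data.Nat.Properties as ℕₚ
open import Data.Nat.Divisibility using (_∣_; divides; 1∣_; ∣m+n∣m⇒∣n; ∣m∣n⇒∣m+n; ∣⇒≤; ∣n⇒∣m*n; m∣m*n; *-monoʳ-∣; m%n≡0⇒n∣m; n∣m⇒m%n≡0; _∣?_)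
open import Data.Nat.DivMod using (m≡m%n+[m/n]*n; m%n<n; [m+kn]%n≡m%n; m<n⇒m%n≡m; m*[n/m]≡n; %-distribˡ-+; _mod_)
open import Data.Nat.GeneralisedArithmetic using (fold)
open import Data.Nat.Primality using (Prime; prime⇒irreducible; prime⇒nonZero)
open import Data.Nat.Solver using () renaming (module +-*-Solver to ℕ-Solver)
open import Data.Product using (Σ; ∃; ∃₂; _×_; _,_; proj₁; proj₂)
open import Data.Sum using (_⊎_; inj₁; inj₂)
open import Data.Vec as Vec using (Vec; []; _∷_; zipWith; replicate; toList; tabulate)
import Data.Vec.Properties as Vecₚ
open import Function using (_∘_)
open import Relation.Nullary using (¬_; Dec; yes; no; contradiction; ¬?; _×-dec_)
open import Relation.Nullary.Decidable using (map′)
open import Relation.Binary.PropositionalEquality as ≡ using (_≡_; _≢_)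

-- The order must be exhibited by a list of representatives, so finiteness of each l-primary part
-- belongs to the claim, and the exponent in `LPrimary`, which varies with the class, has to be
-- bounded uniformly. Size does this: if uᵐ is circular, u may be changed by a circular unit to v so
-- that the exponents of vᵐ are below m; then N(v)ᵐ ≤ N(vᵐ) ≤ Cᵐ, and m cancels.
--
-- The exponents of uᴹ are only defined modulo M and up to a common constant, because ∏ ηᵢ = -1 is
-- its own M-th power. Relative norm 1 makes cᵢ + c_{i+d/2} constant, and as 2 is invertible modulo
-- M exactly one shift turns this constant into 0; that selects one vector per class. Conversely a
-- vector determines its M-th root, since 1 is the only root of unity of odd order. The zero vector
-- supplies the 1 in 1 + r·2ⁿ.
--
-- The arithmetic takes place in an abstract `UnitSystem`, away from polynomial representatives;
-- ℤ[X] is then shown to be an instance.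

unfold-4* : ∀ d r i → (4 ℕ.* d ℕ.+ r) ℕ.+ i ≡ d ℕ.+ (d ℕ.+ (d ℕ.+ (d ℕ.+ (r ℕ.+ i))))
unfold-4* = solve 3 (λ d r i → (con 4 :* d :+ r) :+ i := d :+ (d :+ (d :+ (d :+ (r :+ i))))) ≡.refl
  where open ℕ-Solver

-- Chebyshev recurrences and product-to-sum identities.

module Chebyshev {c ℓ} (R : CommutativeRing c ℓ) (x : CommutativeRing.Carrier R) where
  open CommutativeRing R
  open import Algebra.Properties.Group +-group using (∙-cancelʳ; ⁻¹-involutive)
  open import Algebra.Solver.Ring.NaturalCoefficients.Default commutativeSemiring using (solve; _:+_; _:*_; _:=_; con)
  open import Relation.Binary.Reasoning.Setoid setoid

  Recurrent : (ℕ → Carrier) → Set ℓ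
  Recurrent Y = ∀ i → Y (2 ℕ.+ i) + Y i ≈ x * Y (1 ℕ.+ i)

  -- With x = 2cos θ this is 2cos kθ.
  E : ℕ → Carrier
  E zero          = 1# + 1#
  E (suc zero)    = x
  E (suc (suc k)) = x * E (suc k) + - E k

  -- With x = 2cos θ this is sin((2j+1)θ/2) / sin(θ/2).
  W : ℕ → Carrier
  W zero          = 1#
  W (suc zero)    = 1# + x
  W (suc (suc k)) = x * W (suc k) + - W k

  a-b+b≈a : ∀ a b → (a + - b) + b ≈ a
  a-b+b≈a a b = trans (+-assoc a (- b) b) (trans (+-congˡ (-‿inverseˡ b)) (+-identityʳ a))

  E-recurrent : Recurrent E
  E-recurrent i = a-b+b≈a _ _

  W-recurrent : Recurrent W
  W-recurrent i = a-b+b≈a _ _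

  recurrent-unique : ∀ {Y Z} → Recurrent Y → Recurrent Z → Y 0 ≈ Z 0 → Y 1 ≈ Z 1 → ∀ i → Y i ≈ Z i
  recurrent-unique {Y} {Z} RY RZ e₀ e₁ zero          = e₀
  recurrent-unique {Y} {Z} RY RZ e₀ e₁ (suc zero)    = e₁
  recurrent-unique {Y} {Z} RY RZ e₀ e₁ (suc (suc i)) = ∙-cancelʳ (Y i) _ _ (begin
    Y (2 ℕ.+ i) + Y i  ≈⟨ RY i ⟩
    x * Y (1 ℕ.+ i)    ≈⟨ *-congˡ (recurrent-unique RY RZ e₀ e₁ (suc i)) ⟩
    x * Z (1 ℕ.+ i)    ≈⟨ RZ i ⟨
    Z (2 ℕ.+ i) + Z i  ≈⟨ +-congˡ (recurrent-unique RY RZ e₀ e₁ i) ⟨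
    Z (2 ℕ.+ i) + Y i  ∎)

  E-shift-step : ∀ {Y} → Recurrent Y → ∀ k i →
    E (suc k) * Y (suc k ℕ.+ suc i) ≈ Y (suc k ℕ.+ (suc k ℕ.+ suc i)) + Y (suc i) →
    E k * Y (k ℕ.+ (2 ℕ.+ i)) ≈ Y (k ℕ.+ (k ℕ.+ (2 ℕ.+ i))) + Y (2 ℕ.+ i) →
    E (2 ℕ.+ k) * Y (2 ℕ.+ k ℕ.+ i) ≈ Y (2 ℕ.+ k ℕ.+ (2 ℕ.+ k ℕ.+ i)) + Y i
  E-shift-step {Y} RY k i ih₁ ih₀
    rewrite ℕₚ.+-suc k (suc i) | ℕₚ.+-suc k i
          | ℕₚ.+-suc k (suc (k ℕ.+ i)) | ℕₚ.+-suc k (k ℕ.+ i) =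
    ∙-cancelʳ (E k * Y (2 ℕ.+ (k ℕ.+ i))) _ _ (begin
      E (2 ℕ.+ k) * Y m + E k * Y m
        ≈⟨ distribʳ (Y m) _ _ ⟨
      (E (2 ℕ.+ k) + E k) * Y m
        ≈⟨ *-congʳ (E-recurrent k) ⟩
      (x * E (1 ℕ.+ k)) * Y m
        ≈⟨ *-assoc x _ _ ⟩
      x * (E (1 ℕ.+ k) * Y m)
        ≈⟨ *-congˡ ih₁ ⟩
      x * (Y (3 ℕ.+ s) + Y (1 ℕ.+ i))
        ≈⟨ distribˡ x _ _ ⟩
      x * Y (3 ℕ.+ s) + x * Y (1 ℕ.+ i)
        ≈⟨ +-cong (RY (2 ℕ.+ s)) (RY i) ⟨
      (Y (4 ℕ.+ s) + Y (2 ℕ.+ s)) + (Y (2 ℕ.+ i) + Y i)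
        ≈⟨ solve 4 (λ a b u v → (a :+ b) :+ (u :+ v) := (a :+ v) :+ (b :+ u)) refl _ _ _ _ ⟩
      (Y (4 ℕ.+ s) + Y i) + (Y (2 ℕ.+ s) + Y (2 ℕ.+ i))
        ≈⟨ +-congˡ ih₀ ⟨
      (Y (4 ℕ.+ s) + Y i) + E k * Y m ∎)
    where
    m = 2 ℕ.+ (k ℕ.+ i)
    s = k ℕ.+ (k ℕ.+ i)

  -- The product-to-sum formula for 2cos kθ, valid for every solution of the recurrence. The
  -- induction goes from (k, i + 2) and (k + 1, i + 1) to (k + 2, i), so the middle index is the
  -- same in all three and the factor `Y m` can be taken out.
  E-shift : ∀ {Y} → Recurrent Y → ∀ k i → E k * Y (k ℕ.+ i) ≈ Y (k ℕ.+ (k ℕ.+ i)) + Y i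
  E-shift {Y} RY zero i =
    solve 1 (λ y → (con 1 :+ con 1) :* y := y :+ y) refl (Y i)
  E-shift {Y} RY (suc zero) i = sym (RY i)
  E-shift {Y} RY (suc (suc k)) i =
    E-shift-step {Y} RY k i (E-shift {Y} RY (suc k) (suc i)) (E-shift {Y} RY k (suc (suc i)))

  -- Replacing θ by jθ: the values at multiples of j satisfy the recurrence with parameter `E j`,
  -- which is what the composition law of Chebyshev polynomials rests on.
  E-multiples : ∀ j k → E ((2 ℕ.+ k) ℕ.* j) + E (k ℕ.* j) ≈ E j * E ((1 ℕ.+ k) ℕ.* j)
  E-multiples j k = sym (E-shift E-recurrent j (k ℕ.* j))

  E+W : ∀ i → E (suc i) + W i ≈ W (suc i)
  E+W = recurrent-unique
    (λ i → trans
      (solve 4 (λ a b u v → (a :+ b) :+ (u :+ v) := (a :+ u) :+ (b :+ v)) refl _ _ _ _)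
      (trans (+-cong (E-recurrent (suc i)) (W-recurrent i)) (sym (distribˡ x _ _))))
    (λ i → W-recurrent (suc i))
    (+-comm x 1#)
    (∙-cancelʳ (E 0) _ _ (begin
      (E 2 + W 1) + E 0
        ≈⟨ solve 3 (λ a b u → (a :+ b) :+ u := (a :+ u) :+ b) refl _ _ _ ⟩
      (E 2 + E 0) + W 1
        ≈⟨ +-congʳ (E-recurrent 0) ⟩
      x * x + (1# + x)
        ≈⟨ solve 1 (λ y → y :* y :+ (con 1 :+ y) := y :* (con 1 :+ y) :+ con 1) refl x ⟩
      x * W 1 + 1#
        ≈⟨ +-congʳ (W-recurrent 0) ⟨
      (W 2 + 1#) + 1#
        ≈⟨ +-assoc _ _ _ ⟩
      W 2 + E 0 ∎))

  E*W-step : ∀ j i →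
    E (suc j ℕ.+ (2 ℕ.+ i)) * W (suc j) + W (suc i) ≈ W (suc j ℕ.+ (suc j ℕ.+ (2 ℕ.+ i))) →
    E (j ℕ.+ (3 ℕ.+ i)) * W j + W (2 ℕ.+ i) ≈ W (j ℕ.+ (j ℕ.+ (3 ℕ.+ i))) →
    E (2 ℕ.+ j ℕ.+ suc i) * W (2 ℕ.+ j) + W i ≈ W (2 ℕ.+ j ℕ.+ (2 ℕ.+ j ℕ.+ suc i))
  E*W-step j i ih₁ ih₀
    rewrite ℕₚ.+-suc j (suc (suc i)) | ℕₚ.+-suc j (suc i) | ℕₚ.+-suc j i
          | ℕₚ.+-suc j (suc (suc (j ℕ.+ i)))
          | ℕₚ.+-suc j (suc (j ℕ.+ i)) | ℕₚ.+-suc j (j ℕ.+ i) =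
    ∙-cancelʳ (W (3 ℕ.+ s)) _ _ (begin
      (E m * W (2 ℕ.+ j) + W i) + W (3 ℕ.+ s)
        ≈⟨ +-congˡ ih₀ ⟨
      (E m * W (2 ℕ.+ j) + W i) + (E m * W j + W (2 ℕ.+ i))
        ≈⟨ solve 5 (λ e a b u v → (e :* a :+ u) :+ (e :* b :+ v) := e :* (a :+ b) :+ (v :+ u)) refl _ _ _ _ _ ⟩
      E m * (W (2 ℕ.+ j) + W j) + (W (2 ℕ.+ i) + W i)
        ≈⟨ +-cong (*-congˡ (W-recurrent j)) (W-recurrent i) ⟩
      E m * (x * W (1 ℕ.+ j)) + x * W (1 ℕ.+ i)
        ≈⟨ solve 4 (λ e y a b → e :* (y :* a) :+ y :* b := y :* (e :* a :+ b)) refl _ _ _ _ ⟩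
      x * (E m * W (1 ℕ.+ j) + W (1 ℕ.+ i))
        ≈⟨ *-congˡ ih₁ ⟩
      x * W (4 ℕ.+ s)
        ≈⟨ W-recurrent (3 ℕ.+ s) ⟨
      W (5 ℕ.+ s) + W (3 ℕ.+ s) ∎)
    where
    m = 3 ℕ.+ (j ℕ.+ i)
    s = j ℕ.+ (j ℕ.+ i)

  -- This is 2 cos A sin B = sin(A + B) - sin(A - B) with A = (j+i+1)θ and B = (2j+1)θ/2, divided by
  -- sin(θ/2). Writing the index of A as j + (i+1) keeps A - B positive, so only natural indices
  -- occur.
  E*W : ∀ j i → E (j ℕ.+ suc i) * W j + W i ≈ W (j ℕ.+ (j ℕ.+ suc i))
  E*W zero i = trans (+-congʳ (*-identityʳ _)) (E+W i)
  E*W (suc zero) i = begin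
    E (2 ℕ.+ i) * (1# + x) + W i
      ≈⟨ solve 3 (λ a y w → a :* (con 1 :+ y) :+ w := (y :* a :+ a) :+ w) refl _ _ _ ⟩
    (x * E (2 ℕ.+ i) + E (2 ℕ.+ i)) + W i
      ≈⟨ +-congʳ (+-congʳ (E-recurrent (suc i))) ⟨
    ((E (3 ℕ.+ i) + E (1 ℕ.+ i)) + E (2 ℕ.+ i)) + W i
      ≈⟨ solve 4 (λ a b u w → ((a :+ b) :+ u) :+ w := a :+ (u :+ (b :+ w))) refl _ _ _ _ ⟩
    E (3 ℕ.+ i) + (E (2 ℕ.+ i) + (E (1 ℕ.+ i) + W i))
      ≈⟨ +-congˡ (+-congˡ (E+W i)) ⟩
    E (3 ℕ.+ i) + (E (2 ℕ.+ i) + W (1 ℕ.+ i))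
      ≈⟨ +-congˡ (E+W (1 ℕ.+ i)) ⟩
    E (3 ℕ.+ i) + W (2 ℕ.+ i)
      ≈⟨ E+W (2 ℕ.+ i) ⟩
    W (3 ℕ.+ i) ∎
  E*W (suc (suc j)) i = E*W-step j i (E*W (suc j) (suc i)) (E*W j (suc (suc i)))

  -- This is sin 3B = sin B (1 + 2 cos 2B). For 2j + 1 = 3ⁱ the second factor is ηᵢ, so this is one
  -- step of the telescoping product.
  W-triple : ∀ j → W j * (1# + E (j ℕ.+ suc j)) ≈ W (j ℕ.+ (j ℕ.+ suc j))
  W-triple j = trans
    (solve 2 (λ w e → w :* (con 1 :+ e) := e :* w :+ w) refl (W j) (E (j ℕ.+ suc j)))
    (E*W j j)

  module _ {d : ℕ} (E-d : E d ≈ 0#) {Y : ℕ → Carrier} (RY : Recurrent Y) where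

    -- `E d ≈ 0#` says cos dθ = 0, so moving the index by 2d adds an odd multiple of π to the angle.
    antiperiodic : ∀ i → Y (d ℕ.+ (d ℕ.+ i)) ≈ - Y i
    antiperiodic i = ∙-cancelʳ (Y i) _ _ (begin
      Y (d ℕ.+ (d ℕ.+ i)) + Y i  ≈⟨ E-shift RY d i ⟨
      E d * Y (d ℕ.+ i)          ≈⟨ *-congʳ E-d ⟩
      0# * Y (d ℕ.+ i)           ≈⟨ zeroˡ _ ⟩
      0#                         ≈⟨ -‿inverseˡ (Y i) ⟨
      - Y i + Y i                ∎)

    periodic : ∀ q i → Y (q ℕ.* (4 ℕ.* d) ℕ.+ i) ≈ Y i
    periodic zero    i = refl
    periodic (suc q) i = begin
      Y ((4 ℕ.* d ℕ.+ q ℕ.* (4 ℕ.* d)) ℕ.+ i)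
        ≡⟨ ≡.cong Y (unfold-4* d (q ℕ.* (4 ℕ.* d)) i) ⟩
      Y (d ℕ.+ (d ℕ.+ (d ℕ.+ (d ℕ.+ (q ℕ.* (4 ℕ.* d) ℕ.+ i)))))
        ≈⟨ antiperiodic _ ⟩
      - Y (d ℕ.+ (d ℕ.+ (q ℕ.* (4 ℕ.* d) ℕ.+ i)))
        ≈⟨ -‿cong (antiperiodic _) ⟩
      - (- Y (q ℕ.* (4 ℕ.* d) ℕ.+ i))
        ≈⟨ ⁻¹-involutive _ ⟩
      Y (q ℕ.* (4 ℕ.* d) ℕ.+ i)
        ≈⟨ periodic q i ⟩
      Y i ∎
  
-- Powers of 3 modulo powers of 2.

-- That 4d divides 3ᵈ - 1 makes σᵈ trivial; that the quotient is odd makes the norm of η equal to -1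
-- and not 1. The exponents start at 2 because 4 does not divide 3 - 1.
3^2^ : ∀ n → ∃ λ s → 3 ℕ.^ (2 ℕ.^ suc n) ≡ 1 ℕ.+ (4 ℕ.* 2 ℕ.^ suc n) ℕ.* (1 ℕ.+ 2 ℕ.* s)
3^2^ zero = 0 , ≡.refl
3^2^ (suc n) with s , e ← 3^2^ n = s ℕ.+ D ℕ.* (q ℕ.* q) , (begin
    3 ℕ.^ (2 ℕ.* D)                    ≡⟨ ≡.cong (3 ℕ.^_) (ℕₚ.*-comm 2 D) ⟩
    3 ℕ.^ (D ℕ.* 2)                    ≡⟨ ℕₚ.^-*-assoc 3 D 2 ⟨
    (3 ℕ.^ D) ℕ.^ 2                    ≡⟨ ≡.cong (ℕ._^ 2) e ⟩
    (1 ℕ.+ (4 ℕ.* D) ℕ.* q) ℕ.^ 2      ≡⟨ identity D s ⟩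
    1 ℕ.+ (4 ℕ.* (2 ℕ.* D)) ℕ.* (1 ℕ.+ 2 ℕ.* (s ℕ.+ D ℕ.* (q ℕ.* q))) ∎)
  where
  open ≡.≡-Reasoning
  D = 2 ℕ.^ suc n
  q = 1 ℕ.+ 2 ℕ.* s
  identity : ∀ D s → let q = 1 ℕ.+ 2 ℕ.* s in (1 ℕ.+ (4 ℕ.* D) ℕ.* q) ℕ.^ 2 ≡
    1 ℕ.+ (4 ℕ.* (2 ℕ.* D)) ℕ.* (1 ℕ.+ 2 ℕ.* (s ℕ.+ D ℕ.* (q ℕ.* q)))
  identity = solve 2 (λ D s → let q = con 1 :+ con 2 :* s in
    (con 1 :+ (con 4 :* D) :* q) :^ 2 :=
    con 1 :+ (con 4 :* (con 2 :* D)) :* (con 1 :+ con 2 :* (s :+ D :* (q :* q)))) ≡.refl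
    where open ℕ-Solver

-- The step from t to 3t + 1 is written in the shape of the index that `W-triple` produces.
[3^_-1]/2 : ℕ → ℕ
[3^ zero -1]/2    = 0
[3^ suc i -1]/2 = [3^ i -1]/2 ℕ.+ ([3^ i -1]/2 ℕ.+ suc [3^ i -1]/2)

3^≡ : ∀ i → 3 ℕ.^ i ≡ [3^ i -1]/2 ℕ.+ suc [3^ i -1]/2
3^≡ zero    = ≡.refl
3^≡ (suc i) = ≡.trans (≡.cong (3 ℕ.*_) (3^≡ i))
  (solve 1 (λ t → con 3 :* (t :+ (con 1 :+ t)) := (t :+ (t :+ (con 1 :+ t))) :+ (con 1 :+ (t :+ (t :+ (con 1 :+ t))))) ≡.refl [3^ i -1]/2)
  where open ℕ-Solver

-- Thus t is 2d modulo 4d, half a period of `W`: the origin of the sign in `norm-η`. The trailing 0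
-- is the index at which `antiperiodic` is applied.
t-value : ∀ {t} d s → t ℕ.+ suc t ≡ 1 ℕ.+ (4 ℕ.* d) ℕ.* (1 ℕ.+ 2 ℕ.* s) → t ≡ s ℕ.* (4 ℕ.* d) ℕ.+ (d ℕ.+ (d ℕ.+ 0))
t-value {t} d s e = ℕₚ.*-cancelˡ-≡ t _ 2 (ℕₚ.suc-injective (≡.trans
  (solve 1 (λ t → con 1 :+ con 2 :* t := t :+ (con 1 :+ t)) ≡.refl t)
  (≡.trans e (solve 2 (λ d s → con 1 :+ (con 4 :* d) :* (con 1 :+ con 2 :* s) := con 1 :+ con 2 :* (s :* (con 4 :* d) :+ (d :+ (d :+ con 0)))) ≡.refl d s))))
  where open ℕ-Solver

-- Integer vectors with the Euclidean form.

module IntegerVectors where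
  open ≡ using (refl; sym; trans; cong; cong₂; subst; module ≡-Reasoning)

  infixl 6 _⊕_
  infixr 7 _⊙_

  _⊕_ : ∀ {d} → Vec ℤ d → Vec ℤ d → Vec ℤ d
  _⊕_ = zipWith ℤ._+_

  _⊙_ : ∀ {d} → ℤ → Vec ℤ d → Vec ℤ d
  c ⊙ y = Vec.map (c ℤ.*_) y

  𝟎 : ∀ {d} → Vec ℤ d
  𝟎 = replicate _ (+ 0)

  ⊕-identityˡ : ∀ {d} (y : Vec ℤ d) → 𝟎 ⊕ y ≡ y
  ⊕-identityˡ []      = refl
  ⊕-identityˡ (x ∷ y) = cong₂ _∷_ (ℤₚ.+-identityˡ x) (⊕-identityˡ y)

  ⊕-identityʳ : ∀ {d} (y : Vec ℤ d) → y ⊕ 𝟎 ≡ y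
  ⊕-identityʳ []      = refl
  ⊕-identityʳ (x ∷ y) = cong₂ _∷_ (ℤₚ.+-identityʳ x) (⊕-identityʳ y)

  ⊕-interchange : ∀ {d} (u v y z : Vec ℤ d) → (u ⊕ v) ⊕ (y ⊕ z) ≡ (u ⊕ y) ⊕ (v ⊕ z)
  ⊕-interchange []      []      []      []      = refl
  ⊕-interchange (a ∷ u) (b ∷ v) (x ∷ y) (w ∷ z) = cong₂ _∷_
    (solve 4 (λ a b x w → (a :+ b) :+ (x :+ w) := (a :+ x) :+ (b :+ w)) refl a b x w)
    (⊕-interchange u v y z)
    where open ℤ-Solver

  ⊙-zero : ∀ {d} (y : Vec ℤ d) → + 0 ⊙ y ≡ 𝟎
  ⊙-zero []      = refl
  ⊙-zero (x ∷ y) = cong₂ _∷_ (ℤₚ.*-zeroˡ x) (⊙-zero y)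

  ⊙-𝟎 : ∀ {d} c → c ⊙ 𝟎 {d} ≡ 𝟎
  ⊙-𝟎 {zero}  c = refl
  ⊙-𝟎 {suc d} c = cong₂ _∷_ (ℤₚ.*-zeroʳ c) (⊙-𝟎 c)

  ⊙-one : ∀ {d} (y : Vec ℤ d) → + 1 ⊙ y ≡ y
  ⊙-one []      = refl
  ⊙-one (x ∷ y) = cong₂ _∷_ (ℤₚ.*-identityˡ x) (⊙-one y)

  ⊙-⊕ : ∀ {d} c (y z : Vec ℤ d) → c ⊙ (y ⊕ z) ≡ c ⊙ y ⊕ c ⊙ z
  ⊙-⊕ c []      []      = refl
  ⊙-⊕ c (x ∷ y) (w ∷ z) = cong₂ _∷_ (ℤₚ.*-distribˡ-+ c x w) (⊙-⊕ c y z)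

  +-⊙ : ∀ {d} a b (y : Vec ℤ d) → (a ℤ.+ b) ⊙ y ≡ a ⊙ y ⊕ b ⊙ y
  +-⊙ a b []      = refl
  +-⊙ a b (x ∷ y) = cong₂ _∷_ (ℤₚ.*-distribʳ-+ x a b) (+-⊙ a b y)

  ⊙-assoc : ∀ {d} a b (y : Vec ℤ d) → (a ℤ.* b) ⊙ y ≡ a ⊙ b ⊙ y
  ⊙-assoc a b []      = refl
  ⊙-assoc a b (x ∷ y) = cong₂ _∷_ (ℤₚ.*-assoc a b x) (⊙-assoc a b y)

  dot : ∀ {d} → Vec ℤ d → Vec ℤ d → ℤ
  dot []      []      = + 0
  dot (x ∷ y) (w ∷ z) = x ℤ.* w ℤ.+ dot y z

  dot-sym : ∀ {d} (y z : Vec ℤ d) → dot y z ≡ dot z y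
  dot-sym []      []      = refl
  dot-sym (x ∷ y) (w ∷ z) = cong₂ ℤ._+_ (ℤₚ.*-comm x w) (dot-sym y z)

  dot-𝟎ˡ : ∀ {d} (z : Vec ℤ d) → dot 𝟎 z ≡ + 0
  dot-𝟎ˡ []      = refl
  dot-𝟎ˡ (w ∷ z) = cong₂ ℤ._+_ (ℤₚ.*-zeroˡ w) (dot-𝟎ˡ z)

  dot-⊕ˡ : ∀ {d} (u y z : Vec ℤ d) → dot (u ⊕ y) z ≡ dot u z ℤ.+ dot y z
  dot-⊕ˡ []      []      []      = refl
  dot-⊕ˡ (a ∷ u) (x ∷ y) (w ∷ z) rewrite dot-⊕ˡ u y z =
    solve 5 (λ a x w p q → (a :+ x) :* w :+ (p :+ q) := (a :* w :+ p) :+ (x :* w :+ q)) refl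
      a x w (dot u z) (dot y z)
    where open ℤ-Solver

  dot-⊙ˡ : ∀ {d} c (y z : Vec ℤ d) → dot (c ⊙ y) z ≡ c ℤ.* dot y z
  dot-⊙ˡ c []      []      = sym (ℤₚ.*-zeroʳ c)
  dot-⊙ˡ c (x ∷ y) (w ∷ z) rewrite dot-⊙ˡ c y z =
    solve 4 (λ c x w q → (c :* x) :* w :+ c :* q := c :* (x :* w :+ q)) refl c x w (dot y z)
    where open ℤ-Solver

  dot-⊕ʳ : ∀ {d} (u y z : Vec ℤ d) → dot z (u ⊕ y) ≡ dot z u ℤ.+ dot z y
  dot-⊕ʳ u y z = trans (dot-sym z (u ⊕ y)) (trans (dot-⊕ˡ u y z) (cong₂ ℤ._+_ (dot-sym u z) (dot-sym y z)))

  dot-⊙ʳ : ∀ {d} c (y z : Vec ℤ d) → dot z (c ⊙ y) ≡ c ℤ.* dot z y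
  dot-⊙ʳ c y z = trans (dot-sym z (c ⊙ y)) (trans (dot-⊙ˡ c y z) (cong (c ℤ.*_) (dot-sym y z)))

  sq : ℤ → ℕ
  sq x = ∣ x ∣ ℕ.* ∣ x ∣

  +sq : ∀ x → + sq x ≡ x ℤ.* x
  +sq (+ n)    = ℤₚ.pos-* n n
  +sq -[1+ n ] = refl

  ∥_∥² : ∀ {d} → Vec ℤ d → ℕ
  ∥ [] ∥²    = 0
  ∥ x ∷ y ∥² = sq x ℕ.+ ∥ y ∥²

  +∥∥² : ∀ {d} (y : Vec ℤ d) → + ∥ y ∥² ≡ dot y y
  +∥∥² []      = refl
  +∥∥² (x ∷ y) = trans (ℤₚ.pos-+ (sq x) ∥ y ∥²) (cong₂ ℤ._+_ (+sq x) (+∥∥² y))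

  sq≡0⇒≡0 : ∀ x → sq x ≡ 0 → x ≡ + 0
  sq≡0⇒≡0 (+ zero) e = refl

  ∥∥²≡0⇒≡𝟎 : ∀ {d} (y : Vec ℤ d) → ∥ y ∥² ≡ 0 → y ≡ 𝟎
  ∥∥²≡0⇒≡𝟎 []      e = refl
  ∥∥²≡0⇒≡𝟎 (x ∷ y) e = cong₂ _∷_ (sq≡0⇒≡0 x (ℕₚ.m+n≡0⇒m≡0 (sq x) e)) (∥∥²≡0⇒≡𝟎 y (ℕₚ.m+n≡0⇒n≡0 (sq x) e))

  ∥𝟎∥² : ∀ d → ∥ 𝟎 {d} ∥² ≡ 0
  ∥𝟎∥² zero    = refl
  ∥𝟎∥² (suc d) = ∥𝟎∥² d

  parallelogram : ∀ a b → sq (a ℤ.+ b) ℕ.+ sq (a ℤ.- b) ≡ 2 ℕ.* sq a ℕ.+ 2 ℕ.* sq b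
  parallelogram a b = ℤₚ.+-injective (begin
    + (sq (a ℤ.+ b) ℕ.+ sq (a ℤ.- b))
      ≡⟨ ℤₚ.pos-+ (sq (a ℤ.+ b)) (sq (a ℤ.- b)) ⟩
    + sq (a ℤ.+ b) ℤ.+ + sq (a ℤ.- b)
      ≡⟨ cong₂ ℤ._+_ (+sq (a ℤ.+ b)) (+sq (a ℤ.- b)) ⟩
    (a ℤ.+ b) ℤ.* (a ℤ.+ b) ℤ.+ (a ℤ.- b) ℤ.* (a ℤ.- b)
      ≡⟨ solve 2 (λ a b → (a :+ b) :* (a :+ b) :+ (a :- b) :* (a :- b) := con (+ 2) :* (a :* a) :+ con (+ 2) :* (b :* b)) refl a b ⟩
    + 2 ℤ.* (a ℤ.* a) ℤ.+ + 2 ℤ.* (b ℤ.* b)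
      ≡⟨ cong₂ (λ u v → + 2 ℤ.* u ℤ.+ + 2 ℤ.* v) (+sq a) (+sq b) ⟨
    + 2 ℤ.* + sq a ℤ.+ + 2 ℤ.* + sq b
      ≡⟨ cong₂ ℤ._+_ (ℤₚ.pos-* 2 (sq a)) (ℤₚ.pos-* 2 (sq b)) ⟨
    + (2 ℕ.* sq a) ℤ.+ + (2 ℕ.* sq b)
      ≡⟨ ℤₚ.pos-+ (2 ℕ.* sq a) (2 ℕ.* sq b) ⟨
    + (2 ℕ.* sq a ℕ.+ 2 ℕ.* sq b) ∎)
    where
    open ≡-Reasoning
    open ℤ-Solver

  sq-+ : ∀ a b → sq (a ℤ.+ b) ℕ.≤ 2 ℕ.* sq a ℕ.+ 2 ℕ.* sq b
  sq-+ a b = ℕₚ.≤-trans (ℕₚ.m≤m+n (sq (a ℤ.+ b)) _) (ℕₚ.≤-reflexive (parallelogram a b))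

  ∥⊕∥² : ∀ {d} (y z : Vec ℤ d) → ∥ y ⊕ z ∥² ℕ.≤ 2 ℕ.* ∥ y ∥² ℕ.+ 2 ℕ.* ∥ z ∥²
  ∥⊕∥² []      []      = ℕ.z≤n
  ∥⊕∥² (x ∷ y) (w ∷ z) = ℕₚ.≤-trans (ℕₚ.+-mono-≤ (sq-+ x w) (∥⊕∥² y z))
    (ℕₚ.≤-reflexive (solve 4 (λ a b u v → (con 2 :* a :+ con 2 :* b) :+ (con 2 :* u :+ con 2 :* v) := con 2 :* (a :+ u) :+ con 2 :* (b :+ v)) refl (sq x) (sq w) ∥ y ∥² ∥ z ∥²))
    where open ℕ-Solver

  sq-* : ∀ c x → sq (c ℤ.* x) ≡ sq c ℕ.* sq x
  sq-* c x rewrite ℤₚ.abs-* c x =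
    solve 2 (λ a b → (a :* b) :* (a :* b) := (a :* a) :* (b :* b)) refl ∣ c ∣ ∣ x ∣
    where open ℕ-Solver

  ∥⊙∥² : ∀ {d} c (y : Vec ℤ d) → ∥ c ⊙ y ∥² ≡ sq c ℕ.* ∥ y ∥²
  ∥⊙∥² c []      = sym (ℕₚ.*-zeroʳ (sq c))
  ∥⊙∥² c (x ∷ y) = trans (cong₂ ℕ._+_ (sq-* c x) (∥⊙∥² c y)) (sym (ℕₚ.*-distribˡ-+ (sq c) (sq x) ∥ y ∥²))

  -- Expand the square norm of a z − b y, where a = ∥y∥² and b = ⟨y,z⟩.
  cauchy-schwarz : ∀ {d} (y z : Vec ℤ d) → sq (dot y z) ℕ.≤ ∥ y ∥² ℕ.* ∥ z ∥²
  cauchy-schwarz y z = go ∥ y ∥² refl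
    where
    open ≡-Reasoning
    b = dot y z
    v : ℤ → Vec ℤ _
    v a = a ⊙ z ⊕ (ℤ.- b) ⊙ y
    expand : ∀ a → a ≡ dot y y → dot (v a) (v a) ≡ a ℤ.* (a ℤ.* dot z z ℤ.- b ℤ.* b)
    expand a e = begin
      dot (v a) (v a)
        ≡⟨ dot-⊕ˡ (a ⊙ z) ((ℤ.- b) ⊙ y) (v a) ⟩
      dot (a ⊙ z) (v a) ℤ.+ dot ((ℤ.- b) ⊙ y) (v a)
        ≡⟨ cong₂ ℤ._+_ (dot-⊙ˡ a z (v a)) (dot-⊙ˡ (ℤ.- b) y (v a)) ⟩
      a ℤ.* dot z (v a) ℤ.+ (ℤ.- b) ℤ.* dot y (v a)
        ≡⟨ cong₂ (λ p q → a ℤ.* p ℤ.+ (ℤ.- b) ℤ.* q) (right z) (right y) ⟩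
      a ℤ.* (a ℤ.* dot z z ℤ.+ (ℤ.- b) ℤ.* dot z y) ℤ.+ (ℤ.- b) ℤ.* (a ℤ.* b ℤ.+ (ℤ.- b) ℤ.* dot y y)
        ≡⟨ cong₂ (λ p q → a ℤ.* (a ℤ.* dot z z ℤ.+ (ℤ.- b) ℤ.* p) ℤ.+ (ℤ.- b) ℤ.* (a ℤ.* b ℤ.+ (ℤ.- b) ℤ.* q)) (dot-sym z y) (sym e) ⟩
      a ℤ.* (a ℤ.* dot z z ℤ.+ (ℤ.- b) ℤ.* b) ℤ.+ (ℤ.- b) ℤ.* (a ℤ.* b ℤ.+ (ℤ.- b) ℤ.* a)
        ≡⟨ solve 3 (λ a b c → a :* (a :* c :+ (:- b) :* b) :+ (:- b) :* (a :* b :+ (:- b) :* a) := a :* (a :* c :- b :* b)) refl a b (dot z z) ⟩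
      a ℤ.* (a ℤ.* dot z z ℤ.- b ℤ.* b) ∎
      where
      open ℤ-Solver
      right : ∀ u → dot u (v a) ≡ a ℤ.* dot u z ℤ.+ (ℤ.- b) ℤ.* dot u y
      right u = trans (dot-⊕ʳ (a ⊙ z) ((ℤ.- b) ⊙ y) u) (cong₂ ℤ._+_ (dot-⊙ʳ a z u) (dot-⊙ʳ (ℤ.- b) y u))
    go : ∀ a → ∥ y ∥² ≡ a → sq b ℕ.≤ a ℕ.* ∥ z ∥²
    go zero e = ℕₚ.≤-reflexive (cong sq (trans (cong (λ w → dot w z) (∥∥²≡0⇒≡𝟎 y e)) (dot-𝟎ˡ z)))
    go a@(suc _) e = ℤ.drop‿+≤+ (subst (ℤ._≤ + (a ℕ.* ∥ z ∥²)) (sym (+sq b))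
      (subst (b ℤ.* b ℤ.≤_) (sym (trans (ℤₚ.pos-* a ∥ z ∥²) (cong (+ a ℤ.*_) (+∥∥² z))))
        (ℤₚ.0≤i-j⇒j≤i (ℤₚ.*-cancelˡ-≤-pos (+ 0) _ (+ a)
          (subst (ℤ._≤ + a ℤ.* (+ a ℤ.* dot z z ℤ.- b ℤ.* b)) (sym (ℤₚ.*-zeroʳ (+ a)))
            (subst (+ 0 ℤ.≤_) (trans (+∥∥² (v (+ a))) (expand (+ a) (trans (cong +_ (sym e)) (+∥∥² y)))) (ℤ.+≤+ ℕ.z≤n)))))))

  interval : ℕ → List ℤ
  interval M = List.map +_ (upTo (suc M)) ++ List.map (λ k → ℤ.- (+ k)) (upTo (suc M))

  ∈-interval : ∀ M x → ∣ x ∣ ℕ.≤ M → x ∈ interval M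
  ∈-interval M (+ k)    le = ∈-++⁺ˡ (∈-map⁺ +_ (∈-upTo⁺ (ℕ.s≤s le)))
  ∈-interval M -[1+ k ] le = ∈-++⁺ʳ (List.map +_ (upTo (suc M))) (∈-map⁺ (λ k → ℤ.- (+ k)) (∈-upTo⁺ (ℕ.s≤s le)))

  -- A cube around the ball of square norm M is enough, because an integer is at most its square in
  -- absolute value. Repetitions (0 occurs twice in `interval`) do not affect searching or the
  -- pigeonhole principle.
  box : ℕ → ∀ d → List (Vec ℤ d)
  box M zero    = [] ∷ []
  box M (suc d) = List.cartesianProductWith _∷_ (interval M) (box M d)

  ∣∣≤sq : ∀ x → ∣ x ∣ ℕ.≤ sq x
  ∣∣≤sq (+ zero)  = ℕ.z≤n
  ∣∣≤sq (+ suc n) = ℕₚ.m≤m*n (suc n) (suc n)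
  ∣∣≤sq -[1+ n ]  = ℕₚ.m≤m*n (suc n) (suc n)

  ∈-box : ∀ M {d} (y : Vec ℤ d) → ∥ y ∥² ℕ.≤ M → y ∈ box M d
  ∈-box M []      le = here refl
  ∈-box M (x ∷ y) le = ∈-cartesianProductWith⁺ _∷_
    (∈-interval M x (ℕₚ.≤-trans (∣∣≤sq x) (ℕₚ.m+n≤o⇒m≤o (sq x) le)))
    (∈-box M y (ℕₚ.m+n≤o⇒n≤o (sq x) le))

open IntegerVectors using (_⊕_; _⊙_; 𝟎; dot; dot-sym; dot-𝟎ˡ; dot-⊕ˡ; dot-⊕ʳ; dot-⊙ˡ; dot-⊙ʳ; ∥_∥²; +∥∥²; ∥∥²≡0⇒≡𝟎; cauchy-schwarz; sq; box; ∈-box)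

even⊎odd : ∀ n → 2 ∣ n ⊎ ∃ λ c → n ≡ suc (2 ℕ.* c)
even⊎odd zero = inj₁ (divides 0 ≡.refl)
even⊎odd (suc n) with even⊎odd n
... | inj₁ (divides c e) = inj₂ (c , ≡.cong suc (≡.trans e (ℕₚ.*-comm c 2)))
... | inj₂ (c , e)       = inj₁ (divides (suc c) (≡.trans (≡.cong suc e) (≡.cong (2 ℕ.+_) (ℕₚ.*-comm 2 c))))

-- The abstract setting.

module ConjugateProduct (R : CommutativeRing 0ℓ 0ℓ) (conjugate : ℕ → CommutativeRing.Carrier R) where
  open CommutativeRing R using (Carrier; _*_; 1#; semiring)
  open import Algebra.Properties.Semiring.Exp semiring using (_^_)

  ∏ : ℕ → (ℕ → ℕ) → Carrier
  ∏ zero    a = 1#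
  ∏ (suc r) a = ∏ r a * conjugate r ^ a r

-- The pairing of `φ x` with `φ y` behaves like a trace form of a totally real ring: by `φ-adjoint`
-- it depends on the product xy alone, and it is positive definite because `φ` has the left inverse
-- `ψ`. The arithmetic inputs are `norm-η` and `√1`.
record UnitSystem : Set₁ where
  field
    ring : CommutativeRing 0ℓ 0ℓ
  open CommutativeRing ring using (Carrier; _≈_; _+_; _*_; -_; 1#)
  field
    σ      : Carrier → Carrier
    σ-cong : ∀ {x y} → x ≈ y → σ x ≈ σ y
    σ-*    : ∀ x y → σ (x * y) ≈ σ x * σ y
    σ-1    : σ 1# ≈ 1#

  σ^ : ℕ → Carrier → Carrier
  σ^ i x = fold x σ i

  field
    log-d : ℕ
    η     : Carrier

  half : ℕ
  half = 2 ℕ.^ log-d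

  d : ℕ
  d = 2 ℕ.^ suc log-d

  open ConjugateProduct ring (λ i → σ^ i η) public

  field
    σ-period  : ∀ x → σ^ d x ≈ x
    norm-η    : ∏ d (λ _ → 1) ≈ - 1#
    rank      : ℕ
    φ         : Carrier → Vec ℤ rank
    φ-cong    : ∀ {x y} → x ≈ y → φ x ≡ φ y
    φ-+       : ∀ x y → φ (x + y) ≡ φ x ⊕ φ y
    φ-neg     : ∀ x → φ (- x) ≡ (ℤ.- (+ 1)) ⊙ φ x
    φ-adjoint : ∀ x y z → dot (φ (x * y)) (φ z) ≡ dot (φ y) (φ (x * z))
    φ-1       : ∥ φ 1# ∥² ≡ 1
    φ-bounded : ∀ x → ∃ λ B → ∀ y → ∥ φ (x * y) ∥² ℕ.≤ B ℕ.* ∥ φ y ∥²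
    ψ         : Vec ℤ rank → Carrier
    ψ∘φ       : ∀ x → ψ (φ x) ≈ x
    √1        : ∀ w → w * w ≈ 1# → w ≈ 1# ⊎ w ≈ - 1#

-- Sizes of units and uniqueness of odd roots.

module Saturation (U : UnitSystem) where
  open UnitSystem U
  open CommutativeRing ring hiding (ring)
  open import Algebra.Properties.Ring (CommutativeRing.ring ring) using (-‿distribˡ-*)
  open import Algebra.Properties.Group +-group using (⁻¹-involutive; x∙y⁻¹≈ε⇒x≈y)
  open import Algebra.Properties.CommutativeSemiring.Exp commutativeSemiring
    using (_^_; ^-congˡ; ^-congʳ; ^-homo-*; ^-assocʳ; ^-distrib-*)
  open import Algebra.Properties.CommutativeSemigroup *-commutativeSemigroup using (interchange)
  open import Relation.Binary.Reasoning.Setoid setoid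

  1^ : ∀ m → 1# ^ m ≈ 1#
  1^ zero    = refl
  1^ (suc m) = trans (*-identityˡ _) (1^ m)

  ^2 : ∀ x → x ^ 2 ≈ x * x
  ^2 x = *-congˡ (*-identityʳ x)

  -1*-1 : - 1# * - 1# ≈ 1#
  -1*-1 = trans (sym (-‿distribˡ-* 1# (- 1#))) (trans (-‿cong (*-identityˡ (- 1#))) (⁻¹-involutive 1#))

  [-1]^even : ∀ q → (- 1#) ^ (2 ℕ.* q) ≈ 1#
  [-1]^even q = begin
    (- 1#) ^ (2 ℕ.* q)    ≈⟨ ^-assocʳ (- 1#) 2 q ⟨
    ((- 1#) ^ 2) ^ q      ≈⟨ ^-congˡ q (trans (^2 (- 1#)) -1*-1) ⟩
    1# ^ q                ≈⟨ 1^ q ⟩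
    1#                    ∎

  Unit : Carrier → Set
  Unit x = ∃ λ y → x * y ≈ 1#

  Unit-resp : ∀ {x y} → x ≈ y → Unit x → Unit y
  Unit-resp e (z , f) = z , trans (*-congʳ (sym e)) f

  Unit-* : ∀ {x y} → Unit x → Unit y → Unit (x * y)
  Unit-* {x} {y} (u , e) (v , f) = u * v ,
    trans (interchange x y u v) (trans (*-cong e f) (*-identityˡ 1#))

  Unit-1 : Unit 1#
  Unit-1 = 1# , *-identityˡ 1#

  Unit-−1 : Unit (- 1#)
  Unit-−1 = - 1# , -1*-1

  Unit-^ : ∀ {x} m → Unit x → Unit (x ^ m)
  Unit-^ zero    u = Unit-1
  Unit-^ (suc m) u = Unit-* u (Unit-^ m u)

  Unit-factorˡ : ∀ {x y} → Unit (x * y) → Unit x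
  Unit-factorˡ {x} {y} (z , e) = y * z , trans (sym (*-assoc x y z)) e

  Unit-factorʳ : ∀ {x y} → Unit (x * y) → Unit y
  Unit-factorʳ u = Unit-factorˡ (Unit-resp (*-comm _ _) u)

  cancelʳ : ∀ {x y u} → Unit u → x * u ≈ y * u → x ≈ y
  cancelʳ {x} {y} {u} (v , e) f = begin
    x            ≈⟨ *-identityʳ x ⟨
    x * 1#       ≈⟨ *-congˡ e ⟨
    x * (u * v)  ≈⟨ *-assoc x u v ⟨
    x * u * v    ≈⟨ *-congʳ f ⟩
    y * u * v    ≈⟨ *-assoc y u v ⟩
    y * (u * v)  ≈⟨ *-congˡ e ⟩
    y * 1#       ≈⟨ *-identityʳ y ⟩
    y            ∎

  ⟪_,_⟫ : Carrier → Carrier → ℤ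
  ⟪ x , y ⟫ = dot (φ x) (φ y)

  N : Carrier → ℕ
  N x = ∥ φ x ∥²

  N-cong : ∀ {x y} → x ≈ y → N x ≡ N y
  N-cong e = ≡.cong ∥_∥² (φ-cong e)

  φ-injective : ∀ {x y} → φ x ≡ φ y → x ≈ y
  φ-injective {x} {y} e = trans (sym (ψ∘φ x)) (trans (reflexive (≡.cong ψ e)) (ψ∘φ y))

  ⟪x*y,1⟫ : ∀ x y → ⟪ x * y , 1# ⟫ ≡ ⟪ y , x ⟫
  ⟪x*y,1⟫ x y = ≡.trans (φ-adjoint x y 1#) (≡.cong (dot (φ y)) (φ-cong (*-identityʳ x)))

  ⟪w*w,1⟫ : ∀ w → ⟪ w * w , 1# ⟫ ≡ + N w
  ⟪w*w,1⟫ w = ≡.trans (⟪x*y,1⟫ w w) (≡.sym (+∥∥² (φ w)))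

  N-unit : ∀ {x} → Unit x → 1 ℕ.≤ N x
  N-unit {x} (y , e) = ℕₚ.n≢0⇒n>0 λ N≡0 → contradiction (≡.trans (≡.sym φ-1) (ℤₚ.+-injective (≡R.begin
    + ∥ φ 1# ∥²            ≡R.≡⟨ +∥∥² (φ 1#) ⟩
    dot (φ 1#) (φ 1#)      ≡R.≡⟨ ≡.cong (λ v → dot v (φ 1#)) (φ-cong (trans (sym e) (*-comm x y))) ⟩
    dot (φ (y * x)) (φ 1#) ≡R.≡⟨ φ-adjoint y x 1# ⟩
    dot (φ x) (φ (y * 1#)) ≡R.≡⟨ ≡.cong (λ v → dot v (φ (y * 1#))) (∥∥²≡0⇒≡𝟎 (φ x) N≡0) ⟩
    dot 𝟎 (φ (y * 1#))     ≡R.≡⟨ dot-𝟎ˡ (φ (y * 1#)) ⟩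
    + 0                    ≡R.∎))) λ ()
    where module ≡R = ≡.≡-Reasoning

  -- Self-adjointness moves one factor x across the form, so the pairing of xⁱ with xⁱ⁺² is N(xⁱ⁺¹);
  -- Cauchy-Schwarz does the rest.
  N-log-convex : ∀ x i → N (x ^ suc i) ℕ.* N (x ^ suc i) ℕ.≤ N (x ^ i) ℕ.* N (x ^ (2 ℕ.+ i))
  N-log-convex x i = ≡.subst (λ z → sq z ℕ.≤ N (x ^ i) ℕ.* N (x ^ (2 ℕ.+ i)))
    (≡.trans (≡.sym (φ-adjoint x (x ^ i) (x ^ suc i))) (≡.sym (+∥∥² (φ (x ^ suc i)))))
    (cauchy-schwarz (φ (x ^ i)) (φ (x ^ (2 ℕ.+ i))))

  -- By log-convexity the ratios N(xⁱ⁺¹)/N(xⁱ) do not decrease, and the one at i = 0 is N(x) because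
  -- N(1) = 1. For a unit x the cancelled factor N(xⁱ) is positive.
  N-step : ∀ {x} → Unit x → ∀ i → N x ℕ.* N (x ^ i) ℕ.≤ N (x ^ suc i)
  N-step {x} u zero = ℕₚ.≤-reflexive (≡.trans (≡.cong (N x ℕ.*_) φ-1)
    (≡.trans (ℕₚ.*-identityʳ (N x)) (N-cong (sym (*-identityʳ x)))))
  N-step {x} u (suc i) = ℕₚ.*-cancelˡ-≤ (N (x ^ i)) {{ℕ.>-nonZero (N-unit (Unit-^ i u))}} (R.begin
    N (x ^ i) ℕ.* (N x ℕ.* N (x ^ suc i))    R.≡⟨ ≡.sym (ℕₚ.*-assoc (N (x ^ i)) (N x) _) ⟩
    (N (x ^ i) ℕ.* N x) ℕ.* N (x ^ suc i)    R.≡⟨ ≡.cong (ℕ._* N (x ^ suc i)) (ℕₚ.*-comm (N (x ^ i)) (N x)) ⟩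
    (N x ℕ.* N (x ^ i)) ℕ.* N (x ^ suc i)    R.≤⟨ ℕₚ.*-monoˡ-≤ (N (x ^ suc i)) (N-step u i) ⟩
    N (x ^ suc i) ℕ.* N (x ^ suc i)          R.≤⟨ N-log-convex x i ⟩
    N (x ^ i) ℕ.* N (x ^ (2 ℕ.+ i))          R.∎)
    where module R = ℕₚ.≤-Reasoning

  N-^ : ∀ {x} → Unit x → ∀ i → N x ℕ.^ i ℕ.≤ N (x ^ i)
  N-^ u zero    = ℕₚ.≤-reflexive (≡.sym φ-1)
  N-^ {x} u (suc i) = ℕₚ.≤-trans (ℕₚ.*-monoʳ-≤ (N x) (N-^ u i)) (N-step u i)

  N≤N^ : ∀ {x} → Unit x → ∀ i → N x ℕ.≤ N (x ^ suc i)
  N≤N^ {x} u i = ℕₚ.≤-trans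
    (ℕₚ.m≤m*n (N x) (N x ℕ.^ i) {{ℕₚ.m^n≢0 (N x) i {{ℕ.>-nonZero (N-unit u)}}}})
    (N-^ u (suc i))

  N-difference : ∀ x y → + N (x + - y) ≡ (+ N x ℤ.+ + N y) ℤ.- (+ 2) ℤ.* ⟪ x , y ⟫
  N-difference x y = ≡R.begin
    + N (x + - y)                    ≡R.≡⟨ +∥∥² (φ (x + - y)) ⟩
    dot (φ (x + - y)) (φ (x + - y))  ≡R.≡⟨ ≡.cong (λ v → dot v v) (≡.trans (φ-+ x (- y)) (≡.cong (φ x ⊕_) (φ-neg y))) ⟩
    dot v v                          ≡R.≡⟨ dot-⊕ˡ (φ x) (−1ℤ ⊙ φ y) v ⟩
    dot (φ x) v ℤ.+ dot (−1ℤ ⊙ φ y) v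
      ≡R.≡⟨ ≡.cong₂ ℤ._+_ (right (φ x)) (≡.trans (dot-⊙ˡ −1ℤ (φ y) v) (≡.cong (−1ℤ ℤ.*_) (right (φ y)))) ⟩
    (⟪ x , x ⟫ ℤ.+ −1ℤ ℤ.* ⟪ x , y ⟫) ℤ.+ −1ℤ ℤ.* (⟪ y , x ⟫ ℤ.+ −1ℤ ℤ.* ⟪ y , y ⟫)
      ≡R.≡⟨ ≡.cong (λ z → (⟪ x , x ⟫ ℤ.+ −1ℤ ℤ.* ⟪ x , y ⟫) ℤ.+ −1ℤ ℤ.* (z ℤ.+ −1ℤ ℤ.* ⟪ y , y ⟫)) (dot-sym (φ y) (φ x)) ⟩
    (⟪ x , x ⟫ ℤ.+ −1ℤ ℤ.* ⟪ x , y ⟫) ℤ.+ −1ℤ ℤ.* (⟪ x , y ⟫ ℤ.+ −1ℤ ℤ.* ⟪ y , y ⟫)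
      ≡R.≡⟨ solve 3 (λ a b c → (a :+ con −1ℤ :* b) :+ con −1ℤ :* (b :+ con −1ℤ :* c) := (a :+ c) :- con (+ 2) :* b) ≡.refl ⟪ x , x ⟫ ⟪ x , y ⟫ ⟪ y , y ⟫ ⟩
    (⟪ x , x ⟫ ℤ.+ ⟪ y , y ⟫) ℤ.- (+ 2) ℤ.* ⟪ x , y ⟫
      ≡R.≡⟨ ≡.cong₂ (λ a b → (a ℤ.+ b) ℤ.- (+ 2) ℤ.* ⟪ x , y ⟫) (+∥∥² (φ x)) (+∥∥² (φ y)) ⟨
    (+ N x ℤ.+ + N y) ℤ.- (+ 2) ℤ.* ⟪ x , y ⟫ ≡R.∎
    where
    module ≡R = ≡.≡-Reasoning
    open ℤ-Solver
    −1ℤ = ℤ.- (+ 1)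
    v = φ x ⊕ −1ℤ ⊙ φ y
    right : ∀ u → dot u v ≡ dot u (φ x) ℤ.+ −1ℤ ℤ.* dot u (φ y)
    right u = ≡.trans (dot-⊕ʳ (φ x) (−1ℤ ⊙ φ y) u) (≡.cong (λ z → dot u (φ x) ℤ.+ z) (dot-⊙ʳ −1ℤ (φ y) u))

  N≡0⇒≈0 : ∀ x → N x ≡ 0 → x ≈ 0#
  N≡0⇒≈0 x e = φ-injective (≡.trans (∥∥²≡0⇒≡𝟎 (φ x) e) (≡.sym (∥∥²≡0⇒≡𝟎 (φ 0#) N0)))
    where
    N0 : N 0# ≡ 0
    N0 = ℤₚ.+-injective (≡.trans (≡.cong +_ (N-cong (sym (-‿inverseʳ 1#))))
      (≡.trans (N-difference 1# 1#) (≡.trans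
        (≡.cong (λ z → (+ N 1# ℤ.+ + N 1#) ℤ.- (+ 2) ℤ.* z) (≡.sym (+∥∥² (φ 1#))))
        (≡.cong (λ m → (+ m ℤ.+ + m) ℤ.- (+ 2) ℤ.* + m) φ-1))))

  -- Pairing with 1 turns w² into N(w) ≥ 0 and -v² into -N(v) < 0.
  no-negative-square : ∀ {w v} → Unit v → ¬ (w * w ≈ - (v * v))
  no-negative-square {w} {v} u e = contradiction (N-unit u) (ℕₚ.<⇒≱ (ℕ.s≤s (ℕₚ.≤-reflexive
    (ℕₚ.m+n≡0⇒n≡0 (N w) (ℤₚ.+-injective (≡R.begin
      + (N w ℕ.+ N v)                   ≡R.≡⟨ ℤₚ.pos-+ (N w) (N v) ⟩
      + N w ℤ.+ + N v                   ≡R.≡⟨ ≡.cong (λ z → z ℤ.+ + N v) (≡R.begin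
        + N w                             ≡R.≡⟨ ⟪w*w,1⟫ w ⟨
        ⟪ w * w , 1# ⟫                    ≡R.≡⟨ ≡.cong (λ z → dot z (φ 1#)) (≡.trans (φ-cong e) (φ-neg (v * v))) ⟩
        dot ((ℤ.- (+ 1)) ⊙ φ (v * v)) (φ 1#) ≡R.≡⟨ dot-⊙ˡ (ℤ.- (+ 1)) (φ (v * v)) (φ 1#) ⟩
        (ℤ.- (+ 1)) ℤ.* ⟪ v * v , 1# ⟫    ≡R.≡⟨ ≡.cong ((ℤ.- (+ 1)) ℤ.*_) (⟪w*w,1⟫ v) ⟩
        (ℤ.- (+ 1)) ℤ.* + N v             ≡R.≡⟨ ℤₚ.-1*i≡-i (+ N v) ⟩
        ℤ.- (+ N v)                       ≡R.∎) ⟩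
      ℤ.- (+ N v) ℤ.+ + N v             ≡R.≡⟨ ℤₚ.+-inverseˡ (+ N v) ⟩
      + 0                               ≡R.∎))))))
    where module ≡R = ≡.≡-Reasoning

  -- N t = N t² = 1 forces t² = 1, by the equality case of Cauchy–Schwarz.
  odd-root-of-1 : ∀ q t → t ^ suc (2 ℕ.* q) ≈ 1# → t ≈ 1#
  odd-root-of-1 q t e = begin
    t                    ≈⟨ *-identityʳ t ⟨
    t * 1#               ≈⟨ *-congˡ (1^ q) ⟨
    t * 1# ^ q           ≈⟨ *-congˡ (^-congˡ q t²≈1) ⟨
    t * (t ^ 2) ^ q      ≈⟨ *-congˡ (^-assocʳ t 2 q) ⟩
    t * t ^ (2 ℕ.* q)    ≈⟨ e ⟩
    1#                   ∎
    where
    u : Unit t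
    u = Unit-factorˡ (Unit-resp (sym e) Unit-1)
    root : ∀ {s} → Unit s → s ^ suc (2 ℕ.* q) ≈ 1# → N s ≡ 1
    root v f = ℕₚ.≤-antisym (ℕₚ.≤-trans (N≤N^ v (2 ℕ.* q)) (ℕₚ.≤-reflexive (≡.trans (N-cong f) φ-1))) (N-unit v)
    [t²]^ : (t ^ 2) ^ suc (2 ℕ.* q) ≈ 1#
    [t²]^ = trans (^-assocʳ t 2 (suc (2 ℕ.* q))) (trans (^-congʳ t (ℕₚ.*-comm 2 (suc (2 ℕ.* q))))
      (trans (sym (^-assocʳ t (suc (2 ℕ.* q)) 2)) (trans (^-congˡ 2 e) (1^ 2))))
    N-t² : N (t ^ 2 + - 1#) ≡ 0
    N-t² = ℤₚ.+-injective (≡.trans (N-difference (t ^ 2) 1#) (≡.cong₂ (λ a b → a ℤ.- (+ 2) ℤ.* b)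
      (≡.cong₂ (λ a b → + a ℤ.+ + b) (root (Unit-^ 2 u) [t²]^) φ-1)
      (≡.trans (≡.cong (λ z → dot z (φ 1#)) (φ-cong (^2 t))) (≡.trans (⟪w*w,1⟫ t) (≡.cong +_ (root u e))))))
    t²≈1 : t ^ 2 ≈ 1#
    t²≈1 = x∙y⁻¹≈ε⇒x≈y (t ^ 2) 1# (N≡0⇒≈0 _ N-t²)

  -- The quotient x/y is a root of 1 of odd order.
  odd-root-unique : ∀ q {x y} → Unit y → x ^ suc (2 ℕ.* q) ≈ y ^ suc (2 ℕ.* q) → x ≈ y
  odd-root-unique q {x} {y} (z , yz) e = cancelʳ (y , trans (*-comm z y) yz) (trans
    (odd-root-of-1 q (x * z) (begin
      (x * z) ^ m      ≈⟨ ^-distrib-* x z m ⟩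
      x ^ m * z ^ m    ≈⟨ *-congʳ e ⟩
      y ^ m * z ^ m    ≈⟨ ^-distrib-* y z m ⟨
      (y * z) ^ m      ≈⟨ ^-congˡ m yz ⟩
      1# ^ m           ≈⟨ 1^ m ⟩
      1#               ∎))
    (sym yz))
    where m = suc (2 ℕ.* q)

  -- Products of conjugates of η and their exponents.

  σ^-cong : ∀ i {x y} → x ≈ y → σ^ i x ≈ σ^ i y
  σ^-cong zero    e = e
  σ^-cong (suc i) e = σ-cong (σ^-cong i e)

  σ^-* : ∀ i x y → σ^ i (x * y) ≈ σ^ i x * σ^ i y
  σ^-* zero    x y = refl
  σ^-* (suc i) x y = trans (σ-cong (σ^-* i x y)) (σ-* _ _)

  σ^-1 : ∀ i → σ^ i 1# ≈ 1#
  σ^-1 zero    = refl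
  σ^-1 (suc i) = trans (σ-cong (σ^-1 i)) σ-1

  σ^-^ : ∀ i x m → σ^ i (x ^ m) ≈ σ^ i x ^ m
  σ^-^ i x zero    = σ^-1 i
  σ^-^ i x (suc m) = trans (σ^-* i x (x ^ m)) (*-congˡ (σ^-^ i x m))

  σ^-σ : ∀ i x → σ^ i (σ x) ≡ σ (σ^ i x)
  σ^-σ zero    x = ≡.refl
  σ^-σ (suc i) x = ≡.cong σ (σ^-σ i x)

  ∏-cong : ∀ r {a b} → (∀ i → i ℕ.< r → a i ≡ b i) → ∏ r a ≈ ∏ r b
  ∏-cong zero    e = refl
  ∏-cong (suc r) e = *-cong (∏-cong r (λ i i<r → e i (ℕₚ.m<n⇒m<1+n i<r))) (^-congʳ _ (e r ℕₚ.≤-refl))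

  ∏-+ : ∀ r a b → ∏ r (λ i → a i ℕ.+ b i) ≈ ∏ r a * ∏ r b
  ∏-+ zero    a b = sym (*-identityˡ 1#)
  ∏-+ (suc r) a b = trans (*-cong (∏-+ r a b) (^-homo-* (σ^ r η) (a r) (b r))) (interchange _ _ _ _)

  ∏-0 : ∀ r → ∏ r (λ _ → 0) ≈ 1#
  ∏-0 zero    = refl
  ∏-0 (suc r) = trans (*-congʳ (∏-0 r)) (*-identityˡ 1#)

  ∏-* : ∀ r m a → ∏ r (λ i → m ℕ.* a i) ≈ ∏ r a ^ m
  ∏-* r zero    a = ∏-0 r
  ∏-* r (suc m) a = trans (∏-+ r a (λ i → m ℕ.* a i)) (*-congˡ (∏-* r m a))

  P : (ℕ → ℕ) → Carrier
  P = ∏ d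

  P-cong : ∀ {a b} → (∀ i → a i ≡ b i) → P a ≈ P b
  P-cong e = ∏-cong d (λ i _ → e i)

  P-const : ∀ m → P (λ _ → m) ≈ (- 1#) ^ m
  P-const m = trans (P-cong (λ _ → ≡.sym (ℕₚ.*-identityʳ m))) (trans (∏-* d m (λ _ → 1)) (^-congˡ m norm-η))

  d≡half+half : d ≡ half ℕ.+ half
  d≡half+half = ≡.cong (half ℕ.+_) (ℕₚ.+-identityʳ half)

  instance
    d≢0 : NonZero d
    d≢0 = ℕₚ.m^n≢0 2 (suc log-d)

  d-1 : ℕ
  d-1 = ℕ.pred d

  suc-d-1 : suc d-1 ≡ d
  suc-d-1 = ℕₚ.suc-pred d

  σ^d-1∘σ : ∀ x → σ^ d-1 (σ x) ≈ x
  σ^d-1∘σ x = trans (reflexive (≡.trans (σ^-σ d-1 x) (≡.cong (λ i → σ^ i x) suc-d-1))) (σ-period x)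

  -- The last factor of the norm, σᵈ⁻¹η, divides the unit -1; one more σ brings it back to η.
  η-unit : Unit η
  η-unit = Unit-resp (trans (*-identityʳ _) (trans (reflexive (≡.cong (λ i → σ^ i η) suc-d-1)) (σ-period η)))
    (Unit-σ (Unit-factorʳ (≡.subst (λ r → Unit (∏ r (λ _ → 1))) (≡.sym suc-d-1) (Unit-resp (sym norm-η) Unit-−1))))
    where
    Unit-σ : ∀ {x} → Unit (x ^ 1) → Unit (σ x ^ 1)
    Unit-σ {x} (y , e) = σ y , trans (*-congʳ (*-identityʳ (σ x))) (trans (sym (σ-* x y))
      (trans (σ-cong (trans (*-congʳ (sym (*-identityʳ x))) e)) σ-1))

  Unit-σ^ : ∀ i {x} → Unit x → Unit (σ^ i x)
  Unit-σ^ i {x} (y , e) = σ^ i y , trans (sym (σ^-* i x y)) (trans (σ^-cong i e) (σ^-1 i))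

  ∏-unit : ∀ r a → Unit (∏ r a)
  ∏-unit zero    a = Unit-1
  ∏-unit (suc r) a = Unit-* (∏-unit r a) (Unit-^ (a r) (Unit-σ^ r η-unit))

  P-unit : ∀ a → Unit (P a)
  P-unit = ∏-unit d

  -- Exponents indexed by ℤ/d are kept as d-periodic sequences on ℕ, so that a rotation is a plain
  -- shift of the argument.
  Periodic : (ℕ → ℕ) → Set
  Periodic a = ∀ i → a (d ℕ.+ i) ≡ a i

  periodic-*d : ∀ {a} → Periodic a → ∀ q i → a (q ℕ.* d ℕ.+ i) ≡ a i
  periodic-*d pa zero    i = ≡.refl
  periodic-*d {a} pa (suc q) i = ≡.trans (≡.cong a (ℕₚ.+-assoc d (q ℕ.* d) i))
    (≡.trans (pa (q ℕ.* d ℕ.+ i)) (periodic-*d pa q i))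

  periodic-% : ∀ {a} → Periodic a → ∀ i → a i ≡ a (i % d)
  periodic-% {a} pa i = ≡.trans (≡.cong a (≡.trans (m≡m%n+[m/n]*n i d) (ℕₚ.+-comm (i % d) (i / d ℕ.* d))))
    (periodic-*d pa (i / d) (i % d))

  shift-periodic : ∀ {a} → Periodic a → ∀ j → Periodic (λ i → a (j ℕ.+ i))
  shift-periodic {a} pa j i = ≡.trans (≡.cong a (swap j d i)) (pa (j ℕ.+ i))
    where
    swap : ∀ j d i → j ℕ.+ (d ℕ.+ i) ≡ d ℕ.+ (j ℕ.+ i)
    swap = solve 3 (λ j d i → j :+ (d :+ i) := d :+ (j :+ i)) ≡.refl
      where open ℕ-Solver

  half-half : ∀ {a} → Periodic a → ∀ i → a (half ℕ.+ (half ℕ.+ i)) ≡ a i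
  half-half {a} pa i = ≡.trans
    (≡.cong a (≡.trans (≡.sym (ℕₚ.+-assoc half half i)) (≡.cong (ℕ._+ i) (≡.sym d≡half+half)))) (pa i)

  ∏-rotate : ∀ r a → η ^ a 0 * σ (∏ r (λ i → a (suc i))) ≈ ∏ (suc r) a
  ∏-rotate zero    a = trans (*-congˡ σ-1) (*-comm _ _)
  ∏-rotate (suc r) a = begin
    η ^ a 0 * σ (∏ r a′ * σ^ r η ^ a′ r)
      ≈⟨ *-congˡ (σ-* _ _) ⟩
    η ^ a 0 * (σ (∏ r a′) * σ (σ^ r η ^ a′ r))
      ≈⟨ *-assoc _ _ _ ⟨
    η ^ a 0 * σ (∏ r a′) * σ (σ^ r η ^ a′ r)
      ≈⟨ *-cong (∏-rotate r a) (σ^-^ 1 (σ^ r η) (a′ r)) ⟩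
    ∏ (suc r) a * σ^ (suc r) η ^ a (suc r) ∎
    where a′ = λ i → a (suc i)

  -- Shifting the exponents thus acts as σ⁻¹ on the product. The factor that wraps around is σᵈη = η
  -- with exponent a d = a 0, which periodicity makes cancel.
  σP : ∀ {a} → Periodic a → σ (P (λ i → a (suc i))) ≈ P a
  σP {a} pa = cancelʳ (Unit-^ (a 0) η-unit) (begin
    σ (P (λ i → a (suc i))) * η ^ a 0    ≈⟨ *-comm _ _ ⟩
    η ^ a 0 * σ (P (λ i → a (suc i)))    ≈⟨ ∏-rotate d a ⟩
    P a * σ^ d η ^ a d                   ≈⟨ *-congˡ (^-congˡ (a d) (σ-period η)) ⟩
    P a * η ^ a d                        ≈⟨ *-congˡ (^-congʳ η (≡.trans (≡.cong a (≡.sym (ℕₚ.+-identityʳ d))) (pa 0))) ⟩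
    P a * η ^ a 0                        ∎)

  σ^P : ∀ j {a} → Periodic a → σ^ j (P (λ i → a (j ℕ.+ i))) ≈ P a
  σ^P zero    pa = refl
  σ^P (suc j) pa = trans (σ-cong (σ^P j (shift-periodic pa 1))) (σP pa)

  σ^half-P : ∀ {a} → Periodic a → σ^ half (P a) ≈ P (λ i → a (half ℕ.+ i))
  σ^half-P pa = trans (σ^-cong half (P-cong (λ i → ≡.sym (half-half pa i)))) (σ^P half (shift-periodic pa half))

  -- A product of conjugates of η that is a square has even exponents: the group
  -- ring of ⟨σ⟩ over 𝔽₂ is local with socle the norm element, so some iterate
  -- of Δ = 1 + σ would otherwise make −v² a square for a unit v, by norm-η.

  Square : (ℕ → ℕ) → Set
  Square a = ∃ λ w → w * w ≈ P a

  Δ : (ℕ → ℕ) → ℕ → ℕ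
  Δ a i = a i ℕ.+ a (suc i)

  Δ^ : ℕ → (ℕ → ℕ) → ℕ → ℕ
  Δ^ zero    a = a
  Δ^ (suc m) a = Δ^ m (Δ a)

  Δ^-+ : ∀ m m′ a → Δ^ (m ℕ.+ m′) a ≡ Δ^ m′ (Δ^ m a)
  Δ^-+ zero    m′ a = ≡.refl
  Δ^-+ (suc m) m′ a = Δ^-+ m m′ (Δ a)

  Δ-periodic : ∀ {a} → Periodic a → Periodic (Δ a)
  Δ-periodic {a} pa i = ≡.cong₂ ℕ._+_ (pa i) (≡.trans (≡.cong a (≡.sym (ℕₚ.+-suc d i))) (pa (suc i)))

  -- If w is a square root for a, then σ⁻¹w is one for the shifted exponents; σ⁻¹ is available as
  -- σᵈ⁻¹.
  Δ-square : ∀ {a} → Periodic a → Square a → Square (Δ a)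
  Δ-square {a} pa (w , e) = w * w′ , (begin
    (w * w′) * (w * w′)            ≈⟨ interchange w w′ w w′ ⟩
    (w * w) * (w′ * w′)            ≈⟨ *-cong e (sym (σ^-* d-1 w w)) ⟩
    P a * σ^ d-1 (w * w)           ≈⟨ *-congˡ (σ^-cong d-1 (trans e (sym (σP pa)))) ⟩
    P a * σ^ d-1 (σ (P (λ i → a (suc i))))  ≈⟨ *-congˡ (σ^d-1∘σ _) ⟩
    P a * P (λ i → a (suc i))      ≈⟨ ∏-+ d a (λ i → a (suc i)) ⟨
    P (Δ a)                        ∎)
    where w′ = σ^ d-1 w

  2∣n+n : ∀ n → 2 ∣ n ℕ.+ n
  2∣n+n n = divides n (solve 1 (λ n → n :+ n := n :* con 2) ≡.refl n)
    where open ℕ-Solver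

  -- Frobenius in characteristic 2: the 2ʲ-th power of 1 + shift is 1 + shift by 2ʲ. A congruence
  -- modulo 2 is stated as evenness of the sum, which avoids subtraction in ℕ.
  Δ^2^ : ∀ j a i → 2 ∣ Δ^ (2 ℕ.^ j) a i ℕ.+ (a i ℕ.+ a (2 ℕ.^ j ℕ.+ i))
  Δ^2^ zero    a i = 2∣n+n (a i ℕ.+ a (suc i))
  Δ^2^ (suc j) a i = ≡.subst (λ z → 2 ∣ z ℕ.+ (a i ℕ.+ a (2 ℕ.^ suc j ℕ.+ i)))
    (≡.cong-app (≡.trans (≡.sym (Δ^-+ D D a)) (≡.cong (λ m → Δ^ m a) (≡.sym 2D))) i)
    (∣m+n∣m⇒∣n {m = (b i ℕ.+ b (D ℕ.+ i)) ℕ.+ (b i ℕ.+ b (D ℕ.+ i)) ℕ.+ (a (D ℕ.+ i) ℕ.+ a (D ℕ.+ i))}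
      (≡.subst (2 ∣_) (rearrange (Δ^ D b i) (b i) (b (D ℕ.+ i)) (a i) (a (D ℕ.+ i)) (a (2 ℕ.^ suc j ℕ.+ i)))
        (∣m∣n⇒∣m+n (Δ^2^ j b i) (∣m∣n⇒∣m+n (Δ^2^ j a i)
          (≡.subst (λ z → 2 ∣ b (D ℕ.+ i) ℕ.+ (a (D ℕ.+ i) ℕ.+ a z))
            (≡.trans (≡.sym (ℕₚ.+-assoc D D i)) (≡.cong (ℕ._+ i) (≡.sym 2D))) (Δ^2^ j a (D ℕ.+ i))))))
      (∣m∣n⇒∣m+n (2∣n+n (b i ℕ.+ b (D ℕ.+ i))) (2∣n+n (a (D ℕ.+ i)))))
    where
    D = 2 ℕ.^ j
    b = Δ^ D a
    2D : 2 ℕ.^ suc j ≡ D ℕ.+ D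
    2D = ≡.cong (D ℕ.+_) (ℕₚ.+-identityʳ D)
    rearrange : ∀ e b b′ a a′ a″ → (e ℕ.+ (b ℕ.+ b′)) ℕ.+ ((b ℕ.+ (a ℕ.+ a′)) ℕ.+ (b′ ℕ.+ (a′ ℕ.+ a″))) ≡
      ((b ℕ.+ b′) ℕ.+ (b ℕ.+ b′) ℕ.+ (a′ ℕ.+ a′)) ℕ.+ (e ℕ.+ (a ℕ.+ a″))
    rearrange = solve 6 (λ e b b′ a a′ a″ → (e :+ (b :+ b′)) :+ ((b :+ (a :+ a′)) :+ (b′ :+ (a′ :+ a″))) :=
      ((b :+ b′) :+ (b :+ b′) :+ (a′ :+ a′)) :+ (e :+ (a :+ a″))) ≡.refl
      where open ℕ-Solver

  Δ^d-even : ∀ {a} → Periodic a → ∀ i → 2 ∣ Δ^ d a i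
  Δ^d-even {a} pa i = ∣m+n∣m⇒∣n {m = a i ℕ.+ a i}
    (≡.subst (2 ∣_) (≡.trans (≡.cong (λ z → Δ^ d a i ℕ.+ (a i ℕ.+ z)) (pa i)) (ℕₚ.+-comm (Δ^ d a i) _)) (Δ^2^ (suc log-d) a i))
    (2∣n+n (a i))

  -- With aᵢ = 1 + 2cᵢ the product is -(∏ ηᵢ^cᵢ)² by `norm-η`.
  odd-exponents : ∀ {a} → Square a → ¬ (∀ i → ∃ λ c → a i ≡ suc (2 ℕ.* c))
  odd-exponents {a} (w , e) odd = no-negative-square (P-unit c) (begin
    w * w                              ≈⟨ e ⟩
    P a                                ≈⟨ P-cong (λ i → proj₂ (odd i)) ⟩
    P (λ i → 1 ℕ.+ 2 ℕ.* c i)          ≈⟨ ∏-+ d (λ _ → 1) (λ i → 2 ℕ.* c i) ⟩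
    P (λ _ → 1) * P (λ i → 2 ℕ.* c i)  ≈⟨ *-cong norm-η (trans (∏-* d 2 c) (^2 (P c))) ⟩
    - 1# * (P c * P c)                 ≈⟨ -‿distribˡ-* 1# _ ⟨
    - (1# * (P c * P c))               ≈⟨ -‿cong (*-identityˡ _) ⟩
    - (P c * P c)                      ∎)
    where c = λ i → proj₁ (odd i)

  -- The induction hypothesis for Δa says that neighbouring exponents have equal parity, so all are
  -- even or all are odd; `odd-exponents` excludes the latter.
  square-descent : ∀ m {a} → Periodic a → Square a → (∀ i → 2 ∣ Δ^ m a i) → ∀ i → 2 ∣ a i
  square-descent zero    pa s ev = ev
  square-descent (suc m) {a} pa s ev with even⊎odd (a 0)
  ... | inj₁ even₀ = allEven
    where
    same : ∀ i → 2 ∣ a i ℕ.+ a (suc i)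
    same = square-descent m (Δ-periodic pa) (Δ-square pa s) ev
    allEven : ∀ i → 2 ∣ a i
    allEven zero    = even₀
    allEven (suc i) = ∣m+n∣m⇒∣n (same i) (allEven i)
  ... | inj₂ odd₀ = ⊥-elim (odd-exponents s allOdd)
    where
    same : ∀ i → 2 ∣ a i ℕ.+ a (suc i)
    same = square-descent m (Δ-periodic pa) (Δ-square pa s) ev
    allOdd : ∀ i → ∃ λ c → a i ≡ suc (2 ℕ.* c)
    allOdd zero    = odd₀
    allOdd (suc i) with even⊎odd (a (suc i))
    ... | inj₂ o = o
    ... | inj₁ e with c , f ← allOdd i = ⊥-elim (1+2c-odd c (≡.subst (2 ∣_) f
            (∣m+n∣m⇒∣n (≡.subst (2 ∣_) (ℕₚ.+-comm (a i) (a (suc i))) (same i)) e)))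
      where
      1+2c-odd : ∀ c → ¬ (2 ∣ suc (2 ℕ.* c))
      1+2c-odd c (divides q g) = ℕₚ.even≢odd q c (≡.trans (ℕₚ.*-comm 2 q) (≡.sym g))

  square-exponents-even : ∀ {a} → Periodic a → Square a → ∀ i → 2 ∣ a i
  square-exponents-even pa s = square-descent d pa s (Δ^d-even pa)

  2*half : ∀ {n} → 2 ∣ n → n ≡ 2 ℕ.* (n / 2)
  2*half {n} 2∣n = ≡.sym (m*[n/m]≡n 2∣n)
    where open import Data.Nat.DivMod using (m*[n/m]≡n)

  halve-periodic : ∀ {a} m .{{_ : NonZero m}} → Periodic a → Periodic (λ i → a i / m)
  halve-periodic m pa i = ≡.cong (_/ m) (pa i)

  -- A 2-adic descent: 1 is a square, so a = 2c and the product with exponents c is 1 or -1. In the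
  -- second case adding 1 to every exponent restores the value 1 and leaves the differences
  -- unchanged.
  exponent-differences : ∀ m {a} → Periodic a → P a ≈ 1# → ∀ i j → 2 ℕ.^ m ∣ ℕ.∣ a i - a j ∣
  exponent-differences zero    pa e i j = 1∣ _
  exponent-differences (suc m) {a} pa e i j =
    ≡.subst (2 ℕ.^ suc m ∣_)
      (≡.trans (ℕₚ.*-distribˡ-∣-∣ 2 (c i) (c j)) (≡.sym (≡.cong₂ ℕ.∣_-_∣ (a≡2c i) (a≡2c j))))
      (*-monoʳ-∣ 2 (go (√1 (P c) (trans (sym (^2 (P c))) (trans (sym (∏-* d 2 c)) (trans (sym (P-cong a≡2c)) e))))))
    where
    c = λ i → a i / 2
    a≡2c : ∀ i → a i ≡ 2 ℕ.* c i
    a≡2c i = 2*half (square-exponents-even pa (1# , trans (*-identityˡ 1#) (sym e)) i)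
    go : P c ≈ 1# ⊎ P c ≈ - 1# → 2 ℕ.^ m ∣ ℕ.∣ c i - c j ∣
    go (inj₁ f) = exponent-differences m (halve-periodic 2 pa) f i j
    go (inj₂ f) = exponent-differences m {λ i → suc (c i)} (λ i → ≡.cong suc (halve-periodic 2 pa i))
      (trans (∏-+ d (λ _ → 1) c) (trans (*-cong norm-η f) -1*-1)) i j

  n<2^n : ∀ n → n ℕ.< 2 ℕ.^ n
  n<2^n zero    = ℕ.s≤s ℕ.z≤n
  n<2^n (suc n) = ℕₚ.≤-trans (ℕₚ.+-mono-≤ (ℕₚ.m^n>0 2 n) (n<2^n n))
    (ℕₚ.≤-reflexive (≡.cong (2 ℕ.^ n ℕ.+_) (≡.sym (ℕₚ.+-identityʳ (2 ℕ.^ n)))))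

  constant-exponents : ∀ {a} → Periodic a → P a ≈ 1# → ∀ i j → a i ≡ a j
  constant-exponents {a} pa e i j = ℕₚ.∣m-n∣≡0⇒m≡n (go _ (λ m → exponent-differences m pa e i j))
    where
    go : ∀ x → (∀ m → 2 ℕ.^ m ∣ x) → x ≡ 0
    go zero    f = ≡.refl
    go (suc x) f = contradiction (∣⇒≤ (f (suc x))) (ℕₚ.<⇒≱ (n<2^n (suc x)))

  periodic-bounded : ∀ {a} → Periodic a → ∃ λ B → ∀ i → a i ℕ.≤ B
  periodic-bounded {a} pa = sum d , λ i →
    ≡.subst (ℕ._≤ sum d) (≡.sym (periodic-% pa i)) (≤sum d (i % d) (m%n<n i d))
    where
    sum : ℕ → ℕ
    sum zero    = 0
    sum (suc r) = sum r ℕ.+ a r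
    ≤sum : ∀ r i → i ℕ.< r → a i ℕ.≤ sum r
    ≤sum (suc r) i i<r with ℕₚ.m≤n⇒m<n∨m≡n (ℕ.s≤s⁻¹ i<r)
    ... | inj₁ i<r′    = ℕₚ.≤-trans (≤sum r i i<r′) (ℕₚ.m≤m+n _ _)
    ... | inj₂ ≡.refl  = ℕₚ.m≤n+m _ _

  -- Complementing to a constant inverts up to the product with constant exponent, a power of -1;
  -- the constant 2B is taken even to make that power 1.
  inverse-exponents : ∀ {a} → Periodic a → ∃ λ b → Periodic b × P a * P b ≈ 1# × ∃ λ B → ∀ i → a i ℕ.+ b i ≡ B
  inverse-exponents {a} pa with B , a≤B ← periodic-bounded pa =
    b , (λ i → ≡.cong (2 ℕ.* B ℕ.∸_) (pa i)) ,
    trans (sym (∏-+ d a b)) (trans (P-cong a+b) (trans (P-const (2 ℕ.* B)) ([-1]^even B))) ,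
    2 ℕ.* B , a+b
    where
    b = λ i → 2 ℕ.* B ℕ.∸ a i
    a+b : ∀ i → a i ℕ.+ b i ≡ 2 ℕ.* B
    a+b i = ℕₚ.m+[n∸m]≡n (ℕₚ.≤-trans (a≤B i) (ℕₚ.m≤m+n B _))

  +-periodic : ∀ {a b} → Periodic a → Periodic b → Periodic (λ i → a i ℕ.+ b i)
  +-periodic pa pb i = ≡.cong₂ ℕ._+_ (pa i) (pb i)

  *-periodic : ∀ m {a} → Periodic a → Periodic (λ i → m ℕ.* a i)
  *-periodic m pa i = ≡.cong (m ℕ.*_) (pa i)

  -- The subtraction-free form of: a - b is constant.
  independence : ∀ {a b} → Periodic a → Periodic b → P a ≈ P b → ∀ i j → a i ℕ.+ b j ≡ a j ℕ.+ b i
  independence {a} {b} pa pb e i j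
    with b′ , pb′ , inv , B , b+b′ ← inverse-exponents pb = ℕₚ.+-cancelʳ-≡ B _ _ (≡R.begin
      (a i ℕ.+ b j) ℕ.+ B                ≡R.≡⟨ ≡.cong ((a i ℕ.+ b j) ℕ.+_) (b+b′ i) ⟨
      (a i ℕ.+ b j) ℕ.+ (b i ℕ.+ b′ i)   ≡R.≡⟨ solve 4 (λ a b c d → (a :+ b) :+ (c :+ d) := (a :+ d) :+ (b :+ c)) ≡.refl (a i) (b j) (b i) (b′ i) ⟩
      (a i ℕ.+ b′ i) ℕ.+ (b j ℕ.+ b i)   ≡R.≡⟨ ≡.cong (ℕ._+ (b j ℕ.+ b i)) (constant-exponents (+-periodic pa pb′)
                                              (trans (∏-+ d a b′) (trans (*-congʳ e) inv)) i j) ⟩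
      (a j ℕ.+ b′ j) ℕ.+ (b j ℕ.+ b i)   ≡R.≡⟨ solve 4 (λ a b c d → (a :+ d) :+ (b :+ c) := (a :+ c) :+ (b :+ d)) ≡.refl (a j) (b j) (b i) (b′ j) ⟩
      (a j ℕ.+ b i) ℕ.+ (b j ℕ.+ b′ j)   ≡R.≡⟨ ≡.cong ((a j ℕ.+ b i) ℕ.+_) (b+b′ j) ⟩
      (a j ℕ.+ b i) ℕ.+ B                ≡R.∎)
    where
    module ≡R = ≡.≡-Reasoning
    open ℕ-Solver

  -- Relative units and classes modulo circular units.

  Relative : Carrier → Set
  Relative u = u * σ^ half u ≈ 1#

  Relative-^ : ∀ m {u} → Relative u → Relative (u ^ m)
  Relative-^ m {u} e = trans (*-congˡ (σ^-^ half u m)) (trans (sym (^-distrib-* u (σ^ half u) m)) (trans (^-congˡ m e) (1^ m)))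

  Relative-quotient : ∀ {u v w} → Relative u → Relative v → u ≈ v * w → Relative w
  Relative-quotient {u} {v} {w} ru rv e = begin
    w * σ^ half w                         ≈⟨ *-identityˡ _ ⟨
    1# * (w * σ^ half w)                  ≈⟨ *-congʳ rv ⟨
    (v * σ^ half v) * (w * σ^ half w)     ≈⟨ interchange _ _ _ _ ⟩
    (v * w) * (σ^ half v * σ^ half w)     ≈⟨ *-congˡ (σ^-* half v w) ⟨
    (v * w) * σ^ half (v * w)             ≈⟨ *-cong e (σ^-cong half e) ⟨
    u * σ^ half u                         ≈⟨ ru ⟩
    1#                                    ∎

  Relative-1 : Relative 1#
  Relative-1 = trans (*-identityˡ _) (σ^-1 half)

  infix 4 _∼_

  -- Cosets of all products of conjugates of η. For two relative units the factor between them is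
  -- itself relative by `Relative-quotient`, so between them this is equality of classes in the
  -- quotient studied.
  _∼_ : Carrier → Carrier → Set
  u ∼ v = ∃ λ a → Periodic a × u ≈ v * P a

  Circular : Carrier → Set
  Circular u = ∃ λ a → Periodic a × u ≈ P a

  Circular-resp : ∀ {u v} → u ≈ v → Circular u → Circular v
  Circular-resp e (a , pa , f) = a , pa , trans (sym e) f

  ∼-refl : ∀ {u} → u ∼ u
  ∼-refl = (λ _ → 0) , (λ _ → ≡.refl) , sym (trans (*-congˡ (∏-0 d)) (*-identityʳ _))

  ∼-respˡ : ∀ {u v w} → u ≈ v → u ∼ w → v ∼ w
  ∼-respˡ e (a , pa , f) = a , pa , trans (sym e) f

  ≈⇒∼ : ∀ {u v} → u ≈ v → u ∼ v
  ≈⇒∼ e = ∼-respˡ (sym e) ∼-refl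

  ∼-sym : ∀ {u v} → u ∼ v → v ∼ u
  ∼-sym {u} {v} (a , pa , e) with b , pb , inv , _ ← inverse-exponents pa = b , pb , (begin
    v                ≈⟨ *-identityʳ v ⟨
    v * 1#           ≈⟨ *-congˡ inv ⟨
    v * (P a * P b)  ≈⟨ *-assoc _ _ _ ⟨
    v * P a * P b    ≈⟨ *-congʳ e ⟨
    u * P b          ∎)

  ∼-trans : ∀ {u v w} → u ∼ v → v ∼ w → u ∼ w
  ∼-trans {u} {v} {w} (a , pa , e) (b , pb , f) = (λ i → b i ℕ.+ a i) , +-periodic pb pa , (begin
    u                ≈⟨ e ⟩
    v * P a          ≈⟨ *-congʳ f ⟩
    w * P b * P a    ≈⟨ *-assoc _ _ _ ⟩
    w * (P b * P a)  ≈⟨ *-congˡ (∏-+ d b a) ⟨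
    w * P (λ i → b i ℕ.+ a i) ∎)

  ∼-^ : ∀ m {u v} → u ∼ v → u ^ m ∼ v ^ m
  ∼-^ m {u} {v} (a , pa , e) = (λ i → m ℕ.* a i) , *-periodic m pa ,
    trans (^-congˡ m e) (trans (^-distrib-* v (P a) m) (*-congˡ (sym (∏-* d m a))))

  ∼-circular : ∀ {u v} → u ∼ v → Circular v → Circular u
  ∼-circular (a , pa , e) (b , pb , f) = (λ i → b i ℕ.+ a i) , +-periodic pb pa ,
    trans e (trans (*-congʳ f) (sym (∏-+ d b a)))

  Circular-^ : ∀ m {u} → Circular u → Circular (u ^ m)
  Circular-^ m (a , pa , e) = (λ i → m ℕ.* a i) , *-periodic m pa , trans (^-congˡ m e) (sym (∏-* d m a))

  Circular-neg : ∀ {u} → Circular u → Circular (- 1# * u)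
  Circular-neg (a , pa , e) = (λ i → 1 ℕ.+ a i) , (λ i → ≡.cong suc (pa i)) ,
    trans (*-cong (sym norm-η) e) (sym (∏-+ d (λ _ → 1) a))

  -- The exponents of u² are even, so u divided by the product with halved exponents squares to 1;
  -- it is 1 or -1, and -1 is circular by `norm-η`.
  circular-2-saturated : ∀ u → Circular (u * u) → Circular u
  circular-2-saturated u (a , pa , e) = go (√1 (u * P c′) [uPc′]²)
    where
    c = λ i → a i / 2
    inv = inverse-exponents (halve-periodic 2 pa)
    c′ = proj₁ inv
    cc′ : P c * P c′ ≈ 1#
    cc′ = proj₁ (proj₂ (proj₂ inv))
    [uPc′]² : (u * P c′) * (u * P c′) ≈ 1#
    [uPc′]² = begin
      (u * P c′) * (u * P c′)        ≈⟨ interchange u (P c′) u (P c′) ⟩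
      (u * u) * (P c′ * P c′)        ≈⟨ *-congʳ (trans e (trans (P-cong (λ i → 2*half (square-exponents-even pa (u , e) i)))
                                          (trans (∏-* d 2 c) (^2 (P c))))) ⟩
      (P c * P c) * (P c′ * P c′)    ≈⟨ interchange (P c) (P c) (P c′) (P c′) ⟩
      (P c * P c′) * (P c * P c′)    ≈⟨ *-cong cc′ cc′ ⟩
      1# * 1#                        ≈⟨ *-identityˡ 1# ⟩
      1#                             ∎
    from : ∀ {s} → u * P c′ ≈ s → u ≈ s * P c
    from {s} f = cancelʳ (P-unit c′) (trans f (sym (trans (*-assoc s (P c) (P c′)) (trans (*-congˡ cc′) (*-identityʳ s)))))
    go : u * P c′ ≈ 1# ⊎ u * P c′ ≈ - 1# → Circular u
    go (inj₁ f) = c , halve-periodic 2 pa , trans (from f) (*-identityˡ (P c))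
    go (inj₂ f) = Circular-resp (sym (from f)) (Circular-neg (c , halve-periodic 2 pa , refl))

  circular-2^-saturated : ∀ j u → Circular (u ^ (2 ℕ.^ j)) → Circular u
  circular-2^-saturated zero    u c = Circular-resp (*-identityʳ u) c
  circular-2^-saturated (suc j) u c = circular-2^-saturated j u (circular-2-saturated _
    (Circular-resp (trans (^-congʳ u (ℕₚ.*-comm 2 (2 ℕ.^ j))) (trans (sym (^-assocʳ u (2 ℕ.^ j) 2)) (^2 _))) c))

  -- Bounded representatives and a uniform exponent.

  -- The successor keeps the constant positive, so that its powers grow with the exponent.
  B : ℕ → ℕ
  B i = suc (proj₁ (φ-bounded (σ^ i η)))

  N-η* : ∀ i y → N (σ^ i η * y) ℕ.≤ B i ℕ.* N y
  N-η* i y = ℕₚ.≤-trans (proj₂ (φ-bounded (σ^ i η)) y) (ℕₚ.*-monoˡ-≤ (N y) (ℕₚ.n≤1+n (proj₁ (φ-bounded (σ^ i η)))))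

  N-η^* : ∀ i c y → N (σ^ i η ^ c * y) ℕ.≤ B i ℕ.^ c ℕ.* N y
  N-η^* i zero    y = ℕₚ.≤-reflexive (≡.trans (N-cong (*-identityˡ y)) (≡.sym (ℕₚ.+-identityʳ _)))
  N-η^* i (suc c) y = R.begin
    N (σ^ i η ^ suc c * y)             R.≡⟨ N-cong (*-assoc _ _ _) ⟩
    N (σ^ i η * (σ^ i η ^ c * y))      R.≤⟨ N-η* i _ ⟩
    B i ℕ.* N (σ^ i η ^ c * y)         R.≤⟨ ℕₚ.*-monoʳ-≤ (B i) (N-η^* i c y) ⟩
    B i ℕ.* (B i ℕ.^ c ℕ.* N y)        R.≡⟨ ≡.sym (ℕₚ.*-assoc (B i) (B i ℕ.^ c) (N y)) ⟩
    B i ℕ.^ suc c ℕ.* N y              R.∎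
    where module R = ℕₚ.≤-Reasoning

  [x*y]^ : ∀ m x y → (x ℕ.* y) ℕ.^ m ≡ x ℕ.^ m ℕ.* y ℕ.^ m
  [x*y]^ zero    x y = ≡.refl
  [x*y]^ (suc m) x y = ≡.trans (≡.cong ((x ℕ.* y) ℕ.*_) ([x*y]^ m x y))
    (solve 4 (λ x y a b → (x :* y) :* (a :* b) := (x :* a) :* (y :* b)) ≡.refl x y (x ℕ.^ m) (y ℕ.^ m))
    where open ℕ-Solver

  ∏B : ℕ → ℕ
  ∏B zero    = 1
  ∏B (suc r) = B r ℕ.* ∏B r

  N-∏ : ∀ m r c → (∀ i → c i ℕ.≤ m) → N (∏ r c) ℕ.≤ ∏B r ℕ.^ m
  N-∏ m zero    c le = ℕₚ.≤-reflexive (≡.trans φ-1 (≡.sym (ℕₚ.^-zeroˡ m)))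
  N-∏ m (suc r) c le = R.begin
    N (∏ r c * σ^ r η ^ c r)           R.≡⟨ N-cong (*-comm _ _) ⟩
    N (σ^ r η ^ c r * ∏ r c)           R.≤⟨ N-η^* r (c r) _ ⟩
    B r ℕ.^ c r ℕ.* N (∏ r c)          R.≤⟨ ℕₚ.*-mono-≤ (ℕₚ.^-monoʳ-≤ (B r) (le r)) (N-∏ m r c le) ⟩
    B r ℕ.^ m ℕ.* ∏B r ℕ.^ m           R.≡⟨ ≡.sym ([x*y]^ m (B r) (∏B r)) ⟩
    (B r ℕ.* ∏B r) ℕ.^ m               R.∎
    where module R = ℕₚ.≤-Reasoning

  -- Divide u by the circular unit with exponents ⌊aᵢ/m⌋: the exponents of the
  -- m-th power become less than m, so its size is at most (∏B d)ᵐ.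
  reduce-exponents : ∀ m .{{_ : NonZero m}} u a → Periodic a → u ^ m ≈ P a →
    ∃ λ v → u ∼ v × v ^ m ≈ P (λ i → a i % m)
  reduce-exponents m u a pa e with q′ , pq′ , inv , _ ← inverse-exponents (halve-periodic m pa) =
    u * P q′ , ∼-sym (q′ , pq′ , refl) , (begin
      (u * P q′) ^ m                 ≈⟨ ^-distrib-* u (P q′) m ⟩
      u ^ m * P q′ ^ m               ≈⟨ *-congʳ (trans e (trans (P-cong a≡) (trans (∏-+ d r (λ i → m ℕ.* q i)) (*-congˡ (∏-* d m q))))) ⟩
      P r * P q ^ m * P q′ ^ m       ≈⟨ *-assoc _ _ _ ⟩
      P r * (P q ^ m * P q′ ^ m)     ≈⟨ *-congˡ (trans (sym (^-distrib-* (P q) (P q′) m)) (trans (^-congˡ m inv) (1^ m))) ⟩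
      P r * 1#                       ≈⟨ *-identityʳ _ ⟩
      P r                            ∎)
    where
    q = λ i → a i / m
    r = λ i → a i % m
    a≡ : ∀ i → a i ≡ r i ℕ.+ m ℕ.* q i
    a≡ i = ≡.trans (m≡m%n+[m/n]*n (a i) m) (≡.cong (r i ℕ.+_) (ℕₚ.*-comm (q i) m))

  root-unit : ∀ m .{{_ : NonZero m}} {v} → Unit (v ^ m) → Unit v
  root-unit (suc m) = Unit-factorˡ

  ^-cancel-≤ : ∀ m .{{_ : NonZero m}} x y → x ℕ.^ m ℕ.≤ y ℕ.^ m → x ℕ.≤ y
  ^-cancel-≤ m x y le = ℕₚ.≮⇒≥ λ y<x → ℕₚ.<⇒≱ (ℕₚ.^-monoˡ-< m y<x) le

  -- Both estimates, N(v)ᵐ ≤ N(vᵐ) and N(vᵐ) ≤ (∏B d)ᵐ, carry the exponent m, so taking m-th roots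
  -- leaves a bound without m.
  bounded-representative : ∀ m .{{_ : NonZero m}} u → Circular (u ^ m) → ∃ λ v → u ∼ v × N v ℕ.≤ ∏B d
  bounded-representative m u (a , pa , e) with v , u∼v , f ← reduce-exponents m u a pa e =
    v , u∼v , ^-cancel-≤ m (N v) (∏B d) (ℕₚ.≤-trans (N-^ (root-unit m (Unit-resp (sym f) (P-unit _))) m)
      (ℕₚ.≤-trans (ℕₚ.≤-reflexive (N-cong f)) (N-∏ m d _ (λ i → ℕₚ.<⇒≤ (m%n<n (a i) m)))))

  -- Among any F + 1 vectors of the box two coincide. The number depends only on the unit system,
  -- not on l or on a class.
  F : ℕ
  F = length (box (∏B d) rank)

  ^-^-comm : ∀ x m n → (x ^ m) ^ n ≈ (x ^ n) ^ m
  ^-^-comm x m n = trans (^-assocʳ x m n) (trans (^-congʳ x (ℕₚ.*-comm m n)) (sym (^-assocʳ x n m)))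

  l^-+ : ∀ l x i j → x ^ (l ℕ.^ (i ℕ.+ j)) ≈ (x ^ (l ℕ.^ i)) ^ (l ℕ.^ j)
  l^-+ l x i j = trans (^-congʳ x (ℕₚ.^-distribˡ-+-* l i j)) (sym (^-assocʳ x (l ℕ.^ i) (l ℕ.^ j)))

  -- Iterating j times gives w ∼ w^(l^(j(e+1))), and j(e+1) ≥ j, so the right side is a power of the
  -- circular unit w^(lʲ).
  self-similar : ∀ l e w → w ∼ w ^ (l ℕ.^ suc e) → ∀ j → Circular (w ^ (l ℕ.^ j)) → Circular w
  self-similar l e w s j c = ∼-circular (iterate j)
    (Circular-resp (trans (sym (l^-+ l w j (j ℕ.* e))) (^-congʳ w (≡.cong (l ℕ.^_) (≡.sym (ℕₚ.*-suc j e))))) (Circular-^ (l ℕ.^ (j ℕ.* e)) c))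
    where
    iterate : ∀ t → w ∼ w ^ (l ℕ.^ (t ℕ.* suc e))
    iterate zero    = ≈⇒∼ (sym (*-identityʳ w))
    iterate (suc t) = ∼-trans s (∼-trans (∼-^ (l ℕ.^ suc e) (iterate t))
      (≈⇒∼ (trans (^-^-comm w (l ℕ.^ (t ℕ.* suc e)) (l ℕ.^ suc e)) (sym (l^-+ l w (suc e) (t ℕ.* suc e))))))

  -- Two of the classes of u^(lⁱ), 0 ≤ i ≤ F, share a bounded representative. The one with smaller i
  -- is therefore equivalent to a proper l-power power of itself, hence circular by `self-similar`,
  -- and i ≤ F.
  exponent-bound : ∀ l .{{_ : NonZero l}} u j → Circular (u ^ (l ℕ.^ j)) → Circular (u ^ (l ℕ.^ F))
  exponent-bound l u j c = Circular-resp
    (trans (sym (l^-+ l u (toℕ i) (F ℕ.∸ toℕ i))) (^-congʳ u (≡.cong (l ℕ.^_) (ℕₚ.m+[n∸m]≡n (Finₚ.toℕ≤pred[n] i)))))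
    (Circular-^ (l ℕ.^ (F ℕ.∸ toℕ i)) (self-similar l e (u ^ (l ℕ.^ toℕ i)) similar j
      (Circular-resp (^-^-comm u (l ℕ.^ j) (l ℕ.^ toℕ i)) (Circular-^ (l ℕ.^ toℕ i) c))))
    where
    rep : ∀ (i : Fin (suc F)) → ∃ λ v → u ^ (l ℕ.^ toℕ i) ∼ v × N v ℕ.≤ ∏B d
    rep i = bounded-representative (l ℕ.^ j) {{ℕₚ.m^n≢0 l j}} _
      (Circular-resp (^-^-comm u (l ℕ.^ j) (l ℕ.^ toℕ i)) (Circular-^ (l ℕ.^ toℕ i) c))
    v∈ : ∀ i → φ (proj₁ (rep i)) ∈ box (∏B d) rank
    v∈ i = ∈-box (∏B d) _ (proj₂ (proj₂ (rep i)))
    collision = Finₚ.pigeonhole (ℕₚ.n<1+n F) (λ i → Any.index (v∈ i))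
    i = proj₁ collision
    i′ = proj₁ (proj₂ collision)
    i<i′ = proj₁ (proj₂ (proj₂ collision))
    v≈v′ : proj₁ (rep i) ≈ proj₁ (rep i′)
    v≈v′ = φ-injective (≡.trans (lookup-index (v∈ i))
      (≡.trans (≡.cong (lookup (box (∏B d) rank)) (proj₂ (proj₂ (proj₂ collision)))) (≡.sym (lookup-index (v∈ i′)))))
    e = toℕ i′ ℕ.∸ suc (toℕ i)
    i+e : toℕ i ℕ.+ suc e ≡ toℕ i′
    i+e = ≡.trans (ℕₚ.+-suc (toℕ i) e) (ℕₚ.m+[n∸m]≡n i<i′)
    similar : u ^ (l ℕ.^ toℕ i) ∼ (u ^ (l ℕ.^ toℕ i)) ^ (l ℕ.^ suc e)
    similar = ∼-trans (proj₁ (proj₂ (rep i))) (∼-trans (≈⇒∼ v≈v′) (∼-trans (∼-sym (proj₁ (proj₂ (rep i′))))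
      (≈⇒∼ (trans (^-congʳ u (≡.cong (l ℕ.^_) (≡.sym i+e))) (l^-+ l u (toℕ i) (suc e))))))

-- Counting by free orbits of a cyclic 2-group.

module FreeOrbits {A : Set} (τ : A → A) where

  τ^ : ℕ → A → A
  τ^ i x = fold x τ i

  τ^-+ : ∀ i j x → τ^ (i ℕ.+ j) x ≡ τ^ i (τ^ j x)
  τ^-+ zero    j x = ≡.refl
  τ^-+ (suc i) j x = ≡.cong τ (τ^-+ i j x)

  τ^-* : ∀ {m x} → τ^ m x ≡ x → ∀ q → τ^ (q ℕ.* m) x ≡ x
  τ^-* e zero    = ≡.refl
  τ^-* {m} {x} e (suc q) = ≡.trans (τ^-+ m (q ℕ.* m) x) (≡.trans (≡.cong (τ^ m) (τ^-* e q)) e)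

  -- Every nontrivial subgroup of ℤ/2ᵏ⁺¹ contains 2ᵏ: an odd e is multiplied by 2ᵏ, an even one is
  -- halved. Freeness thus need only be tested on the rotation by 2ᵏ.
  multiple-of-half : ∀ k e → 0 ℕ.< e → e ℕ.< 2 ℕ.^ suc k → ∃₂ λ m q → m ℕ.* e ≡ 2 ℕ.^ k ℕ.+ q ℕ.* 2 ℕ.^ suc k
  multiple-of-half k e 0<e e<d with even⊎odd e
  ... | inj₂ (c , ≡.refl) = 2 ℕ.^ k , c , solve 2 (λ h c → h :* (con 1 :+ con 2 :* c) := h :+ c :* (con 2 :* h)) ≡.refl (2 ℕ.^ k) c
    where open ℕ-Solver
  multiple-of-half zero e 0<e e<d | inj₁ (divides zero ≡.refl) = contradiction 0<e λ ()
  multiple-of-half zero e 0<e e<d | inj₁ (divides (suc c) ≡.refl) = contradiction e<d (ℕₚ.≤⇒≯ (ℕₚ.m≤n*m 2 (suc c)))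
  multiple-of-half (suc k) e 0<e e<d | inj₁ (divides c ≡.refl)
    with m , q , f ← multiple-of-half k c (ℕₚ.*-cancelʳ-< 2 0 c 0<e) (ℕₚ.*-cancelˡ-< 2 c (2 ℕ.^ suc k) (≡.subst (ℕ._< 2 ℕ.^ suc (suc k)) (ℕₚ.*-comm c 2) e<d)) =
    m , q , (≡R.begin
      m ℕ.* (c ℕ.* 2)                                ≡R.≡⟨ solve 2 (λ m c → m :* (c :* con 2) := con 2 :* (m :* c)) ≡.refl m c ⟩
      2 ℕ.* (m ℕ.* c)                                ≡R.≡⟨ ≡.cong (2 ℕ.*_) f ⟩
      2 ℕ.* (2 ℕ.^ k ℕ.+ q ℕ.* 2 ℕ.^ suc k)          ≡R.≡⟨ solve 3 (λ h q d → con 2 :* (h :+ q :* d) := con 2 :* h :+ q :* (con 2 :* d)) ≡.refl (2 ℕ.^ k) q (2 ℕ.^ suc k) ⟩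
      2 ℕ.* 2 ℕ.^ k ℕ.+ q ℕ.* (2 ℕ.* 2 ℕ.^ suc k)    ≡R.∎)
    where
    module ≡R = ≡.≡-Reasoning
    open ℕ-Solver

  extract : ∀ {O L : List A} → Unique O → O ⊆ L → ∃ λ L′ → L ↭ O ++ L′
  extract {[]}    {L} u sub = L , ↭-refl
  extract {x ∷ O} {L} (x∉O ∷ u) sub with ys , zs , ≡.refl ← ∈-∃++ (sub (here ≡.refl)) =
    proj₁ rest , ↭-trans (shift x ys zs) (prep x (proj₂ rest))
    where
    ∈-tail : ∀ {y} → y ∈ O → y ∈ x ∷ (ys ++ zs) → y ∈ ys ++ zs
    ∈-tail y∈O (here ≡.refl) = ⊥-elim (All.lookup x∉O y∈O ≡.refl)
    ∈-tail y∈O (there y∈)    = y∈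
    rest : ∃ λ L′ → ys ++ zs ↭ O ++ L′
    rest = extract u (λ y∈O → ∈-tail y∈O (∈-resp-↭ (shift x ys zs) (sub (there y∈O))))

  Unique-++ʳ : ∀ (O : List A) {L} → Unique (O ++ L) → Unique L
  Unique-++ʳ []      u       = u
  Unique-++ʳ (x ∷ O) (_ ∷ u) = Unique-++ʳ O u

  Unique-disjoint : ∀ (O : List A) {L y} → Unique (O ++ L) → y ∈ O → y ∉ L
  Unique-disjoint (x ∷ O) (x∉ ∷ u) (here ≡.refl) y∈L = All.lookup x∉ (∈-++⁺ʳ O y∈L) ≡.refl
  Unique-disjoint (x ∷ O) (_ ∷ u)  (there y∈O)   y∈L = Unique-disjoint O u y∈O y∈L

  module _ (k : ℕ) (period : ∀ x → τ^ (2 ℕ.^ suc k) x ≡ x) where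

    private
      d = 2 ℕ.^ suc k
      instance
        d≢0 : NonZero d
        d≢0 = ℕₚ.m^n≢0 2 (suc k)

    τ^-% : ∀ i x → τ^ i x ≡ τ^ (i % d) x
    τ^-% i x = ≡.trans (≡.cong (λ j → τ^ j x) (m≡m%n+[m/n]*n i d))
      (≡.trans (τ^-+ (i % d) (i / d ℕ.* d) x) (≡.cong (τ^ (i % d)) (τ^-* (period x) (i / d))))

    τ^-pred : ∀ x → τ^ (ℕ.pred d) (τ x) ≡ x
    τ^-pred x = ≡.trans (≡.sym (τ^-+ (ℕ.pred d) 1 x))
      (≡.trans (≡.cong (λ j → τ^ j x) (≡.trans (ℕₚ.+-comm (ℕ.pred d) 1) (ℕₚ.suc-pred d))) (period x))

    orbit : A → List A
    orbit x = applyUpTo (λ i → τ^ i x) d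

    τ^∈orbit : ∀ i x → τ^ i x ∈ orbit x
    τ^∈orbit i x = ≡.subst (_∈ orbit x) (≡.sym (τ^-% i x)) (∈-applyUpTo⁺ (λ i → τ^ i x) (m%n<n i d))

    -- The inverse of τ is its power d - 1. This is what keeps the complement of an orbit closed
    -- under τ.
    orbit-back : ∀ {x y} → τ y ∈ orbit x → y ∈ orbit x
    orbit-back {x} {y} τy∈ with i , _ , e ← ∈-applyUpTo⁻ (λ i → τ^ i x) τy∈ =
      ≡.subst (_∈ orbit x)
        (≡.trans (τ^-+ (ℕ.pred d) i x) (≡.trans (≡.cong (τ^ (ℕ.pred d)) (≡.sym e)) (τ^-pred y)))
        (τ^∈orbit (ℕ.pred d ℕ.+ i) x)

    τ^-injective : ∀ i {x y} → τ^ i x ≡ τ^ i y → x ≡ y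
    τ^-injective zero    e = e
    τ^-injective (suc i) {x} {y} e = τ^-injective i
      (≡.trans (≡.sym (τ^-pred (τ^ i x))) (≡.trans (≡.cong (τ^ (ℕ.pred d)) e) (τ^-pred (τ^ i y))))

    -- If τⁱx = τʲx with i < j < d, then τʲ⁻ⁱ fixes x, and so does the multiple of j - i that is
    -- half the period.
    orbit-unique : ∀ {x} → τ^ (2 ℕ.^ k) x ≢ x → Unique (orbit x)
    orbit-unique {x} free = applyUpTo⁺₁ _ d λ {i} {j} i<j j<d e →
      let s = j ℕ.∸ i
          i+s = ℕₚ.m+[n∸m]≡n (ℕₚ.<⇒≤ i<j)
          fixed = τ^-injective i (≡.trans (≡.sym (τ^-+ i s x)) (≡.trans (≡.cong (λ t → τ^ t x) i+s) (≡.sym e)))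
          m , q , f = multiple-of-half k s (ℕₚ.m<n⇒0<n∸m i<j) (ℕₚ.≤-<-trans (ℕₚ.m∸n≤m j i) j<d)
      in free (≡.trans (≡.cong (τ^ (2 ℕ.^ k)) (≡.sym (τ^-* (period x) q)))
           (≡.trans (≡.sym (τ^-+ (2 ℕ.^ k) (q ℕ.* d) x))
             (≡.trans (≡.cong (λ t → τ^ t x) (≡.sym f)) (τ^-* fixed m))))

    -- Whole orbits are removed one at a time; `b` bounds the length and makes the recursion
    -- structural.
    count : ∀ b L → length L ℕ.≤ b → Unique L → (∀ {x} → x ∈ L → τ x ∈ L) →
      (∀ {x} → x ∈ L → τ^ (2 ℕ.^ k) x ≢ x) → ∃ λ q → length L ≡ q ℕ.* d
    count b       []      le u closed free = 0 , ≡.refl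
    count (suc b) L@(x ∷ _) le u closed free = suc (proj₁ rest) , ≡.trans total (≡.cong (d ℕ.+_) (proj₂ rest))
      where
      τ^-closed : ∀ i {y} → y ∈ L → τ^ i y ∈ L
      τ^-closed zero    y∈ = y∈
      τ^-closed (suc i) y∈ = closed (τ^-closed i y∈)
      orbit⊆ : orbit x ⊆ L
      orbit⊆ y∈ with i , _ , ≡.refl ← ∈-applyUpTo⁻ (λ i → τ^ i x) y∈ = τ^-closed i (here ≡.refl)
      extracted = extract (orbit-unique (free (here ≡.refl))) orbit⊆
      L′ = proj₁ extracted
      p : L ↭ orbit x ++ L′
      p = proj₂ extracted
      total : length L ≡ d ℕ.+ length L′
      total = ≡.trans (↭-length p) (≡.trans (length-++ (orbit x)) (≡.cong (ℕ._+ length L′) (length-applyUpTo _ d)))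
      u′ : Unique (orbit x ++ L′)
      u′ = Unique-resp-↭ (↭⇒↭ₛ p) u
        where open import Data.List.Relation.Binary.Permutation.Setoid.Properties (≡.setoid A) using (Unique-resp-↭)
      L′⊆L : L′ ⊆ L
      L′⊆L y∈ = ∈-resp-↭ (↭-sym p) (∈-++⁺ʳ (orbit x) y∈)
      closed′ : ∀ {y} → y ∈ L′ → τ y ∈ L′
      closed′ y∈ with ∈-++⁻ (orbit x) (∈-resp-↭ p (closed (L′⊆L y∈)))
      ... | inj₁ τy∈O = ⊥-elim (Unique-disjoint (orbit x) u′ (orbit-back τy∈O) y∈)
      ... | inj₂ τy∈  = τy∈
      le′ : length L′ ℕ.≤ b
      le′ = ℕ.s≤s⁻¹ (ℕₚ.≤-trans (ℕₚ.+-monoˡ-≤ (length L′) (ℕₚ.m^n>0 2 (suc k))) (ℕₚ.≤-trans (ℕₚ.≤-reflexive (≡.sym total)) le))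
      rest = count b L′ le′ (Unique-++ʳ (orbit x) u′) closed′ (λ y∈ → free (L′⊆L y∈))

-- Classes killed by an odd M as vectors of residues.

module OddPrimaryPart (U : UnitSystem) (q : ℕ) where
  open UnitSystem U
  open CommutativeRing ring hiding (ring)
  open Saturation U
  open import Algebra.Properties.CommutativeSemiring.Exp commutativeSemiring
    using (_^_; ^-congˡ; ^-distrib-*)
  open import Algebra.Properties.CommutativeSemigroup *-commutativeSemigroup using (interchange)
  open import Relation.Binary.Reasoning.Setoid setoid

  M : ℕ
  M = suc (2 ℕ.* q)

  -- The d coordinates modulo M are packed into one `Fin`, which has decidable equality and an
  -- enumeration and in which pointwise equal vectors are equal.
  Residues : Set
  Residues = Fin (M ℕ.^ d)

  residue : Residues → ℕ → Fin M
  residue c i = finToFun {M} {d} c (i mod d)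

  encode : (ℕ → Fin M) → Residues
  encode f = funToFin {d} {M} (λ i → f (toℕ i))

  toℕ-mod : ∀ i n .{{_ : NonZero n}} → toℕ (i mod n) ≡ i % n
  toℕ-mod i n = Finₚ.toℕ-fromℕ< (m%n<n i n)

  d-mod : ∀ i → (d ℕ.+ i) mod d ≡ i mod d
  d-mod i = Finₚ.toℕ-injective (≡.trans (toℕ-mod (d ℕ.+ i) d) (≡.trans
    (≡.trans (≡.cong (_% d) (≡.trans (ℕₚ.+-comm d i) (≡.cong (i ℕ.+_) (≡.sym (ℕₚ.*-identityˡ d))))) ([m+kn]%n≡m%n i 1 d))
    (≡.sym (toℕ-mod i d))))

  residue-periodic : ∀ c i → residue c (d ℕ.+ i) ≡ residue c i
  residue-periodic c i = ≡.cong (finToFun c) (d-mod i)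

  residue-encode : ∀ f → (∀ i → f (d ℕ.+ i) ≡ f i) → ∀ i → residue (encode f) i ≡ f i
  residue-encode f pf i = ≡.trans (Finₚ.finToFun-funToFin {d} {M} (λ i → f (toℕ i)) (i mod d))
    (≡.trans (≡.cong f (toℕ-mod i d)) (Finₚ.toℕ-injective
      (≡.sym (periodic-% {λ i → toℕ (f i)} (λ i → ≡.cong toℕ (pf i)) i))))

  funToFin-cong : ∀ {m n} {f g : Fin m → Fin n} → (∀ i → f i ≡ g i) → funToFin f ≡ funToFin g
  funToFin-cong {zero}  e = ≡.refl
  funToFin-cong {suc m} e = ≡.cong₂ Fin.combine (e Fin.zero) (funToFin-cong (e ∘ Fin.suc))

  residue-injective : ∀ {c c′} → (∀ i → residue c i ≡ residue c′ i) → c ≡ c′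
  residue-injective {c} {c′} e = ≡.trans (≡.sym (Finₚ.funToFin-finToFin {d} {M} c))
    (≡.trans (funToFin-cong {d} {M} pointwise) (Finₚ.funToFin-finToFin {d} {M} c′))
    where
    toℕ-mod-d : ∀ (j : Fin d) → toℕ j mod d ≡ j
    toℕ-mod-d j = Finₚ.toℕ-injective (≡.trans (toℕ-mod (toℕ j) d) (m<n⇒m%n≡m (Finₚ.toℕ<n j)))
    pointwise : ∀ j → finToFun c j ≡ finToFun c′ j
    pointwise j = ≡.subst (λ t → finToFun c t ≡ finToFun c′ t) (toℕ-mod-d j) (e (toℕ j))

  exponents : Residues → ℕ → ℕ
  exponents c i = toℕ (residue c i)

  exponents-periodic : ∀ c → Periodic (exponents c)
  exponents-periodic c i = ≡.cong toℕ (residue-periodic c i)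

  exponents-encode : ∀ {a} → Periodic a → ∀ i → exponents (encode (λ i → a i mod M)) i ≡ a i % M
  exponents-encode {a} pa i = ≡.trans
    (≡.cong toℕ (residue-encode (λ i → a i mod M) (λ i → ≡.cong (_mod M) (pa i)) i)) (toℕ-mod (a i) M)

  rotate : Residues → Residues
  rotate c = encode (λ i → residue c (suc i))

  open FreeOrbits rotate using (τ^; count; τ^-pred)

  residue-rotate : ∀ c i → residue (rotate c) i ≡ residue c (suc i)
  residue-rotate c = residue-encode (λ i → residue c (suc i))
    (λ i → ≡.trans (≡.cong (residue c) (≡.sym (ℕₚ.+-suc d i))) (residue-periodic c (suc i)))

  residue-rotate^ : ∀ j c i → residue (τ^ j c) i ≡ residue c (j ℕ.+ i)
  residue-rotate^ zero    c i = ≡.refl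
  residue-rotate^ (suc j) c i = ≡.trans (residue-rotate (τ^ j c) i)
    (≡.trans (residue-rotate^ j c (suc i)) (≡.cong (residue c) (ℕₚ.+-suc j i)))

  rotate-period : ∀ c → τ^ d c ≡ c
  rotate-period c = residue-injective (λ i → ≡.trans (residue-rotate^ d c i) (residue-periodic c i))

  𝟘 : Residues
  𝟘 = encode (λ _ → Fin.zero)

  residue-𝟘 : ∀ i → residue 𝟘 i ≡ Fin.zero
  residue-𝟘 = residue-encode (λ _ → Fin.zero) (λ _ → ≡.refl)

  -- For a relative unit u with uᴹ circular, the exponents of uᴹ are determined
  -- modulo M up to an additive constant, which the condition Antisymmetric fixes.
  Antisymmetric : Residues → Set
  Antisymmetric c = ∀ i → M ∣ exponents c i ℕ.+ exponents c (half ℕ.+ i)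

  Root : Residues → Set
  Root c = ∃ λ w → w ^ M ≈ P (exponents c)

  Torsion : Residues → Set
  Torsion c = Antisymmetric c × Root c

  antisymmetric? : ∀ c → Dec (Antisymmetric c)
  antisymmetric? c = map′
    (λ f i → ≡.subst (M ∣_) (≡.trans (≡.cong g (toℕ-mod i d)) (≡.sym (periodic-% pg i))) (f (i mod d)))
    (λ f i → f (toℕ i))
    (Finₚ.all? (λ i → M ∣? g (toℕ i)))
    where
    g : ℕ → ℕ
    g i = exponents c i ℕ.+ exponents c (half ℕ.+ i)
    pg : Periodic g
    pg = +-periodic (exponents-periodic c) (shift-periodic (exponents-periodic c) half)

  infix 4 _≈?_

  _≈?_ : ∀ x y → Dec (x ≈ y)
  x ≈? y = map′ φ-injective φ-cong (Vecₚ.≡-dec ℤ._≟_ (φ x) (φ y))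

  -- An M-th root w satisfies N(w) ≤ N(wᴹ), so searching a box whose size is read off from the
  -- product is exhaustive.
  root? : ∀ c → Dec (Root c)
  root? c = map′ to from (Any.any? (λ y → ψ y ^ M ≈? P e) (box (N (P e)) rank))
    where
    e = exponents c
    to : Any.Any (λ y → ψ y ^ M ≈ P e) (box (N (P e)) rank) → Root c
    to any = ψ (proj₁ (find any)) , proj₂ (proj₂ (find any))
    from : Root c → Any.Any (λ y → ψ y ^ M ≈ P e) (box (N (P e)) rank)
    from (w , f) = lose
      (∈-box (N (P e)) (φ w) (ℕₚ.≤-trans (N≤N^ (root-unit M (Unit-resp (sym f) (P-unit e))) (2 ℕ.* q)) (ℕₚ.≤-reflexive (N-cong f))))
      (trans (^-congˡ M (ψ∘φ w)) f)

  nonzeroTorsion? : ∀ c → Dec (Torsion c × c ≢ 𝟘)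
  nonzeroTorsion? c = (antisymmetric? c ×-dec root? c) ×-dec ¬? (c Finₚ.≟ 𝟘)

  nonzero : List Residues
  nonzero = filter nonzeroTorsion? (allFin (M ℕ.^ d))

  torsion-rotate : ∀ {c} → Torsion c → Torsion (rotate c)
  torsion-rotate {c} (anti , w , f) =
    (λ i → ≡.subst (M ∣_) (≡.sym (≡.cong₂ ℕ._+_ (exp-rotate i) (≡.trans (exp-rotate (half ℕ.+ i)) (≡.cong (exponents c) (≡.sym (ℕₚ.+-suc half i)))))) (anti (suc i))) ,
    σ^ d-1 w , (begin
      σ^ d-1 w ^ M                                    ≈⟨ σ^-^ d-1 w M ⟨
      σ^ d-1 (w ^ M)                                  ≈⟨ σ^-cong d-1 (trans f (sym (σP (exponents-periodic c)))) ⟩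
      σ^ d-1 (σ (P (λ i → exponents c (suc i))))      ≈⟨ σ^d-1∘σ _ ⟩
      P (λ i → exponents c (suc i))                   ≈⟨ P-cong (λ i → ≡.sym (exp-rotate i)) ⟩
      P (exponents (rotate c))                        ∎)
    where
    exp-rotate : ∀ i → exponents (rotate c) i ≡ exponents c (suc i)
    exp-rotate i = ≡.cong toℕ (residue-rotate c i)

  ∣2*⇒∣ : ∀ x → M ∣ x ℕ.+ x → M ∣ x
  -- Here M x = q (x + x) + x.
  ∣2*⇒∣ x M∣2x = ∣m+n∣m⇒∣n {m = q ℕ.* (x ℕ.+ x)}
    (≡.subst (M ∣_) (solve 2 (λ q x → (con 1 :+ con 2 :* q) :* x := q :* (x :+ x) :+ x) ≡.refl q x) (m∣m*n x))
    (∣n⇒∣m*n q M∣2x)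
    where open ℕ-Solver

  rotate-half-free : ∀ {c} → Torsion c → c ≢ 𝟘 → τ^ half c ≢ c
  rotate-half-free {c} (anti , _) c≢𝟘 fixed = c≢𝟘 (residue-injective λ i → Finₚ.toℕ-injective (≡.trans
    (≡.trans (≡.sym (m<n⇒m%n≡m (Finₚ.toℕ<n (residue c i)))) (n∣m⇒m%n≡0 (exponents c i) M (∣2*⇒∣ _
      (≡.subst (λ t → M ∣ exponents c i ℕ.+ toℕ t) (≡.trans (≡.sym (residue-rotate^ half c i)) (≡.cong (λ b → residue b i) fixed)) (anti i)))))
    (≡.sym (≡.cong toℕ (residue-𝟘 i)))))

  rotate-𝟘 : rotate 𝟘 ≡ 𝟘
  rotate-𝟘 = residue-injective (λ i → ≡.trans (residue-rotate 𝟘 i) (≡.trans (residue-𝟘 (suc i)) (≡.sym (residue-𝟘 i))))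

  nonzero-unique : Unique nonzero
  nonzero-unique = filter⁺ nonzeroTorsion? (allFin⁺ (M ℕ.^ d))

  ∈-nonzero : ∀ {c} → c ∈ nonzero → Torsion c × c ≢ 𝟘
  ∈-nonzero c∈ = proj₂ (∈-filter⁻ nonzeroTorsion? {xs = allFin (M ℕ.^ d)} c∈)

  nonzero-count : ∃ λ r → length nonzero ≡ r ℕ.* d
  nonzero-count = count log-d rotate-period (length nonzero) nonzero ℕₚ.≤-refl nonzero-unique closed
    (λ c∈ → rotate-half-free (proj₁ (∈-nonzero c∈)) (proj₂ (∈-nonzero c∈)))
    where
    closed : ∀ {c} → c ∈ nonzero → rotate c ∈ nonzero
    closed {c} c∈ = ∈-filter⁺ nonzeroTorsion? (∈-allFin (rotate c)) (torsion-rotate (proj₁ (∈-nonzero c∈)) ,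
      -- A rotation to 𝟘 comes only from 𝟘, because rotating d - 1 further undoes it.
      λ e → proj₂ (∈-nonzero c∈) (≡.trans (≡.sym (τ^-pred log-d rotate-period c))
        (≡.trans (≡.cong (τ^ d-1) (≡.trans e (≡.sym rotate-𝟘))) (τ^-pred log-d rotate-period 𝟘))))

  elements : List Residues
  elements = 𝟘 ∷ nonzero

  torsion-𝟘 : Torsion 𝟘
  torsion-𝟘 = (λ i → ≡.subst (M ∣_) (≡.sym (≡.cong₂ ℕ._+_ (exp-𝟘 i) (exp-𝟘 (half ℕ.+ i)))) (divides 0 ≡.refl)) ,
    1# , trans (1^ M) (sym (trans (P-cong exp-𝟘) (∏-0 d)))
    where
    exp-𝟘 : ∀ i → exponents 𝟘 i ≡ 0
    exp-𝟘 i = ≡.cong toℕ (residue-𝟘 i)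

  ∈-elements⁻ : ∀ {c} → c ∈ elements → Torsion c
  ∈-elements⁻ (here ≡.refl) = torsion-𝟘
  ∈-elements⁻ (there c∈)    = proj₁ (∈-nonzero c∈)

  ∈-elements⁺ : ∀ {c} → Torsion c → c ∈ elements
  ∈-elements⁺ {c} t with c Finₚ.≟ 𝟘
  ... | yes e  = here e
  ... | no c≢𝟘 = there (∈-filter⁺ nonzeroTorsion? (∈-allFin c) (t , c≢𝟘))

  -- The number x - M·`excess x` is the residue of least absolute value. For opposite residues these
  -- cancel exactly, so the quotient of x + y by M splits into a part depending on x and the same
  -- function of y.
  excess : ℕ → ℕ
  excess x with q ℕ.<? x
  ... | yes _ = 1
  ... | no  _ = 0

  excess-sum : ∀ x y → x ℕ.< M → y ℕ.< M → M ∣ x ℕ.+ y → x ℕ.+ y ≡ M ℕ.* (excess x ℕ.+ excess y)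
  excess-sum x y x<M y<M (divides zero e) with q ℕ.<? x | q ℕ.<? y
  ... | yes q<x | _       = contradiction (ℕₚ.m+n≡0⇒m≡0 x e) (ℕₚ.m<n⇒n≢0 q<x)
  ... | no _    | yes q<y = contradiction (ℕₚ.m+n≡0⇒n≡0 x e) (ℕₚ.m<n⇒n≢0 q<y)
  ... | no _    | no _    = ≡.trans e (≡.sym (ℕₚ.*-zeroʳ M))
  excess-sum x y x<M y<M (divides (suc zero) e) with q ℕ.<? x | q ℕ.<? y
  ... | yes q<x | yes q<y = contradiction (≡.trans e (ℕₚ.+-identityʳ M)) (ℕₚ.>⇒≢ (≡.subst (ℕ._< x ℕ.+ y) ≡.refl
        (ℕₚ.≤-trans (ℕₚ.≤-reflexive (solve 1 (λ q → con 2 :+ con 2 :* q := (con 1 :+ q) :+ (con 1 :+ q)) ≡.refl q)) (ℕₚ.+-mono-≤ q<x q<y))))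
    where open ℕ-Solver
  ... | yes _   | no _    = ≡.trans e (ℕₚ.*-comm 1 M)
  ... | no _    | yes _   = ≡.trans e (ℕₚ.*-comm 1 M)
  ... | no q≮x  | no q≮y  = contradiction (≡.trans e (ℕₚ.+-identityʳ M)) (ℕₚ.<⇒≢ (ℕ.s≤s
        (ℕₚ.≤-trans (ℕₚ.+-mono-≤ (ℕₚ.≮⇒≥ q≮x) (ℕₚ.≮⇒≥ q≮y)) (ℕₚ.≤-reflexive (≡.cong (q ℕ.+_) (≡.sym (ℕₚ.+-identityʳ q)))))))
  excess-sum x y x<M y<M (divides (suc (suc r)) e) = contradiction (ℕₚ.+-mono-< x<M y<M)
    (ℕₚ.≤⇒≯ (ℕₚ.≤-trans (ℕₚ.≤-trans (ℕₚ.m≤m+n (M ℕ.+ M) (r ℕ.* M)) (ℕₚ.≤-reflexive (ℕₚ.+-assoc M M (r ℕ.* M)))) (ℕₚ.≤-reflexive (≡.sym e))))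

  -- The relative norm of w is ∏ ηᵢ^(fᵢ + f_{half+i}), so dividing w by ∏ ηᵢ^fᵢ
  -- makes it 1.
  relative-representative : ∀ {c} → Torsion c → ∃ λ v → Relative v × ∃ λ w → w ^ M ≈ P (exponents c) × v ∼ w
  relative-representative {c} (anti , w , wM) = v , relative , w , wM , (f′ , pf′ , refl)
    where
    e = exponents c
    pe = exponents-periodic c
    f = λ i → excess (e i)
    pf : Periodic f
    pf i = ≡.cong excess (pe i)
    inv = inverse-exponents pf
    f′ = proj₁ inv
    pf′ = proj₁ (proj₂ inv)
    ff′ : P f * P f′ ≈ 1#
    ff′ = proj₁ (proj₂ (proj₂ inv))
    v = w * P f′
    g = λ i → f i ℕ.+ f (half ℕ.+ i)
    norm-w : w * σ^ half w ≈ P g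
    -- The antisymmetry controls only the M-th power of the relative norm; uniqueness of odd roots
    -- passes to the norm itself.
    norm-w = odd-root-unique q (P-unit g) (begin
      (w * σ^ half w) ^ M                       ≈⟨ ^-distrib-* w (σ^ half w) M ⟩
      w ^ M * σ^ half w ^ M                     ≈⟨ *-cong wM (trans (sym (σ^-^ half w M)) (trans (σ^-cong half wM) (σ^half-P pe))) ⟩
      P e * P (λ i → e (half ℕ.+ i))            ≈⟨ ∏-+ d e (λ i → e (half ℕ.+ i)) ⟨
      P (λ i → e i ℕ.+ e (half ℕ.+ i))          ≈⟨ P-cong (λ i → excess-sum (e i) (e (half ℕ.+ i)) (Finₚ.toℕ<n (residue c i)) (Finₚ.toℕ<n (residue c (half ℕ.+ i))) (anti i)) ⟩
      P (λ i → M ℕ.* g i)                       ≈⟨ ∏-* d M g ⟩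
      P g ^ M                                   ∎)
    relative : Relative v
    relative = begin
      (w * P f′) * σ^ half (w * P f′)                  ≈⟨ *-congˡ (σ^-* half w (P f′)) ⟩
      (w * P f′) * (σ^ half w * σ^ half (P f′))        ≈⟨ interchange _ _ _ _ ⟩
      (w * σ^ half w) * (P f′ * σ^ half (P f′))        ≈⟨ *-congʳ (trans norm-w (trans (∏-+ d f (λ i → f (half ℕ.+ i))) (*-congˡ (sym (σ^half-P pf))))) ⟩
      (P f * σ^ half (P f)) * (P f′ * σ^ half (P f′))  ≈⟨ interchange _ _ _ _ ⟩
      (P f * P f′) * (σ^ half (P f) * σ^ half (P f′))  ≈⟨ *-cong ff′ (trans (sym (σ^-* half (P f) (P f′))) (trans (σ^-cong half ff′) (σ^-1 half))) ⟩
      1# * 1#                                          ≈⟨ *-identityˡ 1# ⟩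
      1#                                               ∎

  -- The multiplier q + 1 is the inverse of 2 modulo M = 2q + 1.
  congruent⇒≡ : ∀ x y s t → x ℕ.< M → y ℕ.< M → (x ℕ.+ x) ℕ.+ s ℕ.* M ≡ (y ℕ.+ y) ℕ.+ t ℕ.* M → x ≡ y
  congruent⇒≡ x y s t x<M y<M e = ≡R.begin
    x                                        ≡R.≡⟨ m<n⇒m%n≡m x<M ⟨
    x % M                                    ≡R.≡⟨ [m+kn]%n≡m%n x (x ℕ.+ suc q ℕ.* s) M ⟨
    (x ℕ.+ (x ℕ.+ suc q ℕ.* s) ℕ.* M) % M    ≡R.≡⟨ ≡.cong (_% M) (scale x s) ⟨
    (suc q ℕ.* ((x ℕ.+ x) ℕ.+ s ℕ.* M)) % M  ≡R.≡⟨ ≡.cong (λ z → (suc q ℕ.* z) % M) e ⟩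
    (suc q ℕ.* ((y ℕ.+ y) ℕ.+ t ℕ.* M)) % M  ≡R.≡⟨ ≡.cong (_% M) (scale y t) ⟩
    (y ℕ.+ (y ℕ.+ suc q ℕ.* t) ℕ.* M) % M    ≡R.≡⟨ [m+kn]%n≡m%n y (y ℕ.+ suc q ℕ.* t) M ⟩
    y % M                                    ≡R.≡⟨ m<n⇒m%n≡m y<M ⟩
    y                                        ≡R.∎
    where
    module ≡R = ≡.≡-Reasoning
    scale : ∀ x s → suc q ℕ.* ((x ℕ.+ x) ℕ.+ s ℕ.* M) ≡ x ℕ.+ (x ℕ.+ suc q ℕ.* s) ℕ.* M
    scale x s = solve 3 (λ q x s → (con 1 :+ q) :* ((x :+ x) :+ s :* (con 1 :+ con 2 :* q)) :=
      x :+ (x :+ (con 1 :+ q) :* s) :* (con 1 :+ con 2 :* q)) ≡.refl q x s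
      where open ℕ-Solver

  roots-∼⇒≡ : ∀ {c c′ w w′} → Antisymmetric c → Antisymmetric c′ →
    w ^ M ≈ P (exponents c) → w′ ^ M ≈ P (exponents c′) → w ∼ w′ → c ≡ c′
  roots-∼⇒≡ {c} {c′} {w} {w′} anti anti′ f f′ (b , pb , e) = residue-injective λ i →
    Finₚ.toℕ-injective (go i (anti i) (anti′ i))
    where
    x = exponents c
    y = exponents c′
    same : P x ≈ P (λ i → y i ℕ.+ M ℕ.* b i)
    same = begin
      P x                                     ≈⟨ f ⟨
      w ^ M                                   ≈⟨ ^-congˡ M e ⟩
      (w′ * P b) ^ M                          ≈⟨ ^-distrib-* w′ (P b) M ⟩
      w′ ^ M * P b ^ M                        ≈⟨ *-cong f′ (sym (∏-* d M b)) ⟩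
      P y * P (λ i → M ℕ.* b i)               ≈⟨ ∏-+ d y (λ i → M ℕ.* b i) ⟨
      P (λ i → y i ℕ.+ M ℕ.* b i)             ∎
    -- By `independence`, x - y - M b is constant. Comparing i with i + half, where x and y both
    -- change sign modulo M, gives 2xᵢ ≡ 2yᵢ.
    go : ∀ i → M ∣ x i ℕ.+ x (half ℕ.+ i) → M ∣ y i ℕ.+ y (half ℕ.+ i) → x i ≡ y i
    go i (divides s g) (divides t g′) =
      congruent⇒≡ (x i) (y i) (t ℕ.+ b (half ℕ.+ i)) (s ℕ.+ b i) (Finₚ.toℕ<n (residue c i)) (Finₚ.toℕ<n (residue c′ i)) (≡R.begin
        (x i ℕ.+ x i) ℕ.+ (t ℕ.+ b j) ℕ.* M                    ≡R.≡⟨ solve 4 (λ x t b M → (x :+ x) :+ (t :+ b) :* M := (x :+ M :* b) :+ (x :+ t :* M)) ≡.refl (x i) t (b j) M ⟩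
        (x i ℕ.+ M ℕ.* b j) ℕ.+ (x i ℕ.+ t ℕ.* M)              ≡R.≡⟨ ≡.cong (λ z → (x i ℕ.+ M ℕ.* b j) ℕ.+ (x i ℕ.+ z)) (≡.sym g′) ⟩
        (x i ℕ.+ M ℕ.* b j) ℕ.+ (x i ℕ.+ (y i ℕ.+ y j))        ≡R.≡⟨ solve 4 (λ x b y y′ → (x :+ b) :+ (x :+ (y :+ y′)) := (x :+ (y′ :+ b)) :+ (x :+ y)) ≡.refl (x i) (M ℕ.* b j) (y i) (y j) ⟩
        (x i ℕ.+ (y j ℕ.+ M ℕ.* b j)) ℕ.+ (x i ℕ.+ y i)        ≡R.≡⟨ ≡.cong (ℕ._+ (x i ℕ.+ y i)) (independence (exponents-periodic c)
                                                                     (+-periodic (exponents-periodic c′) (*-periodic M pb)) same i j) ⟩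
        (x j ℕ.+ (y i ℕ.+ M ℕ.* b i)) ℕ.+ (x i ℕ.+ y i)        ≡R.≡⟨ solve 4 (λ x x′ y b → (x′ :+ (y :+ b)) :+ (x :+ y) := (y :+ b) :+ (y :+ (x :+ x′))) ≡.refl (x i) (x j) (y i) (M ℕ.* b i) ⟩
        (y i ℕ.+ M ℕ.* b i) ℕ.+ (y i ℕ.+ (x i ℕ.+ x j))        ≡R.≡⟨ ≡.cong (λ z → (y i ℕ.+ M ℕ.* b i) ℕ.+ (y i ℕ.+ z)) g ⟩
        (y i ℕ.+ M ℕ.* b i) ℕ.+ (y i ℕ.+ s ℕ.* M)              ≡R.≡⟨ solve 4 (λ y s b M → (y :+ M :* b) :+ (y :+ s :* M) := (y :+ y) :+ (s :+ b) :* M) ≡.refl (y i) s (b i) M ⟩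
        (y i ℕ.+ y i) ℕ.+ (s ℕ.+ b i) ℕ.* M                    ≡R.∎)
      where
      module ≡R = ≡.≡-Reasoning
      open ℕ-Solver
      j = half ℕ.+ i

  -- The product is 1 or -1 and M is odd. Hence a constant may be added to the exponents of an M-th
  -- power, at the price of a sign in the root.
  P-const^M : ∀ m → P (λ _ → m) ^ M ≈ P (λ _ → m)
  P-const^M m = begin
    P (λ _ → m) ^ M                        ≈⟨ ^-congˡ M (P-const m) ⟩
    (- 1#) ^ m * ((- 1#) ^ m) ^ (2 ℕ.* q)  ≈⟨ *-congˡ (trans (^-^-comm (- 1#) m (2 ℕ.* q)) (trans (^-congˡ m ([-1]^even q)) (1^ m))) ⟩
    (- 1#) ^ m * 1#                        ≈⟨ *-identityʳ _ ⟩
    (- 1#) ^ m                             ≈⟨ P-const m ⟨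
    P (λ _ → m)                            ∎

  torsion-class : ∀ u → Relative u → Circular (u ^ M) → ∃ λ c → Antisymmetric c × ∃ λ v → v ^ M ≈ P (exponents c) × u ∼ v
  torsion-class u rel (a , pa , e) = c , anti , v , trans vM (P-cong (λ i → ≡.sym (exponents-encode pa′ i))) ,
    ∼-trans (∼-sym ((λ _ → κ) , (λ _ → ≡.refl) , refl)) u₁∼v
    where
    -- The M-th power also has relative norm 1, and a product equal to 1 has constant exponents.
    constant : ∀ i → a i ℕ.+ a (half ℕ.+ i) ≡ a 0 ℕ.+ a (half ℕ.+ 0)
    constant i = constant-exponents (+-periodic pa (shift-periodic pa half)) (begin
      P (λ i → a i ℕ.+ a (half ℕ.+ i))       ≈⟨ ∏-+ d a (λ i → a (half ℕ.+ i)) ⟩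
      P a * P (λ i → a (half ℕ.+ i))         ≈⟨ *-cong (sym e) (trans (sym (σ^half-P pa)) (σ^-cong half (sym e))) ⟩
      u ^ M * σ^ half (u ^ M)                ≈⟨ *-congˡ (σ^-^ half u M) ⟩
      u ^ M * σ^ half u ^ M                  ≈⟨ ^-distrib-* u (σ^ half u) M ⟨
      (u * σ^ half u) ^ M                    ≈⟨ ^-congˡ M rel ⟩
      1# ^ M                                 ≈⟨ 1^ M ⟩
      1#                                     ∎) i 0
    K = a 0 ℕ.+ a (half ℕ.+ 0)
    -- Adding κ = K q to all exponents turns the constant K into K + 2κ = K M.
    κ = K ℕ.* q
    a′ = λ i → a i ℕ.+ κ
    pa′ : Periodic a′
    pa′ i = ≡.cong (ℕ._+ κ) (pa i)
    u₁ = u * P (λ _ → κ)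
    reduced = reduce-exponents M u₁ a′ pa′ (begin
      (u * P (λ _ → κ)) ^ M          ≈⟨ ^-distrib-* u _ M ⟩
      u ^ M * P (λ _ → κ) ^ M        ≈⟨ *-cong e (P-const^M κ) ⟩
      P a * P (λ _ → κ)              ≈⟨ ∏-+ d a (λ _ → κ) ⟨
      P a′                           ∎)
    v = proj₁ reduced
    u₁∼v = proj₁ (proj₂ reduced)
    vM = proj₂ (proj₂ reduced)
    c = encode (λ i → a′ i mod M)
    anti : Antisymmetric c
    anti i = ≡.subst (M ∣_) (≡.sym (≡.cong₂ ℕ._+_ (exponents-encode pa′ i) (exponents-encode pa′ (half ℕ.+ i))))
      (m%n≡0⇒n∣m _ M (≡.trans (≡.sym (%-distribˡ-+ (a′ i) (a′ (half ℕ.+ i)) M)) (n∣m⇒m%n≡0 _ M (divides K (≡R.begin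
        (a i ℕ.+ κ) ℕ.+ (a (half ℕ.+ i) ℕ.+ κ)   ≡R.≡⟨ solve 3 (λ x y k → (x :+ k) :+ (y :+ k) := (x :+ y) :+ con 2 :* k) ≡.refl (a i) (a (half ℕ.+ i)) κ ⟩
        (a i ℕ.+ a (half ℕ.+ i)) ℕ.+ 2 ℕ.* κ     ≡R.≡⟨ ≡.cong (ℕ._+ 2 ℕ.* κ) (constant i) ⟩
        K ℕ.+ 2 ℕ.* (K ℕ.* q)                    ≡R.≡⟨ solve 2 (λ K q → K :+ con 2 :* (K :* q) := K :* (con 1 :+ con 2 :* q)) ≡.refl K q ⟩
        K ℕ.* M                                  ≡R.∎)))))
      where
      module ≡R = ≡.≡-Reasoning
      open ℕ-Solver

  -- The condition refers to the single exponent M; by `exponent-bound` it captures the l-primary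
  -- part once M is l to the power `F`.
  Enumerated : ℕ → Set
  Enumerated m = Σ (Vec Carrier m) λ reps →
    (∀ i → Relative (Vec.lookup reps i) × Circular (Vec.lookup reps i ^ M)) ×
    (∀ i j → Vec.lookup reps i ∼ Vec.lookup reps j → i ≡ j) ×
    (∀ u → Relative u → Circular (u ^ M) → ∃ λ i → u ∼ Vec.lookup reps i)

  lookup-injective : ∀ {A : Set} {L : List A} → Unique L → ∀ i j → List.lookup L i ≡ List.lookup L j → i ≡ j
  lookup-injective (_ ∷ _)  Fin.zero    Fin.zero    e = ≡.refl
  lookup-injective (n ∷ _)  Fin.zero    (Fin.suc j) e = ⊥-elim (All.lookup n (∈-lookup j) e)
  lookup-injective (n ∷ _)  (Fin.suc i) Fin.zero    e = ⊥-elim (All.lookup n (∈-lookup i) (≡.sym e))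
  lookup-injective (_ ∷ u)  (Fin.suc i) (Fin.suc j) e = ≡.cong Fin.suc (lookup-injective u i j e)

  enumerate : ∀ L → Unique L → (∀ {c} → c ∈ L → Torsion c) → (∀ {c} → Torsion c → c ∈ L) → Enumerated (length L)
  enumerate L unique ∈⁻ ∈⁺ = Vec.tabulate rep ,
    (λ i → ≡.subst (λ v → Relative v × Circular (v ^ M)) (≡.sym (Vecₚ.lookup∘tabulate rep i)) (rep-relative i , rep-circular i)) ,
    (λ i j s → rep-injective i j (≡.subst₂ _∼_ (Vecₚ.lookup∘tabulate rep i) (Vecₚ.lookup∘tabulate rep j) s)) ,
    (λ u rel circ → let i , s = rep-surjective u rel circ in i , ≡.subst (u ∼_) (≡.sym (Vecₚ.lookup∘tabulate rep i)) s)
    where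
    element : Fin (length L) → Residues
    element = List.lookup L
    torsion : ∀ i → Torsion (element i)
    torsion i = ∈⁻ (∈-lookup {xs = L} i)
    representative : ∀ i → ∃ λ v → Relative v × ∃ λ w → w ^ M ≈ P (exponents (element i)) × v ∼ w
    representative i = relative-representative (torsion i)
    rep : Fin (length L) → Carrier
    rep i = proj₁ (representative i)
    rep-relative : ∀ i → Relative (rep i)
    rep-relative i = proj₁ (proj₂ (representative i))
    root : Fin (length L) → Carrier
    root i = proj₁ (proj₂ (proj₂ (representative i)))
    root^M : ∀ i → root i ^ M ≈ P (exponents (element i))
    root^M i = proj₁ (proj₂ (proj₂ (proj₂ (representative i))))
    rep∼root : ∀ i → rep i ∼ root i
    rep∼root i = proj₂ (proj₂ (proj₂ (proj₂ (representative i))))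
    rep-circular : ∀ i → Circular (rep i ^ M)
    rep-circular i = ∼-circular (∼-^ M (rep∼root i)) (exponents (element i) , exponents-periodic (element i) , root^M i)
    rep-injective : ∀ i j → rep i ∼ rep j → i ≡ j
    rep-injective i j s = lookup-injective unique i j
      (roots-∼⇒≡ (proj₁ (torsion i)) (proj₁ (torsion j)) (root^M i) (root^M j)
        (∼-trans (∼-sym (rep∼root i)) (∼-trans s (rep∼root j))))
    rep-surjective : ∀ u → Relative u → Circular (u ^ M) → ∃ λ i → u ∼ rep i
    rep-surjective u rel circ = i , ∼-trans u∼v (∼-trans (≈⇒∼ v≈root) (∼-sym (rep∼root i)))
      where
      class = torsion-class u rel circ
      c : Residues
      c = proj₁ class
      v : Carrier
      v = proj₁ (proj₂ (proj₂ class))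
      vM : v ^ M ≈ P (exponents c)
      vM = proj₁ (proj₂ (proj₂ (proj₂ class)))
      u∼v : u ∼ v
      u∼v = proj₂ (proj₂ (proj₂ (proj₂ class)))
      c∈ : c ∈ L
      c∈ = ∈⁺ (proj₁ (proj₂ class) , v , vM)
      i : Fin (length L)
      i = Any.index c∈
      v≈root : v ≈ root i
      -- Both are M-th roots of the product attached to the same vector, so they coincide.
      v≈root = odd-root-unique q (root-unit M (Unit-resp (sym (root^M i)) (P-unit (exponents (element i)))))
        (trans vM (trans (reflexive (≡.cong (λ b → P (exponents b)) (lookup-index c∈))) (sym (root^M i))))

  order : ∃ λ m → Enumerated m × ∃ λ r → m ≡ 1 ℕ.+ r ℕ.* d
  order = length elements ,
    enumerate elements (All.tabulate (λ c∈ e → proj₂ (∈-nonzero c∈) (≡.sym e)) ∷ nonzero-unique) ∈-elements⁻ ∈-elements⁺ ,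
    proj₁ nonzero-count , ≡.cong suc (proj₂ nonzero-count)

open import Defs

-- The ring of integer polynomials.

module PolynomialRing where
  open ≡ using (refl; sym; trans; cong; cong₂)

  coeff : Poly → ℕ → ℤ
  coeff []      i       = + 0
  coeff (a ∷ p) zero    = a
  coeff (a ∷ p) (suc i) = coeff p i

  infix 4 _≋_

  -- Coefficientwise equality ignores trailing zeros of the lists. A record lets both polynomials be
  -- inferred from a proof.
  record _≋_ (p q : Poly) : Set where
    constructor mk
    field at : ∀ i → coeff p i ≡ coeff q i
  open _≋_ public

  coeff-+ : ∀ p q i → coeff (p +ₚ q) i ≡ coeff p i ℤ.+ coeff q i
  coeff-+ []      q       i       = sym (ℤₚ.+-identityˡ (coeff q i))
  coeff-+ (a ∷ p) []      i       = sym (ℤₚ.+-identityʳ (coeff (a ∷ p) i))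
  coeff-+ (a ∷ p) (b ∷ q) zero    = refl
  coeff-+ (a ∷ p) (b ∷ q) (suc i) = coeff-+ p q i

  coeff-scale : ∀ c p i → coeff (scale c p) i ≡ c ℤ.* coeff p i
  coeff-scale c []      i       = sym (ℤₚ.*-zeroʳ c)
  coeff-scale c (a ∷ p) zero    = refl
  coeff-scale c (a ∷ p) (suc i) = coeff-scale c p i

  coeff-neg : ∀ p i → coeff (negₚ p) i ≡ ℤ.- coeff p i
  coeff-neg p i = trans (coeff-scale (ℤ.- (+ 1)) p i) (ℤₚ.-1*i≡-i (coeff p i))

  coeff-*-zero : ∀ a p q → coeff ((a ∷ p) *ₚ q) zero ≡ a ℤ.* coeff q zero
  coeff-*-zero a p q = trans (coeff-+ (scale a q) _ zero)
    (trans (ℤₚ.+-identityʳ _) (coeff-scale a q zero))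

  coeff-*-suc : ∀ a p q i →
    coeff ((a ∷ p) *ₚ q) (suc i) ≡ a ℤ.* coeff q (suc i) ℤ.+ coeff (p *ₚ q) i
  coeff-*-suc a p q i = trans (coeff-+ (scale a q) _ (suc i))
    (cong (ℤ._+ coeff (p *ₚ q) i) (coeff-scale a q (suc i)))

  ≋-refl : ∀ {p} → p ≋ p
  ≋-refl .at i = refl

  ≋-sym : ∀ {p q} → p ≋ q → q ≋ p
  ≋-sym e .at i = sym (at e i)

  ≋-trans : ∀ {p q r} → p ≋ q → q ≋ r → p ≋ r
  ≋-trans e f .at i = trans (at e i) (at f i)

  +-cong≋ : ∀ {p p′ q q′} → p ≋ p′ → q ≋ q′ → p +ₚ q ≋ p′ +ₚ q′
  +-cong≋ {p} {p′} {q} {q′} e f .at i = trans (coeff-+ p q i)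
    (trans (cong₂ ℤ._+_ (at e i) (at f i)) (sym (coeff-+ p′ q′ i)))

  neg-cong≋ : ∀ {p p′} → p ≋ p′ → negₚ p ≋ negₚ p′
  neg-cong≋ {p} {p′} e .at i =
    trans (coeff-neg p i) (trans (cong ℤ.-_ (at e i)) (sym (coeff-neg p′ i)))

  ∷-cong≋ : ∀ {a b p q} → a ≡ b → p ≋ q → a ∷ p ≋ b ∷ q
  ∷-cong≋ e f .at zero    = e
  ∷-cong≋ e f .at (suc i) = at f i

  tail≋ : ∀ {a b p q} → a ∷ p ≋ b ∷ q → p ≋ q
  tail≋ e .at i = at e (suc i)

  scale-cong≋ : ∀ c {p q} → p ≋ q → scale c p ≋ scale c q
  scale-cong≋ c {p} {q} e .at i =
    trans (coeff-scale c p i) (trans (cong (c ℤ.*_) (at e i)) (sym (coeff-scale c q i)))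

  +-assoc≋ : ∀ p q r → (p +ₚ q) +ₚ r ≋ p +ₚ (q +ₚ r)
  +-assoc≋ p q r .at i rewrite coeff-+ (p +ₚ q) r i | coeff-+ p q i | coeff-+ p (q +ₚ r) i | coeff-+ q r i =
    ℤₚ.+-assoc (coeff p i) (coeff q i) (coeff r i)

  +-comm≋ : ∀ p q → p +ₚ q ≋ q +ₚ p
  +-comm≋ p q .at i rewrite coeff-+ p q i | coeff-+ q p i = ℤₚ.+-comm (coeff p i) (coeff q i)

  +-identityʳ≋ : ∀ p → p +ₚ [] ≋ p
  +-identityʳ≋ p .at i = trans (coeff-+ p [] i) (ℤₚ.+-identityʳ (coeff p i))

  neg-inverseʳ≋ : ∀ p → p +ₚ negₚ p ≋ []
  neg-inverseʳ≋ p .at i rewrite coeff-+ p (negₚ p) i | coeff-neg p i = ℤₚ.+-inverseʳ (coeff p i)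

  *-zeroʳ≋ : ∀ p → p *ₚ [] ≋ []
  *-zeroʳ≋ []      = ≋-refl
  *-zeroʳ≋ (a ∷ p) .at zero    = refl
  *-zeroʳ≋ (a ∷ p) .at (suc i) = at (*-zeroʳ≋ p) i

  *-congʳ≋ : ∀ p {q q′} → q ≋ q′ → p *ₚ q ≋ p *ₚ q′
  *-congʳ≋ []      e = ≋-refl
  *-congʳ≋ (a ∷ p) e = +-cong≋ (scale-cong≋ a e) (∷-cong≋ refl (*-congʳ≋ p e))

  *-∷ʳ : ∀ p b q → p *ₚ (b ∷ q) ≋ scale b p +ₚ ((+ 0) ∷ p *ₚ q)
  *-∷ʳ []      b q .at zero    = refl
  *-∷ʳ []      b q .at (suc i) = refl
  *-∷ʳ (a ∷ p) b q .at zero    = cong (ℤ._+ + 0) (ℤₚ.*-comm a b)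
  *-∷ʳ (a ∷ p) b q .at (suc i)
    rewrite coeff-+ (scale a q) (p *ₚ (b ∷ q)) i
          | at (*-∷ʳ p b q) i
          | coeff-+ (scale b p) ((+ 0) ∷ p *ₚ q) i
          | coeff-+ (scale b p) (scale a q +ₚ ((+ 0) ∷ p *ₚ q)) i
          | coeff-+ (scale a q) ((+ 0) ∷ p *ₚ q) i
    = solve 3 (λ x y z → x :+ (y :+ z) := y :+ (x :+ z)) refl (coeff (scale a q) i) (coeff (scale b p) i) _
    where open ℤ-Solver

  *-comm≋ : ∀ p q → p *ₚ q ≋ q *ₚ p
  *-comm≋ p []      = *-zeroʳ≋ p
  *-comm≋ p (b ∷ q) = ≋-trans (*-∷ʳ p b q) (+-cong≋ ≋-refl (∷-cong≋ refl (*-comm≋ p q)))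

  *-cong≋ : ∀ {p p′ q q′} → p ≋ p′ → q ≋ q′ → p *ₚ q ≋ p′ *ₚ q′
  *-cong≋ {p} {p′} {q} {q′} e f = ≋-trans (*-congʳ≋ p f)
    (≋-trans (*-comm≋ p q′) (≋-trans (*-congʳ≋ q′ e) (*-comm≋ q′ p′)))

  *-distribˡ≋ : ∀ p q r → p *ₚ (q +ₚ r) ≋ p *ₚ q +ₚ p *ₚ r
  *-distribˡ≋ []      q r = ≋-refl
  *-distribˡ≋ (a ∷ p) q r .at zero
    rewrite coeff-*-zero a p (q +ₚ r) | coeff-+ q r 0
          | coeff-+ ((a ∷ p) *ₚ q) ((a ∷ p) *ₚ r) 0 | coeff-*-zero a p q | coeff-*-zero a p r
    = ℤₚ.*-distribˡ-+ a (coeff q 0) (coeff r 0)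
  *-distribˡ≋ (a ∷ p) q r .at (suc i)
    rewrite coeff-*-suc a p (q +ₚ r) i | coeff-+ q r (suc i)
          | coeff-+ ((a ∷ p) *ₚ q) ((a ∷ p) *ₚ r) (suc i) | coeff-*-suc a p q i | coeff-*-suc a p r i
          | at (*-distribˡ≋ p q r) i | coeff-+ (p *ₚ q) (p *ₚ r) i
    = solve 5 (λ α x y u v → α :* (x :+ y) :+ (u :+ v) := (α :* x :+ u) :+ (α :* y :+ v)) refl
        a (coeff q (suc i)) (coeff r (suc i)) (coeff (p *ₚ q) i) (coeff (p *ₚ r) i)
    where open ℤ-Solver

  *-distribʳ≋ : ∀ r p q → (p +ₚ q) *ₚ r ≋ p *ₚ r +ₚ q *ₚ r
  *-distribʳ≋ r p q = ≋-trans (*-comm≋ (p +ₚ q) r)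
    (≋-trans (*-distribˡ≋ r p q) (+-cong≋ (*-comm≋ r p) (*-comm≋ r q)))

  scale-* : ∀ a q r → scale a q *ₚ r ≋ scale a (q *ₚ r)
  scale-* a []      r = ≋-refl
  scale-* a (b ∷ q) r .at zero
    rewrite coeff-*-zero (a ℤ.* b) (scale a q) r | coeff-scale a ((b ∷ q) *ₚ r) 0 | coeff-*-zero b q r
    = ℤₚ.*-assoc a b (coeff r 0)
  scale-* a (b ∷ q) r .at (suc i)
    rewrite coeff-*-suc (a ℤ.* b) (scale a q) r i | coeff-scale a ((b ∷ q) *ₚ r) (suc i) | coeff-*-suc b q r i
          | at (scale-* a q r) i | coeff-scale a (q *ₚ r) i
    = solve 4 (λ α β x y → α :* β :* x :+ α :* y := α :* (β :* x :+ y)) refl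
        a b (coeff r (suc i)) (coeff (q *ₚ r) i)
    where open ℤ-Solver

  scale-0 : ∀ p → scale (+ 0) p ≋ []
  scale-0 p .at i = trans (coeff-scale (+ 0) p i) (ℤₚ.*-zeroˡ (coeff p i))

  shift-* : ∀ p q → ((+ 0) ∷ p) *ₚ q ≋ (+ 0) ∷ p *ₚ q
  shift-* p q = ≋-trans (+-cong≋ {q = (+ 0) ∷ p *ₚ q} (scale-0 q) ≋-refl) ≋-refl

  *-assoc≋ : ∀ p q r → (p *ₚ q) *ₚ r ≋ p *ₚ (q *ₚ r)
  *-assoc≋ []      q r = ≋-refl
  *-assoc≋ (a ∷ p) q r = ≋-trans (*-distribʳ≋ r (scale a q) ((+ 0) ∷ p *ₚ q))
    (+-cong≋ (scale-* a q r) (≋-trans (shift-* (p *ₚ q) r) (∷-cong≋ refl (*-assoc≋ p q r))))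

  *-identityˡ≋ : ∀ p → oneₚ *ₚ p ≋ p
  *-identityˡ≋ p .at zero    = trans (coeff-*-zero (+ 1) [] p) (ℤₚ.*-identityˡ (coeff p 0))
  *-identityˡ≋ p .at (suc i) = trans (coeff-*-suc (+ 1) [] p i)
    (trans (ℤₚ.+-identityʳ _) (ℤₚ.*-identityˡ (coeff p (suc i))))

  polynomialRing : CommutativeRing 0ℓ 0ℓ
  polynomialRing = record
    { Carrier = Poly ; _≈_ = _≋_ ; _+_ = _+ₚ_ ; _*_ = _*ₚ_ ; -_ = negₚ ; 0# = [] ; 1# = oneₚ
    ; isCommutativeRing = record
      { isRing = record
        { +-isAbelianGroup = record
          { isGroup = record
            { isMonoid = record
              { isSemigroup = record
                { isMagma = record
                  { isEquivalence = record { refl = ≋-refl ; sym = ≋-sym ; trans = ≋-trans }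
                  ; ∙-cong = +-cong≋ }
                ; assoc = +-assoc≋ }
              ; identity = (λ p → ≋-refl) , +-identityʳ≋ }
            ; inverse = (λ p → ≋-trans (+-comm≋ (negₚ p) p) (neg-inverseʳ≋ p)) , neg-inverseʳ≋
            ; ⁻¹-cong = neg-cong≋ }
          ; comm = +-comm≋ }
        ; *-cong = *-cong≋
        ; *-assoc = *-assoc≋
        ; *-identity = *-identityˡ≋ , λ p → ≋-trans (*-comm≋ p oneₚ) (*-identityˡ≋ p)
        ; distrib = *-distribˡ≋ , *-distribʳ≋ }
      ; *-comm = *-comm≋ } }

open PolynomialRing
open IntegerVectors

-- The quotient by a principal ideal.

module PrincipalQuotient {c ℓ} (R : CommutativeRing c ℓ) (m : CommutativeRing.Carrier R) where
  open CommutativeRing R renaming (refl to ≈-refl; sym to ≈-sym; trans to ≈-trans)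
  open import Algebra.Properties.Ring ring using (-‿distribˡ-*; -‿+-comm)
  open import Algebra.Properties.CommutativeSemigroup +-commutativeSemigroup using (interchange)
  open import Relation.Binary.Reasoning.Setoid setoid

  infix 4 _≡ₘ_

  record _≡ₘ_ (x y : Carrier) : Set (c ⊔ ℓ) where
    constructor congruent
    field
      quotient : Carrier
      differ   : x ≈ y + quotient * m
  open _≡ₘ_ public

  ≈⇒≡ₘ : ∀ {x y} → x ≈ y → x ≡ₘ y
  ≈⇒≡ₘ {x} {y} e = congruent 0# (≈-trans e (≈-sym (≈-trans (+-congˡ (zeroˡ m)) (+-identityʳ y))))

  ≡ₘ-sym : ∀ {x y} → x ≡ₘ y → y ≡ₘ x
  ≡ₘ-sym {x} {y} (congruent r e) = congruent (- r) (begin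
    y                             ≈⟨ +-identityʳ y ⟨
    y + 0#                        ≈⟨ +-congˡ (-‿inverseʳ (r * m)) ⟨
    y + (r * m + - (r * m))       ≈⟨ +-assoc y _ _ ⟨
    (y + r * m) + - (r * m)       ≈⟨ +-cong (≈-sym e) (-‿distribˡ-* r m) ⟩
    x + (- r) * m                 ∎)

  ≡ₘ-trans : ∀ {x y z} → x ≡ₘ y → y ≡ₘ z → x ≡ₘ z
  ≡ₘ-trans {x} {y} {z} (congruent r e) (congruent s f) = congruent (s + r) (begin
    x                       ≈⟨ e ⟩
    y + r * m               ≈⟨ +-congʳ f ⟩
    z + s * m + r * m       ≈⟨ +-assoc z _ _ ⟩
    z + (s * m + r * m)     ≈⟨ +-congˡ (distribʳ m s r) ⟨
    z + (s + r) * m         ∎)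

  ≡ₘ-+-cong : ∀ {x x′ y y′} → x ≡ₘ x′ → y ≡ₘ y′ → x + y ≡ₘ x′ + y′
  ≡ₘ-+-cong {x} {x′} {y} {y′} (congruent r e) (congruent s f) = congruent (r + s) (begin
    x + y                          ≈⟨ +-cong e f ⟩
    (x′ + r * m) + (y′ + s * m)    ≈⟨ interchange x′ _ y′ _ ⟩
    (x′ + y′) + (r * m + s * m)    ≈⟨ +-congˡ (distribʳ m r s) ⟨
    (x′ + y′) + (r + s) * m        ∎)

  ≡ₘ-*-congˡ : ∀ x {y y′} → y ≡ₘ y′ → x * y ≡ₘ x * y′
  ≡ₘ-*-congˡ x {y} {y′} (congruent s f) = congruent (x * s) (begin
    x * y                   ≈⟨ *-congˡ f ⟩
    x * (y′ + s * m)        ≈⟨ distribˡ x y′ _ ⟩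
    x * y′ + x * (s * m)    ≈⟨ +-congˡ (*-assoc x s m) ⟨
    x * y′ + x * s * m      ∎)

  ≡ₘ-*-cong : ∀ {x x′ y y′} → x ≡ₘ x′ → y ≡ₘ y′ → x * y ≡ₘ x′ * y′
  ≡ₘ-*-cong {x} {x′} {y} {y′} e f = ≡ₘ-trans (≡ₘ-*-congˡ x f)
    (≡ₘ-trans (≈⇒≡ₘ (*-comm x y′)) (≡ₘ-trans (≡ₘ-*-congˡ y′ e) (≈⇒≡ₘ (*-comm y′ x′))))

  ≡ₘ-neg-cong : ∀ {x x′} → x ≡ₘ x′ → - x ≡ₘ - x′
  ≡ₘ-neg-cong {x} {x′} (congruent r e) = congruent (- r) (begin
    - x                    ≈⟨ -‿cong e ⟩
    - (x′ + r * m)         ≈⟨ -‿+-comm x′ (r * m) ⟨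
    - x′ + - (r * m)       ≈⟨ +-congˡ (-‿distribˡ-* r m) ⟩
    - x′ + - r * m         ∎)

  quotientRing : CommutativeRing c (c ⊔ ℓ)
  quotientRing = record
    { Carrier = Carrier ; _≈_ = _≡ₘ_ ; _+_ = _+_ ; _*_ = _*_ ; -_ = -_ ; 0# = 0# ; 1# = 1#
    ; isCommutativeRing = record
      { isRing = record
        { +-isAbelianGroup = record
          { isGroup = record
            { isMonoid = record
              { isSemigroup = record
                { isMagma = record
                  { isEquivalence = record { refl = ≈⇒≡ₘ ≈-refl ; sym = ≡ₘ-sym ; trans = ≡ₘ-trans }
                  ; ∙-cong = ≡ₘ-+-cong }
                ; assoc = λ x y z → ≈⇒≡ₘ (+-assoc x y z) }
              ; identity = (λ x → ≈⇒≡ₘ (+-identityˡ x)) , λ x → ≈⇒≡ₘ (+-identityʳ x) }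
            ; inverse = (λ x → ≈⇒≡ₘ (-‿inverseˡ x)) , λ x → ≈⇒≡ₘ (-‿inverseʳ x)
            ; ⁻¹-cong = ≡ₘ-neg-cong }
          ; comm = λ x y → ≈⇒≡ₘ (+-comm x y) }
        ; *-cong = ≡ₘ-*-cong
        ; *-assoc = λ x y z → ≈⇒≡ₘ (*-assoc x y z)
        ; *-identity = (λ x → ≈⇒≡ₘ (*-identityˡ x)) , λ x → ≈⇒≡ₘ (*-identityʳ x)
        ; distrib = (λ x y z → ≈⇒≡ₘ (distribˡ x y z)) , λ x y z → ≈⇒≡ₘ (distribʳ x y z) }
      ; *-comm = λ x y → ≈⇒≡ₘ (*-comm x y) } }

-- A symmetric tridiagonal matrix and polynomials in it.

module Jacobi where
  open ≡ using (refl; sym; trans; cong; cong₂; subst; module ≡-Reasoning)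

  -- The argument `a` is the entry preceding the vector. The last row subtracts its own entry;
  -- letting the first entry precede itself later gives the corner 1.
  S′ : ∀ {d} → ℤ → Vec ℤ d → Vec ℤ d
  S′ a []          = []
  S′ a (x ∷ [])    = (a ℤ.- x) ∷ []
  S′ a (x ∷ y ∷ z) = (a ℤ.+ y) ∷ S′ x (y ∷ z)

  -- The symmetric tridiagonal matrix with diagonal (1,0,…,0,−1) and
  -- off-diagonal entries 1.  It is the matrix of multiplication by X_n in the
  -- basis cos((k+½)θ)/cos(θ/2), k < 2ⁿ, where X_n = 2cos θ.
  S : ∀ {d} → Vec ℤ d → Vec ℤ d
  S []      = []
  S (x ∷ y) = S′ x (x ∷ y)

  S′-⊕ : ∀ {d} a b (y z : Vec ℤ d) → S′ (a ℤ.+ b) (y ⊕ z) ≡ S′ a y ⊕ S′ b z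
  S′-⊕ a b []          []          = refl
  S′-⊕ a b (x ∷ [])    (w ∷ [])    = cong (_∷ [])
    (solve 4 (λ a b x w → (a :+ b) :- (x :+ w) := (a :- x) :+ (b :- w)) refl a b x w)
    where open ℤ-Solver
  S′-⊕ a b (x ∷ y ∷ u) (w ∷ z ∷ v) = cong₂ _∷_
    (solve 4 (λ a b x w → (a :+ b) :+ (x :+ w) := (a :+ x) :+ (b :+ w)) refl a b y z)
    (S′-⊕ x w (y ∷ u) (z ∷ v))
    where open ℤ-Solver

  S-⊕ : ∀ {d} (y z : Vec ℤ d) → S (y ⊕ z) ≡ S y ⊕ S z
  S-⊕ []      []      = refl
  S-⊕ (x ∷ y) (w ∷ z) = S′-⊕ x w (x ∷ y) (w ∷ z)

  S′-⊙ : ∀ {d} c a (y : Vec ℤ d) → S′ (c ℤ.* a) (c ⊙ y) ≡ c ⊙ S′ a y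
  S′-⊙ c a []          = refl
  S′-⊙ c a (x ∷ [])    = cong (_∷ [])
    (solve 3 (λ c a x → c :* a :- c :* x := c :* (a :- x)) refl c a x)
    where open ℤ-Solver
  S′-⊙ c a (x ∷ y ∷ u) = cong₂ _∷_ (sym (ℤₚ.*-distribˡ-+ c a y)) (S′-⊙ c x (y ∷ u))

  S-⊙ : ∀ {d} c (y : Vec ℤ d) → S (c ⊙ y) ≡ c ⊙ S y
  S-⊙ c []      = refl
  S-⊙ c (x ∷ y) = S′-⊙ c x (x ∷ y)

  S-𝟎 : ∀ {d} → S (𝟎 {d}) ≡ 𝟎
  S-𝟎 {d} = trans (cong S (sym (⊙-zero 𝟎))) (trans (S-⊙ (+ 0) (𝟎 {d})) (⊙-zero (S 𝟎)))

  -- Summation by parts with the boundary terms b x and a w. They agree when each vector's first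
  -- entry is its own predecessor, whence the symmetry of `S`.
  S′-green : ∀ {d} a b x w (y z : Vec ℤ d) →
    dot (S′ a (x ∷ y)) (w ∷ z) ℤ.+ b ℤ.* x ≡ dot (x ∷ y) (S′ b (w ∷ z)) ℤ.+ a ℤ.* w
  S′-green a b x w [] [] =
    solve 4 (λ a b x w → ((a :- x) :* w :+ con (+ 0)) :+ b :* x := (x :* (b :- w) :+ con (+ 0)) :+ a :* w) refl a b x w
    where open ℤ-Solver
  S′-green a b x w (y ∷ u) (z ∷ v) = begin
    ((a ℤ.+ y) ℤ.* w ℤ.+ p) ℤ.+ b ℤ.* x
      ≡⟨ solve 6 (λ a b x w y p → ((a :+ y) :* w :+ p) :+ b :* x := (p :+ w :* y) :+ (a :* w :+ b :* x)) refl a b x w y p ⟩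
    (p ℤ.+ w ℤ.* y) ℤ.+ (a ℤ.* w ℤ.+ b ℤ.* x)
      ≡⟨ cong (ℤ._+ (a ℤ.* w ℤ.+ b ℤ.* x)) (S′-green x w y z u v) ⟩
    (q ℤ.+ x ℤ.* z) ℤ.+ (a ℤ.* w ℤ.+ b ℤ.* x)
      ≡⟨ solve 6 (λ a b x w z q → (q :+ x :* z) :+ (a :* w :+ b :* x) := (x :* (b :+ z) :+ q) :+ a :* w) refl a b x w z q ⟩
    (x ℤ.* (b ℤ.+ z) ℤ.+ q) ℤ.+ a ℤ.* w ∎
    where
    open ≡-Reasoning
    open ℤ-Solver
    p = dot (S′ x (y ∷ u)) (z ∷ v)
    q = dot (y ∷ u) (S′ w (z ∷ v))

  S-symmetric : ∀ {d} (y z : Vec ℤ d) → dot (S y) z ≡ dot y (S z)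
  S-symmetric []      []      = refl
  S-symmetric (x ∷ y) (w ∷ z) = ∙-cancelʳ (w ℤ.* x) _ _
    (trans (S′-green x w x w y z) (cong (λ t → dot (x ∷ y) (S′ w (w ∷ z)) ℤ.+ t) (ℤₚ.*-comm x w)))
    where open import Algebra.Properties.Group (AbelianGroup.group ℤₚ.+-0-abelianGroup) using (∙-cancelʳ)

  -- Each entry occurs in two rows and each row costs a factor 2, hence 4. The extra 2x² on the left
  -- pays, one step earlier, for the share of x in the previous row.
  ∥S′∥² : ∀ {d} a x (y : Vec ℤ d) →
    ∥ S′ a (x ∷ y) ∥² ℕ.+ 2 ℕ.* sq x ℕ.≤ 2 ℕ.* sq a ℕ.+ 4 ℕ.* ∥ x ∷ y ∥²
  ∥S′∥² a x [] = begin
    (sq (a ℤ.- x) ℕ.+ 0) ℕ.+ 2 ℕ.* sq x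
      ≤⟨ ℕₚ.+-monoˡ-≤ (2 ℕ.* sq x) (ℕₚ.+-monoˡ-≤ 0 (ℕₚ.≤-trans (ℕₚ.m≤n+m (sq (a ℤ.- x)) _) (ℕₚ.≤-reflexive (parallelogram a x)))) ⟩
    (2 ℕ.* sq a ℕ.+ 2 ℕ.* sq x ℕ.+ 0) ℕ.+ 2 ℕ.* sq x
      ≡⟨ solve 2 (λ a x → (con 2 :* a :+ con 2 :* x :+ con 0) :+ con 2 :* x := con 2 :* a :+ con 4 :* (x :+ con 0)) refl (sq a) (sq x) ⟩
    2 ℕ.* sq a ℕ.+ 4 ℕ.* (sq x ℕ.+ 0) ∎
    where
    open ℕₚ.≤-Reasoning
    open ℕ-Solver
  ∥S′∥² a x (y ∷ z) = begin
    (sq (a ℤ.+ y) ℕ.+ r) ℕ.+ 2 ℕ.* sq x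
      ≤⟨ ℕₚ.+-monoˡ-≤ (2 ℕ.* sq x) (ℕₚ.+-monoˡ-≤ r (sq-+ a y)) ⟩
    ((2 ℕ.* sq a ℕ.+ 2 ℕ.* sq y) ℕ.+ r) ℕ.+ 2 ℕ.* sq x
      ≡⟨ solve 4 (λ a x y r → ((con 2 :* a :+ con 2 :* y) :+ r) :+ con 2 :* x := con 2 :* a :+ (r :+ con 2 :* y) :+ con 2 :* x) refl (sq a) (sq x) (sq y) r ⟩
    2 ℕ.* sq a ℕ.+ (r ℕ.+ 2 ℕ.* sq y) ℕ.+ 2 ℕ.* sq x
      ≤⟨ ℕₚ.+-monoˡ-≤ (2 ℕ.* sq x) (ℕₚ.+-monoʳ-≤ (2 ℕ.* sq a) (∥S′∥² x y z)) ⟩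
    2 ℕ.* sq a ℕ.+ (2 ℕ.* sq x ℕ.+ 4 ℕ.* ∥ y ∷ z ∥²) ℕ.+ 2 ℕ.* sq x
      ≡⟨ solve 3 (λ a x t → con 2 :* a :+ (con 2 :* x :+ con 4 :* t) :+ con 2 :* x := con 2 :* a :+ con 4 :* (x :+ t)) refl (sq a) (sq x) ∥ y ∷ z ∥² ⟩
    2 ℕ.* sq a ℕ.+ 4 ℕ.* (sq x ℕ.+ ∥ y ∷ z ∥²) ∎
    where
    open ℕₚ.≤-Reasoning
    open ℕ-Solver
    r = ∥ S′ x (y ∷ z) ∥²

  ∥S∥² : ∀ {d} (y : Vec ℤ d) → ∥ S y ∥² ℕ.≤ 4 ℕ.* ∥ y ∥²
  ∥S∥² []      = ℕ.z≤n
  ∥S∥² (x ∷ y) = ℕₚ.+-cancelʳ-≤ (2 ℕ.* sq x) _ _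
    (ℕₚ.≤-trans (∥S′∥² x x y) (ℕₚ.≤-reflexive (ℕₚ.+-comm (2 ℕ.* sq x) _)))

  sq≤1 : ∀ x → sq x ℕ.≤ 1 → x ≡ + 0 ⊎ (x ≡ + 1 ⊎ x ≡ ℤ.- (+ 1))
  sq≤1 (+ 0)                le = inj₁ refl
  sq≤1 (+ 1)                le = inj₂ (inj₁ refl)
  sq≤1 (+ suc (suc n))      (ℕ.s≤s ())
  sq≤1 -[1+ 0 ]             le = inj₂ (inj₂ refl)
  sq≤1 -[1+ suc n ]         (ℕ.s≤s ())

  S′-𝟎 : ∀ {d} x → dot (S′ {d} x 𝟎) 𝟎 ≡ + 0
  S′-𝟎 {d} x = trans (dot-sym (S′ {d} x 𝟎) 𝟎) (dot-𝟎ˡ (S′ {d} x 𝟎))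

  -- An integer vector of square norm 1 is a basis vector up to sign, and with predecessor 0 the
  -- diagonal entries are 0 and, at the end, -1.
  S′-diagonal : ∀ {d} (y : Vec ℤ d) → ∥ y ∥² ≡ 1 → dot (S′ (+ 0) y) y ≢ + 1
  S′-diagonal (x ∷ y) e f with sq≤1 x (subst (sq x ℕ.≤_) e (ℕₚ.m≤m+n (sq x) _))
  S′-diagonal (x ∷ []) () f | inj₁ refl
  S′-diagonal (x ∷ y ∷ z) e f | inj₁ refl = S′-diagonal (y ∷ z) e
    (trans (sym (trans (cong (ℤ._+ dot (S′ (+ 0) (y ∷ z)) (y ∷ z)) (ℤₚ.*-zeroʳ (+ 0 ℤ.+ y))) (ℤₚ.+-identityˡ _))) f)
  S′-diagonal (x ∷ []) e () | inj₂ (inj₁ refl)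
  S′-diagonal (x ∷ []) e () | inj₂ (inj₂ refl)
  S′-diagonal (_∷_ {n = suc k} x (y ∷ z)) e f | inj₂ (inj₁ refl)
    with refl ← ∥∥²≡0⇒≡𝟎 (y ∷ z) (ℕₚ.suc-injective e) =
    contradiction (trans (sym (trans (ℤₚ.+-identityˡ _) (S′-𝟎 {suc k} (+ 1)))) f) λ ()
  S′-diagonal (_∷_ {n = suc k} x (y ∷ z)) e f | inj₂ (inj₂ refl)
    with refl ← ∥∥²≡0⇒≡𝟎 (y ∷ z) (ℕₚ.suc-injective e) =
    contradiction (trans (sym (trans (ℤₚ.+-identityˡ _) (S′-𝟎 {suc k} (ℤ.- (+ 1))))) f) λ ()

  e₀ : ∀ {d} → Vec ℤ (suc d)
  e₀ = + 1 ∷ 𝟎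

  -- e₀ is the only basis vector at which the diagonal of S is 1.
  S-diagonal : ∀ {d} (y : Vec ℤ (2 ℕ.+ d)) → ∥ y ∥² ≡ 1 → dot (S y) y ≡ + 1 →
    y ≡ e₀ ⊎ y ≡ (ℤ.- (+ 1)) ⊙ e₀
  S-diagonal (x ∷ y) e f with sq≤1 x (subst (sq x ℕ.≤_) e (ℕₚ.m≤m+n (sq x) _))
  S-diagonal (x ∷ y@(_ ∷ _)) e f | inj₁ refl = contradiction
    (trans (sym (trans (cong (ℤ._+ dot (S′ (+ 0) y) y) (ℤₚ.*-zeroʳ (+ 0 ℤ.+ Vec.head y))) (ℤₚ.+-identityˡ _))) f)
    (S′-diagonal y e)
  S-diagonal (x ∷ y) e f | inj₂ (inj₁ refl) = inj₁ (cong (+ 1 ∷_) (∥∥²≡0⇒≡𝟎 y (ℕₚ.suc-injective e)))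
  S-diagonal (x ∷ y) e f | inj₂ (inj₂ refl) = inj₂ (cong (ℤ.- (+ 1) ∷_)
    (trans (∥∥²≡0⇒≡𝟎 y (ℕₚ.suc-injective e)) (sym (⊙-𝟎 (ℤ.- (+ 1))))))

  act : Poly → ∀ {d} → Vec ℤ d → Vec ℤ d
  act []      y = 𝟎
  act (a ∷ p) y = a ⊙ y ⊕ S (act p y)

  act-+ : ∀ p q {d} (y : Vec ℤ d) → act (p +ₚ q) y ≡ act p y ⊕ act q y
  act-+ []      q       y = sym (⊕-identityˡ (act q y))
  act-+ (a ∷ p) []      y = sym (⊕-identityʳ (act (a ∷ p) y))
  act-+ (a ∷ p) (b ∷ q) y = trans
    (cong₂ _⊕_ (+-⊙ a b y) (trans (cong S (act-+ p q y)) (S-⊕ (act p y) (act q y))))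
    (⊕-interchange (a ⊙ y) (b ⊙ y) (S (act p y)) (S (act q y)))

  act-scale : ∀ c p {d} (y : Vec ℤ d) → act (scale c p) y ≡ c ⊙ act p y
  act-scale c []      y = sym (⊙-𝟎 c)
  act-scale c (a ∷ p) y = trans
    (cong₂ _⊕_ (⊙-assoc c a y) (trans (cong S (act-scale c p y)) (S-⊙ c (act p y))))
    (sym (⊙-⊕ c (a ⊙ y) (S (act p y))))

  act-* : ∀ p q {d} (y : Vec ℤ d) → act (p *ₚ q) y ≡ act p (act q y)
  act-* []      q y = refl
  act-* (a ∷ p) q y = trans (act-+ (scale a q) ((+ 0) ∷ p *ₚ q) y)
    (cong₂ _⊕_ (act-scale a q y)
      (trans (cong (_⊕ S (act (p *ₚ q) y)) (⊙-zero y))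
        (trans (⊕-identityˡ _) (cong S (act-* p q y)))))

  act-one : ∀ {d} (y : Vec ℤ d) → act oneₚ y ≡ y
  act-one y = trans (cong (+ 1 ⊙ y ⊕_) S-𝟎) (trans (⊕-identityʳ _) (⊙-one y))

  act-𝟎 : ∀ p {d} → act p (𝟎 {d}) ≡ 𝟎
  act-𝟎 []      = refl
  act-𝟎 (a ∷ p) = trans (cong₂ _⊕_ (⊙-𝟎 a) (trans (cong S (act-𝟎 p)) S-𝟎)) (⊕-identityˡ 𝟎)

  act-≋[] : ∀ {p} → p ≋ [] → ∀ {d} (y : Vec ℤ d) → act p y ≡ 𝟎
  act-≋[] {[]}    e y = refl
  act-≋[] {a ∷ p} e y = trans
    (cong₂ _⊕_ (trans (cong (_⊙ y) (at e 0)) (⊙-zero y)) (trans (cong S (act-≋[] {p} (mk λ i → at e (suc i)) y)) S-𝟎))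
    (⊕-identityˡ 𝟎)

  act-cong : ∀ {p q} → p ≋ q → ∀ {d} (y : Vec ℤ d) → act p y ≡ act q y
  act-cong {[]}    {q}     e y = sym (act-≋[] (≋-sym e) y)
  act-cong {a ∷ p} {[]}    e y = act-≋[] e y
  act-cong {a ∷ p} {b ∷ q} e y = cong₂ _⊕_ (cong (_⊙ y) (at e 0)) (cong S (act-cong (tail≋ e) y))

  act-symmetric : ∀ p {d} (y z : Vec ℤ d) → dot (act p y) z ≡ dot y (act p z)
  act-symmetric []      y z = trans (dot-𝟎ˡ z) (sym (trans (dot-sym y 𝟎) (dot-𝟎ˡ y)))
  act-symmetric (a ∷ p) y z = begin
    dot (a ⊙ y ⊕ S (act p y)) z
      ≡⟨ dot-⊕ˡ (a ⊙ y) _ z ⟩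
    dot (a ⊙ y) z ℤ.+ dot (S (act p y)) z
      ≡⟨ cong₂ ℤ._+_ (dot-⊙ˡ a y z) (trans (S-symmetric (act p y) z) (act-symmetric p y (S z))) ⟩
    a ℤ.* dot y z ℤ.+ dot y (act p (S z))
      ≡⟨ cong (λ v → a ℤ.* dot y z ℤ.+ dot y v) (act-S p z) ⟩
    a ℤ.* dot y z ℤ.+ dot y (S (act p z))
      ≡⟨ cong (ℤ._+ dot y (S (act p z))) (dot-⊙ʳ a z y) ⟨
    dot y (a ⊙ z) ℤ.+ dot y (S (act p z))
      ≡⟨ dot-⊕ʳ (a ⊙ z) _ y ⟨
    dot y (a ⊙ z ⊕ S (act p z)) ∎
    where
    open ≡-Reasoning
    act-S : ∀ p {d} (z : Vec ℤ d) → act p (S z) ≡ S (act p z)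
    act-S []      z = sym S-𝟎
    act-S (a ∷ p) z = trans (cong₂ _⊕_ (sym (S-⊙ a z)) (cong S (act-S p z))) (sym (S-⊕ (a ⊙ z) (S (act p z))))

  act-bounded : ∀ p → ∃ λ B → ∀ {d} (y : Vec ℤ d) → ∥ act p y ∥² ℕ.≤ B ℕ.* ∥ y ∥²
  act-bounded [] = 0 , λ {d} y → ℕₚ.≤-reflexive (∥𝟎∥² d)
  act-bounded (a ∷ p) with B , b ← act-bounded p = 2 ℕ.* sq a ℕ.+ 8 ℕ.* B , λ y → begin
    ∥ a ⊙ y ⊕ S (act p y) ∥²
      ≤⟨ ∥⊕∥² (a ⊙ y) _ ⟩
    2 ℕ.* ∥ a ⊙ y ∥² ℕ.+ 2 ℕ.* ∥ S (act p y) ∥²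
      ≤⟨ ℕₚ.+-mono-≤ (ℕₚ.≤-reflexive (cong (2 ℕ.*_) (∥⊙∥² a y)))
           (ℕₚ.*-monoʳ-≤ 2 (ℕₚ.≤-trans (∥S∥² (act p y)) (ℕₚ.*-monoʳ-≤ 4 (b y)))) ⟩
    2 ℕ.* (sq a ℕ.* ∥ y ∥²) ℕ.+ 2 ℕ.* (4 ℕ.* (B ℕ.* ∥ y ∥²))
      ≡⟨ solve 3 (λ a b t → con 2 :* (a :* t) :+ con 2 :* (con 4 :* (b :* t)) := (con 2 :* a :+ con 8 :* b) :* t) refl (sq a) B ∥ y ∥² ⟩
    (2 ℕ.* sq a ℕ.+ 8 ℕ.* B) ℕ.* ∥ y ∥² ∎
    where
    open ℕₚ.≤-Reasoning
    open ℕ-Solver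

open Jacobi

-- Composition of polynomials and of Chebyshev polynomials.

module Composition where
  open CommutativeRing polynomialRing
  open import Algebra.Solver.Ring.NaturalCoefficients.Default commutativeSemiring using (solve; _:+_; _:*_; _:=_; con)
  open import Relation.Binary.Reasoning.Setoid setoid

  ∷≋ : ∀ a p → a ∷ p ≋ const a +ₚ Xₚ *ₚ p
  ∷≋ a p = ≋-sym (≋-trans (+-cong≋ {const a} ≋-refl (≋-trans (shift-* oneₚ p) (∷-cong≋ ≡.refl (*-identityˡ≋ p))))
    (∷-cong≋ (ℤₚ.+-identityʳ a) ≋-refl))

  const-* : ∀ c p → const c *ₚ p ≋ scale c p
  const-* c p = ≋-trans (+-cong≋ {scale c p} {q = (+ 0) ∷ []} {[]} ≋-refl (mk λ { zero → ≡.refl ; (suc i) → ≡.refl })) (+-identityʳ≋ (scale c p))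

  compose-≋[] : ∀ {p} r → p ≋ [] → compose p r ≋ []
  compose-≋[] {[]}    r e = ≋-refl
  compose-≋[] {a ∷ p} r e = begin
    const a +ₚ r *ₚ compose p r  ≈⟨ +-cong≋ {const a} {[]} (mk λ { zero → at e 0 ; (suc i) → ≡.refl }) (*-congʳ≋ r (compose-≋[] {p} r (mk λ i → at e (suc i)))) ⟩
    r *ₚ []                      ≈⟨ *-zeroʳ≋ r ⟩
    []                           ∎

  compose-congˡ : ∀ {p q} r → p ≋ q → compose p r ≋ compose q r
  compose-congˡ {[]}    {q}     r e = ≋-sym (compose-≋[] r (≋-sym e))
  compose-congˡ {a ∷ p} {[]}    r e = compose-≋[] r e
  compose-congˡ {a ∷ p} {b ∷ q} r e =
    +-cong≋ {const a} {const b} (∷-cong≋ (at e 0) ≋-refl) (*-congʳ≋ r (compose-congˡ r (tail≋ e)))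

  compose-+ : ∀ p q r → compose (p +ₚ q) r ≋ compose p r +ₚ compose q r
  compose-+ []      q       r = ≋-refl
  compose-+ (a ∷ p) []      r = ≋-sym (+-identityʳ≋ _)
  compose-+ (a ∷ p) (b ∷ q) r = begin
    const (a ℤ.+ b) +ₚ r *ₚ compose (p +ₚ q) r
      ≈⟨ +-congˡ {const (a ℤ.+ b)} (*-congʳ≋ r (compose-+ p q r)) ⟩
    (const a +ₚ const b) +ₚ r *ₚ (compose p r +ₚ compose q r)
      ≈⟨ solve 5 (λ a b r p q → (a :+ b) :+ r :* (p :+ q) := (a :+ r :* p) :+ (b :+ r :* q)) ≋-refl (const a) (const b) r (compose p r) (compose q r) ⟩
    (const a +ₚ r *ₚ compose p r) +ₚ (const b +ₚ r *ₚ compose q r) ∎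

  compose-scale : ∀ c p r → compose (scale c p) r ≋ const c *ₚ compose p r
  compose-scale c []      r = ≋-sym (*-zeroʳ≋ (const c))
  compose-scale c (a ∷ p) r = begin
    const (c ℤ.* a) +ₚ r *ₚ compose (scale c p) r
      ≈⟨ +-cong≋ {const (c ℤ.* a)} {const c *ₚ const a} (≋-sym (const-* c (const a))) (*-congʳ≋ r (compose-scale c p r)) ⟩
    const c *ₚ const a +ₚ r *ₚ (const c *ₚ compose p r)
      ≈⟨ solve 4 (λ c a r p → c :* a :+ r :* (c :* p) := c :* (a :+ r :* p)) ≋-refl (const c) (const a) r (compose p r) ⟩
    const c *ₚ (const a +ₚ r *ₚ compose p r) ∎

  compose-shift : ∀ p r → compose ((+ 0) ∷ p) r ≋ r *ₚ compose p r
  compose-shift p r = +-cong≋ {const (+ 0)} {[]} (mk λ { zero → ≡.refl ; (suc i) → ≡.refl }) ≋-refl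

  compose-* : ∀ p q r → compose (p *ₚ q) r ≋ compose p r *ₚ compose q r
  compose-* []      q r = ≋-refl
  compose-* (a ∷ p) q r = begin
    compose (scale a q +ₚ ((+ 0) ∷ p *ₚ q)) r
      ≈⟨ compose-+ (scale a q) _ r ⟩
    compose (scale a q) r +ₚ compose ((+ 0) ∷ p *ₚ q) r
      ≈⟨ +-cong≋ (compose-scale a q r) (≋-trans (compose-shift (p *ₚ q) r) (*-congʳ≋ r (compose-* p q r))) ⟩
    const a *ₚ compose q r +ₚ r *ₚ (compose p r *ₚ compose q r)
      ≈⟨ solve 4 (λ a q r p → a :* q :+ r :* (p :* q) := (a :+ r :* p) :* q) ≋-refl (const a) (compose q r) r (compose p r) ⟩
    (const a +ₚ r *ₚ compose p r) *ₚ compose q r ∎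

  compose-const : ∀ c r → compose (const c) r ≋ const c
  compose-const c r = ≋-trans (+-cong≋ {const c} ≋-refl (*-zeroʳ≋ r)) (+-identityʳ≋ (const c))

  compose-Xˡ : ∀ r → compose Xₚ r ≋ r
  compose-Xˡ r = ≋-trans (compose-shift oneₚ r) (≋-trans (*-congʳ≋ r (compose-const (+ 1) r)) (*-identityʳ r))

  compose-Xʳ : ∀ p → compose p Xₚ ≋ p
  compose-Xʳ []      = ≋-refl
  compose-Xʳ (a ∷ p) = ≋-trans (+-cong≋ {const a} ≋-refl (*-congʳ≋ Xₚ (compose-Xʳ p))) (≋-sym (∷≋ a p))

  compose-assoc : ∀ p q r → compose (compose p q) r ≋ compose p (compose q r)
  compose-assoc []      q r = ≋-refl
  compose-assoc (a ∷ p) q r = begin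
    compose (const a +ₚ q *ₚ compose p q) r
      ≈⟨ compose-+ (const a) (q *ₚ compose p q) r ⟩
    compose (const a) r +ₚ compose (q *ₚ compose p q) r
      ≈⟨ +-cong≋ (compose-const a r) (≋-trans (compose-* q (compose p q) r) (*-congʳ≋ (compose q r) (compose-assoc p q r))) ⟩
    const a +ₚ compose q r *ₚ compose p (compose q r) ∎

  compose-congʳ : ∀ p {r s} → r ≋ s → compose p r ≋ compose p s
  compose-congʳ []      e = ≋-refl
  compose-congʳ (a ∷ p) e = +-cong≋ {const a} ≋-refl (*-cong≋ e (compose-congʳ p e))

  open Chebyshev polynomialRing Xₚ using (E; E-recurrent; E-multiples; E-shift; a-b+b≈a) public

  -- Both sides solve, in k, the recurrence with parameter `E j` and have the same first two values.
  compose-E : ∀ j k → compose (E k) (E j) ≋ E (k ℕ.* j)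
  compose-E j = Chebyshev.recurrent-unique polynomialRing (E j)
    (λ k → begin
      compose (E (2 ℕ.+ k)) (E j) +ₚ compose (E k) (E j)  ≈⟨ compose-+ (E (2 ℕ.+ k)) (E k) (E j) ⟨
      compose (E (2 ℕ.+ k) +ₚ E k) (E j)                  ≈⟨ compose-congˡ (E j) (E-recurrent k) ⟩
      compose (Xₚ *ₚ E (1 ℕ.+ k)) (E j)                   ≈⟨ compose-* Xₚ (E (1 ℕ.+ k)) (E j) ⟩
      compose Xₚ (E j) *ₚ compose (E (1 ℕ.+ k)) (E j)     ≈⟨ *-congʳ (compose-Xˡ (E j)) ⟩
      E j *ₚ compose (E (1 ℕ.+ k)) (E j)                  ∎)
    (E-multiples j)
    (compose-const (+ 2) (E j))
    (≋-trans (compose-Xˡ (E j)) (reflexive (≡.cong E (≡.sym (ℕₚ.+-identityʳ j)))))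

  E₃≋ : Xₚ *ₚ Xₚ *ₚ Xₚ -ₚ scale (+ 3) Xₚ ≋ E 3
  E₃≋ = mk λ { 0 → ≡.refl ; 1 → ≡.refl ; 2 → ≡.refl ; 3 → ≡.refl ; 4 → ≡.refl ; (suc (suc (suc (suc (suc i))))) → ≡.refl }

  -- The substituted polynomial x² - 2 is `E 2`, so each step doubles the index.
  minPoly≋E : ∀ n → minPoly n ≋ E (2 ℕ.^ n)
  minPoly≋E zero    = ≋-refl
  minPoly≋E (suc n) = begin
    compose (minPoly n) (E 2)       ≈⟨ compose-congˡ (E 2) (minPoly≋E n) ⟩
    compose (E (2 ℕ.^ n)) (E 2)     ≈⟨ compose-E 2 (2 ℕ.^ n) ⟩
    E (2 ℕ.^ n ℕ.* 2)               ≡⟨ ≡.cong E (ℕₚ.*-comm (2 ℕ.^ n) 2) ⟩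
    E (2 ℕ.* 2 ℕ.^ n)               ∎

  σ^≋ : ∀ i p → fold p σ i ≋ compose p (E (3 ℕ.^ i))
  σ^≋ zero    p = ≋-sym (compose-Xʳ p)
  σ^≋ (suc i) p = begin
    σ (fold p σ i)                              ≈⟨ compose-congˡ _ (σ^≋ i p) ⟩
    σ (compose p (E (3 ℕ.^ i)))                 ≈⟨ compose-assoc p (E (3 ℕ.^ i)) _ ⟩
    compose p (σ (E (3 ℕ.^ i)))                 ≈⟨ compose-congʳ p (≋-trans (compose-congʳ (E (3 ℕ.^ i)) E₃≋) (compose-E 3 (3 ℕ.^ i))) ⟩
    compose p (E (3 ℕ.^ i ℕ.* 3))               ≡⟨ ≡.cong (λ j → compose p (E j)) (ℕₚ.*-comm (3 ℕ.^ i) 3) ⟩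
    compose p (E (3 ℕ.* 3 ℕ.^ i))               ∎

  -- The identity cos 3A = cos A (2 cos 2A - 1) for A = dθ; it lets σ descend to the quotient.
  σ-minPoly : ∀ n → ∃ λ t → σ (minPoly n) ≋ t *ₚ minPoly n
  σ-minPoly n = E (d ℕ.+ d) +ₚ negₚ oneₚ , (begin
    σ (minPoly n)                                 ≈⟨ compose-congˡ _ (minPoly≋E n) ⟩
    σ (E d)                                       ≈⟨ compose-congʳ (E d) E₃≋ ⟩
    compose (E d) (E 3)                           ≈⟨ compose-E 3 d ⟩
    E (d ℕ.* 3)                                   ≡⟨ ≡.cong E (≡.trans (ℕₚ.*-comm d 3) (≡.cong (λ m → d ℕ.+ (d ℕ.+ m)) (ℕₚ.+-identityʳ d))) ⟩
    E (d ℕ.+ (d ℕ.+ d))                           ≈⟨ ∙-cancelʳ (E d) _ _ (begin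
      E (d ℕ.+ (d ℕ.+ d)) +ₚ E d                     ≈⟨ E-shift {E} E-recurrent d d ⟨
      E d *ₚ E (d ℕ.+ d)                             ≈⟨ *-congʳ≋ (E d) (a-b+b≈a _ oneₚ) ⟨
      E d *ₚ ((E (d ℕ.+ d) +ₚ negₚ oneₚ) +ₚ oneₚ)    ≈⟨ solve 2 (λ e t → e :* (t :+ con 1) := t :* e :+ e) ≋-refl (E d) (E (d ℕ.+ d) +ₚ negₚ oneₚ) ⟩
      (E (d ℕ.+ d) +ₚ negₚ oneₚ) *ₚ E d +ₚ E d       ∎) ⟩
    (E (d ℕ.+ d) +ₚ negₚ oneₚ) *ₚ E d             ≈⟨ *-congʳ≋ (E (d ℕ.+ d) +ₚ negₚ oneₚ) (minPoly≋E n) ⟨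
    (E (d ℕ.+ d) +ₚ negₚ oneₚ) *ₚ minPoly n       ∎)
    where
    d = 2 ℕ.^ n
    open import Algebra.Properties.Group +-group using (∙-cancelʳ)

-- Chebyshev polynomials in the tridiagonal basis.

module TridiagonalBasis where
  open Composition using (E; E-recurrent)

  -- The r + 1 basis vectors, followed by δ (r + 1) = − δ r.
  δ : ∀ r → ℕ → Vec ℤ (suc r)
  δ zero    zero          = + 1 ∷ []
  δ zero    (suc zero)    = -[1+ 0 ] ∷ []
  δ zero    (suc (suc j)) = + 0 ∷ []
  δ (suc r) zero          = + 1 ∷ 𝟎
  δ (suc r) (suc j)       = + 0 ∷ δ r j

  δ-zero : ∀ r → δ r 0 ≡ e₀
  δ-zero zero    = ≡.refl
  δ-zero (suc r) = ≡.refl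

  S′-𝟎-0 : ∀ r → S′ (+ 0) (𝟎 {r}) ≡ 𝟎
  S′-𝟎-0 zero          = ≡.refl
  S′-𝟎-0 (suc zero)    = ≡.refl
  S′-𝟎-0 (suc (suc r)) = ≡.cong (+ 0 ∷_) (S′-𝟎-0 (suc r))

  S′-δ-zero : ∀ r a → S′ a (δ r 0) ≡ a ⊙ e₀ ⊕ δ r 1
  S′-δ-zero zero a = ≡.cong (_∷ []) (solve 1 (λ a → a :- con (+ 1) := a :* con (+ 1) :+ con -[1+ 0 ]) ≡.refl a)
    where open ℤ-Solver
  S′-δ-zero (suc zero) a = ≡.cong₂ (λ x y → x ∷ y ∷ [])
    (solve 1 (λ a → a :+ con (+ 0) := a :* con (+ 1) :+ con (+ 0)) ≡.refl a)
    (solve 1 (λ a → con (+ 1) := a :* con (+ 0) :+ con (+ 1)) ≡.refl a)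
    where open ℤ-Solver
  S′-δ-zero (suc (suc r)) a = ≡.cong₂ _∷_
    (solve 1 (λ a → a :+ con (+ 0) := a :* con (+ 1) :+ con (+ 0)) ≡.refl a)
    (≡.trans (≡.cong (+ 1 ∷_) (S′-𝟎-0 (suc r)))
      (≡.sym (≡.trans (≡.cong (_⊕ (+ 1 ∷ 𝟎)) (⊙-𝟎 a)) (⊕-identityˡ _))))
    where open ℤ-Solver

  S′-δ-suc : ∀ r j → suc j ℕ.≤ r → S′ (+ 0) (δ r (suc j)) ≡ δ r j ⊕ δ r (2 ℕ.+ j)
  S′-δ-suc (suc zero) zero le = ≡.refl
  S′-δ-suc (suc zero) (suc j) (ℕ.s≤s ())
  S′-δ-suc (suc (suc r)) zero le = ≡.cong (+ 1 ∷_)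
    (≡.trans (S′-δ-zero (suc r) (+ 0)) (≡.cong (_⊕ δ (suc r) 1) (⊙-zero e₀)))
  S′-δ-suc (suc (suc r)) (suc j) (ℕ.s≤s le) = ≡.cong (+ 0 ∷_) (S′-δ-suc (suc r) j le)

  S-δ-zero : ∀ r → S (δ r 0) ≡ δ r 0 ⊕ δ r 1
  S-δ-zero zero    = ≡.refl
  S-δ-zero (suc r) = ≡.trans (S′-δ-zero (suc r) (+ 1)) (≡.cong (_⊕ δ (suc r) 1) (⊙-one e₀))

  S-δ-suc : ∀ r j → suc j ℕ.≤ r → S (δ r (suc j)) ≡ δ r j ⊕ δ r (2 ℕ.+ j)
  S-δ-suc (suc r) j le = S′-δ-suc (suc r) j le

  δ-last : ∀ r → δ r r ⊕ δ r (suc r) ≡ 𝟎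
  δ-last zero    = ≡.refl
  δ-last (suc r) = ≡.cong (+ 0 ∷_) (δ-last r)

  ⊕-cancelʳ : ∀ {d} (u y z : Vec ℤ d) → y ⊕ u ≡ z ⊕ u → y ≡ z
  ⊕-cancelʳ []      []      []      e = ≡.refl
  ⊕-cancelʳ (a ∷ u) (x ∷ y) (w ∷ z) e = ≡.cong₂ _∷_
    (∙-cancelʳ a x w (≡.cong Vec.head e)) (⊕-cancelʳ u y z (≡.cong Vec.tail e))
    where open import Algebra.Properties.Group (AbelianGroup.group ℤₚ.+-0-abelianGroup) using (∙-cancelʳ)

  act-X : ∀ {d} (y : Vec ℤ d) → act Xₚ y ≡ S y
  act-X y = ≡.trans (≡.cong₂ _⊕_ (⊙-zero y) (≡.cong S (act-one y))) (⊕-identityˡ (S y))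

  act-E-recurrent : ∀ {d} (y : Vec ℤ d) j → act (E (2 ℕ.+ j)) y ⊕ act (E j) y ≡ S (act (E (suc j)) y)
  act-E-recurrent y j = ≡.trans (≡.sym (act-+ (E (2 ℕ.+ j)) (E j) y))
    (≡.trans (act-cong (E-recurrent j) y) (≡.trans (act-* Xₚ (E (suc j)) y) (act-X (act (E (suc j)) y))))

  ⊕-comm : ∀ {d} (y z : Vec ℤ d) → y ⊕ z ≡ z ⊕ y
  ⊕-comm []      []      = ≡.refl
  ⊕-comm (x ∷ y) (w ∷ z) = ≡.cong₂ _∷_ (ℤₚ.+-comm x w) (⊕-comm y z)

  -- With the basis cos((j+½)θ)/cos(θ/2) this is the sum formula for 2 cos((j+1)θ) cos(θ/2). The
  -- sign convention at the end of `δ` then makes E of the dimension act as 0 on `e₀`.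
  act-E : ∀ r j → j ℕ.≤ r → act (E (suc j)) e₀ ≡ δ r j ⊕ δ r (suc j)
  act-E r zero le = ≡.trans (act-X e₀) (≡.trans (≡.cong S (≡.sym (δ-zero r))) (S-δ-zero r))
  -- Here `E 0` is 2, which gives `δ r 0` twice: the reflection of index -1 to index 0.
  act-E r (suc zero) le = ⊕-cancelʳ (δ r 0 ⊕ δ r 0) _ _ (begin
    act (E 2) e₀ ⊕ (δ r 0 ⊕ δ r 0)        ≡⟨ ≡.cong (act (E 2) e₀ ⊕_) (≡.sym two) ⟩
    act (E 2) e₀ ⊕ act (E 0) e₀           ≡⟨ act-E-recurrent e₀ 0 ⟩
    S (act (E 1) e₀)                      ≡⟨ ≡.cong S (act-E r 0 ℕ.z≤n) ⟩
    S (δ r 0 ⊕ δ r 1)                     ≡⟨ S-⊕ (δ r 0) (δ r 1) ⟩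
    S (δ r 0) ⊕ S (δ r 1)                 ≡⟨ ≡.cong₂ _⊕_ (≡.trans (S-δ-zero r) (⊕-comm _ _)) (≡.trans (S-δ-suc r 0 le) (⊕-comm _ _)) ⟩
    (δ r 1 ⊕ δ r 0) ⊕ (δ r 2 ⊕ δ r 0)     ≡⟨ ⊕-interchange (δ r 1) (δ r 0) (δ r 2) (δ r 0) ⟩
    (δ r 1 ⊕ δ r 2) ⊕ (δ r 0 ⊕ δ r 0)     ∎)
    where
    open ≡.≡-Reasoning
    two : act (E 0) e₀ ≡ δ r 0 ⊕ δ r 0
    two = ≡.trans (act-+ oneₚ oneₚ e₀) (≡.cong₂ _⊕_ (≡.trans (act-one e₀) (≡.sym (δ-zero r))) (≡.trans (act-one e₀) (≡.sym (δ-zero r))))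
  act-E r (suc (suc j)) le = ⊕-cancelʳ (δ r j ⊕ δ r (suc j)) _ _ (begin
    act (E (3 ℕ.+ j)) e₀ ⊕ (δ r j ⊕ δ r (suc j))               ≡⟨ ≡.cong (act (E (3 ℕ.+ j)) e₀ ⊕_) (act-E r j (ℕₚ.≤-trans (ℕₚ.n≤1+n j) j<r)) ⟨
    act (E (3 ℕ.+ j)) e₀ ⊕ act (E (1 ℕ.+ j)) e₀                ≡⟨ act-E-recurrent e₀ (suc j) ⟩
    S (act (E (2 ℕ.+ j)) e₀)                                   ≡⟨ ≡.cong S (act-E r (suc j) j<r) ⟩
    S (δ r (suc j) ⊕ δ r (2 ℕ.+ j))                            ≡⟨ S-⊕ (δ r (suc j)) (δ r (2 ℕ.+ j)) ⟩
    S (δ r (suc j)) ⊕ S (δ r (2 ℕ.+ j))                        ≡⟨ ≡.cong₂ _⊕_ (≡.trans (S-δ-suc r j j<r) (⊕-comm _ _)) (≡.trans (S-δ-suc r (suc j) le) (⊕-comm _ _)) ⟩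
    (δ r (2 ℕ.+ j) ⊕ δ r j) ⊕ (δ r (3 ℕ.+ j) ⊕ δ r (suc j))    ≡⟨ ⊕-interchange (δ r (2 ℕ.+ j)) (δ r j) (δ r (3 ℕ.+ j)) (δ r (suc j)) ⟩
    (δ r (2 ℕ.+ j) ⊕ δ r (3 ℕ.+ j)) ⊕ (δ r j ⊕ δ r (suc j))    ∎)
    where
    open ≡.≡-Reasoning
    j<r = ℕₚ.≤-trans (ℕₚ.n≤1+n (suc j)) le

  act-E-rank : ∀ r → act (E (suc r)) (e₀ {r}) ≡ 𝟎
  act-E-rank r = ≡.trans (act-E r r ℕₚ.≤-refl) (δ-last r)

-- The ring ℤ[X] as a unit system.

module RealCyclotomic (k : ℕ) where
  open Composition
  open TridiagonalBasis
  open PrincipalQuotient polynomialRing (minPoly (suc k)) using (congruent; ≈⇒≡ₘ; quotientRing) public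

  d : ℕ
  d = 2 ℕ.^ suc k

  -- Since n ≥ 1, the dimension has the form 2 + r, as `S-diagonal` requires: in dimension 1 the
  -- first diagonal entry would also be the last.
  r : ℕ
  r = d ℕ.∸ 2

  d≡ : d ≡ 2 ℕ.+ r
  d≡ = ≡.sym (ℕₚ.m+[n∸m]≡n (ℕₚ.*-monoʳ-≤ 2 (ℕₚ.m^n>0 2 k)))

  open CommutativeRing quotientRing
  open import Algebra.Properties.Group +-group using (∙-cancelʳ)
  open import Algebra.Solver.Ring.NaturalCoefficients.Default commutativeSemiring using (solve; _:+_; _:*_; _:=_; con)
  open import Relation.Binary.Reasoning.Setoid setoid

  module Q = Chebyshev quotientRing Xₚ

  Q-E : ∀ i → Q.E i ≡ E i
  Q-E zero          = ≡.refl
  Q-E (suc zero)    = ≡.refl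
  Q-E (suc (suc i)) = ≡.cong₂ (λ p q → Xₚ *ₚ p +ₚ negₚ q) (Q-E (suc i)) (Q-E i)

  minPoly≈0 : minPoly (suc k) ≈ []
  minPoly≈0 = congruent oneₚ (≋-sym (*-identityˡ≋ (minPoly (suc k))))

  E-d : Q.E d ≈ 0#
  E-d = trans (reflexive (Q-E d)) (trans (≈⇒≡ₘ (≋-sym (minPoly≋E (suc k)))) minPoly≈0)

  g : Poly
  g = Xₚ *ₚ Xₚ *ₚ Xₚ -ₚ scale (+ 3) Xₚ

  σ-cong : ∀ {p q} → p ≈ q → σ p ≈ σ q
  σ-cong {p} {q} (congruent s e) = begin
    σ p                            ≈⟨ ≈⇒≡ₘ (compose-congˡ g e) ⟩
    σ (q +ₚ s *ₚ minPoly (suc k))  ≈⟨ ≈⇒≡ₘ (≋-trans (compose-+ q _ g) (+-cong≋ ≋-refl (compose-* s (minPoly (suc k)) g))) ⟩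
    σ q + σ s * σ (minPoly (suc k)) ≈⟨ +-congˡ {σ q} (*-congˡ {σ s} (trans (≈⇒≡ₘ (proj₂ (σ-minPoly (suc k)))) (trans (*-congˡ {proj₁ (σ-minPoly (suc k))} minPoly≈0) (zeroʳ (proj₁ (σ-minPoly (suc k))))))) ⟩
    σ q + σ s * 0#                 ≈⟨ +-congˡ {σ q} (zeroʳ (σ s)) ⟩
    σ q + 0#                       ≈⟨ +-identityʳ (σ q) ⟩
    σ q                            ∎

  compose-congʳ≈ : ∀ p {s t} → s ≈ t → compose p s ≈ compose p t
  compose-congʳ≈ []      e = refl
  compose-congʳ≈ (a ∷ p) e = +-congˡ {const a} (*-cong e (compose-congʳ≈ p e))

  3^d = 3^2^ k

  E-3^d : Q.E (3 ℕ.^ d) ≈ Xₚ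
  E-3^d = trans (reflexive (≡.cong Q.E (≡.trans (proj₂ 3^d) (≡.trans (ℕₚ.+-comm 1 _) (≡.cong (ℕ._+ 1) (ℕₚ.*-comm (4 ℕ.* d) _))))))
    (Q.periodic {d} E-d {Q.E} Q.E-recurrent (1 ℕ.+ 2 ℕ.* proj₁ 3^d) 1)

  σ-period : ∀ p → fold p σ d ≈ p
  σ-period p = begin
    fold p σ d                  ≈⟨ ≈⇒≡ₘ (σ^≋ d p) ⟩
    compose p (E (3 ℕ.^ d))     ≈⟨ compose-congʳ≈ p (trans (reflexive (≡.sym (Q-E (3 ℕ.^ d)))) E-3^d) ⟩
    compose p Xₚ                ≈⟨ ≈⇒≡ₘ (compose-Xʳ p) ⟩
    p                           ∎

  η : Poly
  η = oneₚ +ₚ Xₚ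

  open ConjugateProduct quotientRing (λ i → fold η σ i)

  σ^η : ∀ i → fold η σ i ≈ 1# + Q.E ([3^ i -1]/2 ℕ.+ suc [3^ i -1]/2)
  σ^η i = begin
    fold η σ i                                     ≈⟨ ≈⇒≡ₘ (σ^≋ i η) ⟩
    compose (oneₚ +ₚ Xₚ) (E (3 ℕ.^ i))             ≈⟨ ≈⇒≡ₘ (compose-+ oneₚ Xₚ (E (3 ℕ.^ i))) ⟩
    compose oneₚ (E (3 ℕ.^ i)) + compose Xₚ (E (3 ℕ.^ i)) ≈⟨ ≈⇒≡ₘ (+-cong≋ (compose-const (+ 1) (E (3 ℕ.^ i))) (compose-Xˡ (E (3 ℕ.^ i)))) ⟩
    1# + E (3 ℕ.^ i)                               ≡⟨ ≡.cong (λ p → oneₚ +ₚ p) (≡.trans (≡.sym (Q-E (3 ℕ.^ i))) (≡.cong Q.E (3^≡ i))) ⟩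
    1# + Q.E ([3^ i -1]/2 ℕ.+ suc [3^ i -1]/2)                   ∎

  -- The partial products telescope to sin(3ⁱθ/2)/sin(θ/2).
  ∏η : ∀ i → ∏ i (λ _ → 1) ≈ Q.W [3^ i -1]/2
  ∏η zero    = refl
  ∏η (suc i) = trans (*-cong (∏η i) (trans (*-identityʳ (fold η σ i)) (σ^η i))) (Q.W-triple [3^ i -1]/2)

  t-d : [3^ d -1]/2 ≡ proj₁ 3^d ℕ.* (4 ℕ.* d) ℕ.+ (d ℕ.+ (d ℕ.+ 0))
  t-d = t-value d (proj₁ 3^d) (≡.trans (≡.sym (3^≡ d)) (proj₂ 3^d))

  norm-η : ∏ d (λ _ → 1) ≈ - 1#
  norm-η = begin
    ∏ d (λ _ → 1)                                               ≈⟨ ∏η d ⟩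
    Q.W [3^ d -1]/2                                                   ≡⟨ ≡.cong Q.W t-d ⟩
    Q.W (proj₁ 3^d ℕ.* (4 ℕ.* d) ℕ.+ (d ℕ.+ (d ℕ.+ 0)))         ≈⟨ Q.periodic {d} E-d {Q.W} Q.W-recurrent (proj₁ 3^d) (d ℕ.+ (d ℕ.+ 0)) ⟩
    Q.W (d ℕ.+ (d ℕ.+ 0))                                       ≈⟨ Q.antiperiodic {d} E-d {Q.W} Q.W-recurrent 0 ⟩
    - 1#                                                        ∎

  φ : Poly → Vec ℤ (2 ℕ.+ r)
  φ p = act p e₀

  φ-minPoly : φ (minPoly (suc k)) ≡ 𝟎
  φ-minPoly = ≡.trans (act-cong (minPoly≋E (suc k)) e₀) (≡.trans (≡.cong (λ i → act (E i) e₀) d≡) (act-E-rank (suc r)))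

  φ-cong : ∀ {p q} → p ≈ q → φ p ≡ φ q
  φ-cong {p} {q} (congruent s e) = ≡.trans (act-cong e e₀) (≡.trans (act-+ q (s *ₚ minPoly (suc k)) e₀)
    (≡.trans (≡.cong (φ q ⊕_) (≡.trans (act-* s (minPoly (suc k)) e₀) (≡.trans (≡.cong (act s) φ-minPoly) (act-𝟎 s))))
      (⊕-identityʳ (φ q))))

  φ-adjoint : ∀ x y z → dot (φ (x *ₚ y)) (φ z) ≡ dot (φ y) (φ (x *ₚ z))
  φ-adjoint x y z = ≡.trans (≡.cong (λ v → dot v (φ z)) (act-* x y e₀))
    (≡.trans (act-symmetric x (φ y) (φ z)) (≡.cong (dot (φ y)) (≡.sym (act-* x z e₀))))

  ∥e₀∥² : ∥ e₀ {suc r} ∥² ≡ 1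
  ∥e₀∥² = ≡.cong suc (∥𝟎∥² (suc r))

  φ-bounded : ∀ x → ∃ λ B → ∀ y → ∥ φ (x *ₚ y) ∥² ℕ.≤ B ℕ.* ∥ φ y ∥²
  φ-bounded x with B , b ← act-bounded x = B , λ y → ≡.subst (λ v → ∥ v ∥² ℕ.≤ B ℕ.* ∥ φ y ∥²) (≡.sym (act-* x y e₀)) (b (φ y))

  -- With X_n = 2cos θ, G (j + 1) is cos((j+½)θ)/cos(θ/2).
  G : ℕ → Poly
  G zero          = oneₚ
  G (suc zero)    = oneₚ
  G (suc (suc i)) = Xₚ *ₚ G (suc i) +ₚ negₚ (G i)

  G-recurrent : Q.Recurrent G
  G-recurrent i = Q.a-b+b≈a _ (G i)

  -- At i = d the right side vanishes in the quotient, which is the boundary condition at the last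
  -- row of the matrix.
  G+G : ∀ i → G (suc i) + G i ≈ Q.E i
  G+G = Q.recurrent-unique
    (λ i → trans (solve 4 (λ a b u v → (a :+ b) :+ (u :+ v) := (a :+ u) :+ (b :+ v)) refl (G (3 ℕ.+ i)) (G (2 ℕ.+ i)) (G (1 ℕ.+ i)) (G i))
      (trans (+-cong (G-recurrent (suc i)) (G-recurrent i)) (sym (distribˡ Xₚ (G (2 ℕ.+ i)) (G (1 ℕ.+ i))))))
    Q.E-recurrent refl
    (trans (Q.a-b+b≈a (Xₚ * 1#) 1#) (*-identityʳ Xₚ))

  ψ′ : ∀ {e} → ℕ → Vec ℤ e → Poly
  ψ′ j []      = []
  ψ′ j (x ∷ y) = const x *ₚ G (suc j) +ₚ ψ′ (suc j) y

  const-*-const : ∀ a b → const (a ℤ.* b) ≈ const a * const b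
  const-*-const a b = sym (≈⇒≡ₘ (const-* a (const b)))

  ψ′-⊕ : ∀ {e} j (y z : Vec ℤ e) → ψ′ j (y ⊕ z) ≈ ψ′ j y + ψ′ j z
  ψ′-⊕ j []      []      = refl
  ψ′-⊕ j (x ∷ y) (w ∷ z) = trans (+-congˡ {(const x + const w) * G (suc j)} (ψ′-⊕ (suc j) y z))
    (solve 5 (λ a b g u v → (a :+ b) :* g :+ (u :+ v) := (a :* g :+ u) :+ (b :* g :+ v)) refl (const x) (const w) (G (suc j)) (ψ′ (suc j) y) (ψ′ (suc j) z))

  ψ′-⊙ : ∀ {e} j c (y : Vec ℤ e) → ψ′ j (c ⊙ y) ≈ const c * ψ′ j y
  ψ′-⊙ j c []      = sym (zeroʳ (const c))
  ψ′-⊙ j c (x ∷ y) = trans (+-cong (*-congʳ {G (suc j)} (const-*-const c x)) (ψ′-⊙ (suc j) c y))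
    (solve 4 (λ c a g u → (c :* a) :* g :+ c :* u := c :* (a :* g :+ u)) refl (const c) (const x) (G (suc j)) (ψ′ (suc j) y))

  const-0 : const (+ 0) ≈ 0#
  const-0 = ≈⇒≡ₘ (mk λ { zero → ≡.refl ; (suc i) → ≡.refl })

  ψ′-𝟎 : ∀ e j → ψ′ j (𝟎 {e}) ≈ 0#
  ψ′-𝟎 zero    j = refl
  ψ′-𝟎 (suc e) j = trans (+-cong {const (+ 0) * G (suc j)} {0#} (*-congʳ {G (suc j)} {const (+ 0)} {0#} const-0) (ψ′-𝟎 e (suc j))) (+-identityˡ 0#)

  -- Summation by parts again: the recurrence of `G` moves X onto the coefficients. The hypothesis
  -- on the last two values of `G` accounts for the corner -1 of the matrix.
  ψ′-S′ : ∀ {e} j a x (y : Vec ℤ e) → G (2 ℕ.+ (e ℕ.+ j)) + G (1 ℕ.+ (e ℕ.+ j)) ≈ 0# →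
    Xₚ * ψ′ j (x ∷ y) + const a * G (suc j) ≈ ψ′ j (S′ a (x ∷ y)) + const x * G j
  ψ′-S′ j a x [] end = begin
    Xₚ * (const x * G₁ + 0#) + const a * G₁
      ≈⟨ solve 4 (λ X x a g → X :* (x :* g :+ con 0) :+ a :* g := x :* (X :* g) :+ a :* g) refl Xₚ (const x) (const a) G₁ ⟩
    const x * (Xₚ * G₁) + const a * G₁
      ≈⟨ +-cong (*-congˡ {const x} (sym (G-recurrent j))) (*-congʳ {G₁} {const a} {const ((a ℤ.- x) ℤ.+ x)} (≈⇒≡ₘ (∷-cong≋ {p = []} a≡ ≋-refl))) ⟩
    const x * (G₂ + G₀) + (const (a ℤ.- x) + const x) * G₁
      ≈⟨ solve 5 (λ x g₂ g₀ b g₁ → x :* (g₂ :+ g₀) :+ (b :+ x) :* g₁ := (b :* g₁ :+ x :* g₀) :+ x :* (g₂ :+ g₁)) refl (const x) G₂ G₀ (const (a ℤ.- x)) G₁ ⟩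
    (const (a ℤ.- x) * G₁ + const x * G₀) + const x * (G₂ + G₁)
      ≈⟨ +-congˡ {const (a ℤ.- x) * G₁ + const x * G₀} (trans (*-congˡ {const x} end) (zeroʳ (const x))) ⟩
    (const (a ℤ.- x) * G₁ + const x * G₀) + 0#
      ≈⟨ solve 2 (λ u v → (u :+ v) :+ con 0 := (u :+ con 0) :+ v) refl (const (a ℤ.- x) * G₁) (const x * G₀) ⟩
    (const (a ℤ.- x) * G₁ + 0#) + const x * G₀ ∎
    where
    G₀ = G j
    G₁ = G (suc j)
    G₂ = G (suc (suc j))
    a≡ : a ≡ (a ℤ.- x) ℤ.+ x
    a≡ = ≡.sym (≡.trans (ℤₚ.+-assoc a (ℤ.- x) x) (≡.trans (≡.cong (λ z → a ℤ.+ z) (ℤₚ.+-inverseˡ x)) (ℤₚ.+-identityʳ a)))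
  ψ′-S′ {suc e} j a x (y ∷ z) end = begin
    Xₚ * (const x * G₁ + Ψ) + const a * G₁
      ≈⟨ solve 5 (λ X x g u a → X :* (x :* g :+ u) :+ a :* g := (x :* (X :* g) :+ X :* u) :+ a :* g) refl Xₚ (const x) G₁ Ψ (const a) ⟩
    (const x * (Xₚ * G₁) + Xₚ * Ψ) + const a * G₁
      ≈⟨ +-congʳ {const a * G₁} (+-congʳ {Xₚ * Ψ} (*-congˡ {const x} (sym (G-recurrent j)))) ⟩
    (const x * (G₂ + G₀) + Xₚ * Ψ) + const a * G₁
      ≈⟨ solve 5 (λ x g₂ g₀ u v → (x :* (g₂ :+ g₀) :+ u) :+ v := (u :+ x :* g₂) :+ (x :* g₀ :+ v)) refl (const x) G₂ G₀ (Xₚ * Ψ) (const a * G₁) ⟩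
    (Xₚ * Ψ + const x * G₂) + (const x * G₀ + const a * G₁)
      ≈⟨ +-congʳ {const x * G₀ + const a * G₁} (ψ′-S′ (suc j) x y z (≡.subst (λ i → G (suc i) + G i ≈ 0#) (≡.cong suc (≡.sym (ℕₚ.+-suc e j))) end)) ⟩
    (ψ′ (suc j) (S′ x (y ∷ z)) + const y * G₁) + (const x * G₀ + const a * G₁)
      ≈⟨ solve 5 (λ s y g₁ u a → (s :+ y :* g₁) :+ (u :+ a :* g₁) := ((a :+ y) :* g₁ :+ s) :+ u) refl (ψ′ (suc j) (S′ x (y ∷ z))) (const y) G₁ (const x * G₀) (const a) ⟩
    ((const a + const y) * G₁ + ψ′ (suc j) (S′ x (y ∷ z))) + const x * G₀ ∎
    where
    G₀ = G j
    G₁ = G (suc j)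
    G₂ = G (suc (suc j))
    Ψ = ψ′ (suc j) (y ∷ z)

  ψ : Vec ℤ (2 ℕ.+ r) → Poly
  ψ = ψ′ 0

  ψ-S : ∀ y → ψ (S y) ≈ Xₚ * ψ y
  -- As `G 0` and `G 1` are both 1, the two boundary terms are equal and cancel.
  ψ-S (x ∷ y) = sym (∙-cancelʳ (const x * 1#) _ _ (ψ′-S′ 0 x x y end))
    where
    end : G (2 ℕ.+ (suc r ℕ.+ 0)) + G (1 ℕ.+ (suc r ℕ.+ 0)) ≈ 0#
    end = trans (G+G (suc (suc r ℕ.+ 0))) (trans (reflexive (≡.cong Q.E (≡.trans (≡.cong suc (ℕₚ.+-identityʳ (suc r))) (≡.sym d≡)))) E-d)

  ψ-e₀ : ψ e₀ ≈ 1#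
  ψ-e₀ = trans (+-congˡ {1# * 1#} (ψ′-𝟎 (suc r) 1)) (trans (+-identityʳ (1# * 1#)) (*-identityˡ 1#))

  ψ∘φ : ∀ p → ψ (φ p) ≈ p
  ψ∘φ []      = ψ′-𝟎 (2 ℕ.+ r) 0
  ψ∘φ (a ∷ p) = begin
    ψ (a ⊙ e₀ ⊕ S (φ p))           ≈⟨ ψ′-⊕ 0 (a ⊙ e₀) (S (φ p)) ⟩
    ψ (a ⊙ e₀) + ψ (S (φ p))       ≈⟨ +-cong (trans (ψ′-⊙ 0 a (e₀ {suc r})) (trans (*-congˡ {const a} ψ-e₀) (*-identityʳ (const a)))) (trans (ψ-S (φ p)) (*-congˡ {Xₚ} (ψ∘φ p))) ⟩
    const a + Xₚ * p               ≈⟨ ≈⇒≡ₘ (≋-sym (∷≋ a p)) ⟩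
    a ∷ p                          ∎

  φ-injective : ∀ {p q} → φ p ≡ φ q → p ≈ q
  φ-injective {p} {q} e = trans (sym (ψ∘φ p)) (trans (reflexive (≡.cong ψ e)) (ψ∘φ q))

  -- From w² = 1 the vector of w has square norm 1, so it is a basis vector up to sign. Moreover Xw
  -- paired with w equals X paired with 1, the corner entry 1 of the matrix, and this singles out
  -- the first basis vector.
  √1 : ∀ w → w * w ≈ 1# → w ≈ 1# ⊎ w ≈ - 1#
  √1 w e = go (S-diagonal (φ w) norm₁ diagonal₁)
    where
    dot-φ : ∀ p → dot (φ p) (φ w) ≡ dot (φ (w *ₚ p)) e₀
    dot-φ p = ≡.sym (≡.trans (≡.cong (λ v → dot v e₀) (act-* w p e₀)) (act-symmetric w (φ p) e₀))
    norm₁ : ∥ φ w ∥² ≡ 1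
    norm₁ = ℤₚ.+-injective (≡.trans (+∥∥² (φ w)) (≡.trans (dot-φ w) (≡.trans
      (≡.cong (λ v → dot v e₀) (≡.trans (φ-cong e) (act-one e₀))) (≡.trans (≡.sym (+∥∥² (e₀ {suc r}))) (≡.cong +_ ∥e₀∥²)))))
    wXw : w * (Xₚ * w) ≈ Xₚ
    wXw = trans (solve 2 (λ w X → w :* (X :* w) := X :* (w :* w)) refl w Xₚ) (trans (*-congˡ {Xₚ} e) (*-identityʳ Xₚ))
    diagonal₁ : dot (S (φ w)) (φ w) ≡ + 1
    diagonal₁ = ≡.trans (≡.cong (λ v → dot v (φ w)) (≡.sym (≡.trans (act-* Xₚ w e₀) (act-X (φ w)))))
      (≡.trans (dot-φ (Xₚ *ₚ w)) (≡.trans (≡.cong (λ v → dot v e₀) (≡.trans (φ-cong wXw) (act-X e₀)))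
        (≡.cong (λ z → + 1 ℤ.+ z) (≡.trans (dot-sym (S′ {suc r} (+ 1) 𝟎) 𝟎) (dot-𝟎ˡ (S′ {suc r} (+ 1) 𝟎))))))
    go : φ w ≡ e₀ ⊎ φ w ≡ (ℤ.- (+ 1)) ⊙ e₀ → w ≈ 1# ⊎ w ≈ - 1#
    go (inj₁ f) = inj₁ (φ-injective (≡.trans f (≡.sym (act-one e₀))))
    go (inj₂ f) = inj₂ (φ-injective (≡.trans f (≡.sym (≡.trans (act-scale (ℤ.- (+ 1)) oneₚ e₀) (≡.cong ((ℤ.- (+ 1)) ⊙_) (act-one e₀))))))

  unitSystem : UnitSystem
  unitSystem = record
    { ring = quotientRing ; σ = σ ; σ-cong = σ-cong
    ; σ-* = λ x y → ≈⇒≡ₘ (compose-* x y g)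
    ; σ-1 = ≈⇒≡ₘ (compose-const (+ 1) g)
    ; log-d = k ; η = η ; σ-period = σ-period ; norm-η = norm-η
    ; rank = 2 ℕ.+ r ; φ = φ ; φ-cong = φ-cong
    ; φ-+ = λ x y → act-+ x y e₀
    ; φ-neg = λ x → act-scale (ℤ.- (+ 1)) x e₀
    ; φ-adjoint = φ-adjoint
    ; φ-1 = ≡.trans (≡.cong ∥_∥² (act-one (e₀ {suc r}))) ∥e₀∥²
    ; φ-bounded = φ-bounded ; ψ = ψ ; ψ∘φ = ψ∘φ ; √1 = √1 }

open import Data.Nat using (_+_; _*_; _^_; _≤_; _<_; z≤n; s≤s)

-- Translation to the given definitions.

module Translation (k : ℕ) where
  open RealCyclotomic k using (unitSystem; congruent)
  open UnitSystem unitSystem using (half; ∏) renaming (d to degree; σ^ to σ^′)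
  open CommutativeRing (UnitSystem.ring unitSystem)
    using (_≈_; 1#; *-congˡ; *-identityˡ; *-identityʳ; *-assoc; reflexive; setoid; commutativeSemiring)
    renaming (refl to ≈-refl; sym to ≈-sym; trans to ≈-trans; _*_ to _·_)
  open Saturation unitSystem
  open import Algebra.Properties.CommutativeSemiring.Exp commutativeSemiring using () renaming (_^_ to _^^_)
  open import Algebra.Properties.Group (CommutativeRing.+-group polynomialRing) using (x∙y⁻¹≈ε⇒x≈y; x≈y⇒x∙y⁻¹≈ε)
  open import Algebra.Properties.AbelianGroup (CommutativeRing.+-abelianGroup polynomialRing) using (⁻¹-∙-comm)
  open import Relation.Binary.Reasoning.Setoid setoid

  n : ℕ
  n = suc k

  IsZero⇒≋[] : ∀ {p} → IsZeroₚ p → p ≋ []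
  IsZero⇒≋[] []       .at i       = ≡.refl
  IsZero⇒≋[] (e ∷ es) .at zero    = e
  IsZero⇒≋[] (e ∷ es) .at (suc i) = at (IsZero⇒≋[] es) i

  ≋[]⇒IsZero : ∀ p → p ≋ [] → IsZeroₚ p
  ≋[]⇒IsZero []      e = []
  ≋[]⇒IsZero (a ∷ p) e = at e 0 ∷ ≋[]⇒IsZero p (mk λ i → at e (suc i))

  regroup : ∀ p q s → p -ₚ q -ₚ s ≋ p -ₚ (q +ₚ s)
  regroup p q s = ≋-trans (+-assoc≋ p (negₚ q) (negₚ s)) (+-cong≋ {p} ≋-refl (⁻¹-∙-comm q s))

  to≈ : ∀ {p q} → p ≈[ n ] q → p ≈ q
  to≈ {p} {q} (s , z) = congruent s (x∙y⁻¹≈ε⇒x≈y p _ (≋-trans (≋-sym (regroup p q _)) (IsZero⇒≋[] z)))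

  from≈ : ∀ {p q} → p ≈ q → p ≈[ n ] q
  from≈ {p} {q} (congruent s e) = s , ≋[]⇒IsZero _ (≋-trans (regroup p q _) (x≈y⇒x∙y⁻¹≈ε e))

  σ^≡ : ∀ i p → σ^ i p ≡ σ^′ i p
  σ^≡ zero    p = ≡.refl
  σ^≡ (suc i) p = ≡.cong σ (σ^≡ i p)

  powₚ≡ : ∀ p m → powₚ p m ≡ p ^^ m
  powₚ≡ p zero    = ≡.refl
  powₚ≡ p (suc m) = ≡.cong (p *ₚ_) (powₚ≡ p m)

  to-Relative : ∀ {u} → InRE n u → Relative u
  to-Relative {u} (_ , e) = ≈-trans (*-congˡ {u} (reflexive (≡.sym (σ^≡ half u)))) (to≈ e)

  -- The inverse demanded by `IsUnit` is the conjugate of u under σ to the power `half`.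
  from-Relative : ∀ {u} → Relative u → InRE n u
  from-Relative {u} e = (σ^′ half u , from≈ e) , from≈ (≈-trans (*-congˡ {u} (reflexive (σ^≡ half u))) e)

  prodWith : (ℤ → ℕ) → ℕ → List ℤ → Poly
  prodWith x i []       = oneₚ
  prodWith x i (a ∷ as) = powₚ (circ i) (x a) *ₚ prodWith x (suc i) as

  prodPos≡ : ∀ i as → prodPos i as ≡ prodWith posExp i as
  prodPos≡ i []       = ≡.refl
  prodPos≡ i (a ∷ as) = ≡.cong (powₚ (circ i) (posExp a) *ₚ_) (prodPos≡ (suc i) as)

  prodNeg≡ : ∀ i as → prodNeg i as ≡ prodWith negExp i as
  prodNeg≡ i []       = ≡.refl
  prodNeg≡ i (a ∷ as) = ≡.cong (powₚ (circ i) (negExp a) *ₚ_) (prodNeg≡ (suc i) as)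

  ∏-prodWith : ∀ x (e : ℕ → ℕ) i as → (∀ j → e (j + i) ≡ x (coeff as j)) →
    ∏ i e · prodWith x i as ≈ ∏ (length as + i) e
  ∏-prodWith x e i []       f = *-identityʳ (∏ i e)
  ∏-prodWith x e i (a ∷ as) f = begin
    ∏ i e · (powₚ (circ i) (x a) · prodWith x (suc i) as)
      ≈⟨ *-assoc (∏ i e) (powₚ (circ i) (x a)) (prodWith x (suc i) as) ⟨
    ∏ i e · powₚ (circ i) (x a) · prodWith x (suc i) as
      ≡⟨ ≡.cong (λ p → ∏ i e *ₚ p *ₚ prodWith x (suc i) as) (≡.trans (powₚ≡ (circ i) (x a)) (≡.cong₂ _^^_ (σ^≡ i _) (≡.sym (f 0)))) ⟩
    ∏ (suc i) e · prodWith x (suc i) as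
      ≈⟨ ∏-prodWith x e (suc i) as (λ j → ≡.trans (≡.cong e (ℕₚ.+-suc j i)) (f (suc j))) ⟩
    ∏ (length as + suc i) e
      ≡⟨ ≡.cong (λ m → ∏ m e) (ℕₚ.+-suc (length as) i) ⟩
    ∏ (suc (length as + i)) e ∎

  prodWith≈P : ∀ x (a : Vec ℤ degree) → prodWith x 0 (toList a) ≈ P (λ i → x (coeff (toList a) i))
  prodWith≈P x a = begin
    prodWith x 0 (toList a)              ≈⟨ *-identityˡ (prodWith x 0 (toList a)) ⟨
    1# · prodWith x 0 (toList a)         ≈⟨ ∏-prodWith x e 0 (toList a) (λ j → ≡.cong e (ℕₚ.+-identityʳ j)) ⟩
    ∏ (length (toList a) + 0) e          ≡⟨ ≡.cong (λ m → ∏ m e) (≡.trans (ℕₚ.+-identityʳ _) (Vecₚ.length-toList a)) ⟩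
    ∏ degree e                           ∎
    where e = λ i → x (coeff (toList a) i)

  -- Only the exponents below the degree enter the product, so reading e modulo the degree gives a
  -- periodic sequence with the same product.
  P-circular : ∀ e → Circular (P e)
  P-circular e = (λ i → e (i % degree)) , (λ i → ≡.cong e (≡.trans
      (≡.cong (_% degree) (≡.trans (ℕₚ.+-comm degree i) (≡.cong (λ m → i + m) (≡.sym (ℕₚ.*-identityˡ degree))))) ([m+kn]%n≡m%n i 1 degree))) ,
    ∏-cong degree (λ i i<d → ≡.cong e (≡.sym (m<n⇒m%n≡m i<d)))

  sign-circular : ∀ s {u} → Circular u → Circular (signₚ s · u)
  sign-circular true  {u} c = Circular-resp (≈-sym (*-identityˡ u)) c
  sign-circular false     c = Circular-neg c

  ·-circular⇒∼ : ∀ u v p → Circular p → u ≈ v · p → u ∼ v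
  ·-circular⇒∼ u v p (b , pb , f) e = b , pb , ≈-trans e (*-congˡ {v} {p} {P b} f)

  -- The product on the side of u is circular and can be divided out by `∼-sym`; the sign is
  -- absorbed by the norm of η.
  to-Circular : ∀ {u} → InC n u → Circular u
  to-Circular {u} (s , a , e) =
    ∼-circular {u} {w} (∼-sym {w} {u} (·-circular⇒∼ w u (P neg-exponents) (P-circular neg-exponents) w≈)) (sign-circular s (P-circular pos-exponents))
    where
    neg-exponents = λ i → negExp (coeff (toList a) i)
    pos-exponents = λ i → posExp (coeff (toList a) i)
    w = signₚ s · P pos-exponents
    w≈ : w ≈ u · P neg-exponents
    w≈ = begin
      signₚ s · P pos-exponents          ≈⟨ *-congˡ {signₚ s} (≈-trans (reflexive (prodPos≡ 0 (toList a))) (prodWith≈P posExp a)) ⟨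
      signₚ s · prodPos 0 (toList a)     ≈⟨ to≈ e ⟨
      u · prodNeg 0 (toList a)           ≈⟨ *-congˡ {u} (≈-trans (reflexive (prodNeg≡ 0 (toList a))) (prodWith≈P negExp a)) ⟩
      u · P neg-exponents                ∎

  coeff-tabulate : ∀ m (a : ℕ → ℕ) i → i < m → coeff (toList (tabulate {n = m} (λ j → + a (toℕ j)))) i ≡ + a i
  coeff-tabulate (suc m) a zero    i<m       = ≡.refl
  coeff-tabulate (suc m) a (suc i) (s≤s i<m) = coeff-tabulate m (λ j → a (suc j)) i i<m

  -- Natural exponents with sign +1 suffice, which makes the product of negative powers equal to 1.
  from-Circular : ∀ {u} → Circular u → InC n u
  from-Circular {u} (a , pa , e) = true , v , from≈ (begin
    u · prodNeg 0 (toList v)                                 ≈⟨ *-congˡ {u} (≈-trans (reflexive (prodNeg≡ 0 (toList v))) (prodWith≈P negExp v)) ⟩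
    u · P (λ i → negExp (coeff (toList v) i))                ≈⟨ *-congˡ {u} (≈-trans (∏-cong degree (λ i i<d → ≡.cong negExp (coeff-tabulate degree a i i<d))) (∏-0 degree)) ⟩
    u · 1#                                                   ≈⟨ *-identityʳ u ⟩
    u                                                        ≈⟨ e ⟩
    P a                                                      ≈⟨ ∏-cong degree (λ i i<d → ≡.cong posExp (≡.sym (coeff-tabulate degree a i i<d))) ⟩
    P (λ i → posExp (coeff (toList v) i))                    ≈⟨ ≈-trans (reflexive (prodPos≡ 0 (toList v))) (prodWith≈P posExp v) ⟨
    prodPos 0 (toList v)                                     ≈⟨ *-identityˡ (prodPos 0 (toList v)) ⟨
    oneₚ · prodPos 0 (toList v)                              ∎)
    where
    v : Vec ℤ degree
    v = tabulate (λ j → + a (toℕ j))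

  to-∼ : ∀ u v → SameCoset n u v → u ∼ v
  to-∼ u v (a , (_ , c) , e) = ·-circular⇒∼ u v a (to-Circular {a} c) (to≈ {u} {v *ₚ a} e)

  from-∼ : ∀ u v → Relative u → Relative v → u ∼ v → SameCoset n u v
  from-∼ u v ru rv (a , pa , e) = P a ,
    (from-Relative {P a} (Relative-quotient {u} {v} {P a} ru rv e) , from-Circular {P a} (a , pa , ≈-refl {P a})) , from≈ {u} {v *ₚ P a} e

  to-primary : ∀ l u → LPrimary l n u → Relative u × ∃ λ j → Circular (u ^^ (l ^ j))
  to-primary l u (re , j , _ , c) = to-Relative {u} re , j ,
    ≡.subst Circular (powₚ≡ u (l ^ j)) (to-Circular {powₚ u (l ^ j)} c)

  from-primary : ∀ l u j → Relative u → Circular (u ^^ (l ^ j)) → LPrimary l n u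
  from-primary l u j ru c = from-Relative {u} ru , j ,
    ≡.subst (InA n) (≡.sym (powₚ≡ u (l ^ j)))
      (from-Relative {u ^^ (l ^ j)} (Relative-^ (l ^ j) {u} ru) , from-Circular {u ^^ (l ^ j)} c)

  1-circular : Circular 1#
  1-circular = (λ _ → 0) , (λ _ → ≡.refl) , ≈-sym (∏-0 degree)

  circular⇒∼1 : ∀ u → Circular u → u ∼ 1#
  circular⇒∼1 u c = ·-circular⇒∼ u 1# u c (≈-sym (*-identityˡ u))

  order-2 : LPrimaryOrder 2 n 1
  order-2 = oneₚ ∷ [] ,
    (λ { Fin.zero → from-primary 2 oneₚ 0 Relative-1 (Circular-^ 1 {1#} 1-circular) }) ,
    (λ { Fin.zero Fin.zero _ → ≡.refl }) ,
    λ u p → Fin.zero , from-∼ u oneₚ (proj₁ (to-primary 2 u p)) Relative-1 (circular⇒∼1 u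
      (circular-2^-saturated (proj₁ (proj₂ (to-primary 2 u p))) u (proj₂ (proj₂ (to-primary 2 u p)))))

  module _ (l q : ℕ) .{{_ : NonZero l}} (odd : l ^ F ≡ suc (2 * q)) where
    open OddPrimaryPart unitSystem q using (Enumerated; order)

    enumerated : ∀ m → Enumerated m → LPrimaryOrder l n m
    enumerated m (reps , primary , distinct , complete) = reps ,
      (λ i → from-primary l (Vec.lookup reps i) F (proj₁ (primary i))
        (≡.subst (λ M → Circular (Vec.lookup reps i ^^ M)) (≡.sym odd) (proj₂ (primary i)))) ,
      (λ i j s → distinct i j (to-∼ (Vec.lookup reps i) (Vec.lookup reps j) s)) ,
      λ u p → represented u (to-primary l u p)
      where
      represented : ∀ u → (Relative u × ∃ λ j → Circular (u ^^ (l ^ j))) → ∃ λ i → SameCoset n u (Vec.lookup reps i)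
      represented u (ru , j , c) = proj₁ class , from-∼ u (Vec.lookup reps (proj₁ class)) ru (proj₁ (primary (proj₁ class))) (proj₂ class)
        where
        class : ∃ λ i → u ∼ Vec.lookup reps i
        class = complete u ru (≡.subst (λ M → Circular (u ^^ M)) odd (exponent-bound l u j c))

    order-odd : ∃ λ m → LPrimaryOrder l n m × ∃ λ r → m ≡ 1 + r * 2 ^ n
    order-odd = proj₁ order , enumerated (proj₁ order) (proj₁ (proj₂ order)) , proj₂ (proj₂ order)

odd-^ : ∀ l c → l ≡ suc (2 * c) → ∀ j → ∃ λ q → l ^ j ≡ suc (2 * q)
odd-^ l c e zero = 0 , ≡.refl
odd-^ l c e (suc j) with q , f ← odd-^ l c e j = c + q + 2 * (c * q) , ≡.trans (≡.cong₂ _*_ e f)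
  (solve 2 (λ c q → (con 1 :+ con 2 :* c) :* (con 1 :+ con 2 :* q) := con 1 :+ con 2 :* (c :+ q :+ con 2 :* (c :* q))) ≡.refl c q)
  where open ℕ-Solver

theorem4p2 : (l n : ℕ) → Prime l → 1 ≤ n →
    ∃ λ m → LPrimaryOrder l n m × (∃ λ q → m ≡ 1 + q * 2 ^ n)
theorem4p2 l (suc k) p (s≤s z≤n) with even⊎odd l
... | inj₂ (c , e) = Translation.order-odd k l (proj₁ M) {{prime⇒nonZero p}} (proj₂ M)
  where M = odd-^ l c e (Saturation.F (RealCyclotomic.unitSystem k))
... | inj₁ 2∣l with prime⇒irreducible p 2∣l
...   | inj₁ ()
...   | inj₂ ≡.refl = 1 , Translation.order-2 k , 0 , ≡.refl
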